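{- Let $p\ge 3$ be a prime, let $N$ be a positive integer coprime to $p$, and let $\alpha\ge 0$ be an integer. (1) If $p\equiv 1 \pmod 5$, then $\overline{p}(5p^{10\alpha+9}N)\equiv 0 \pmod 5$. (2) If $p\equiv 2,3,$ or $4 \pmod 5$, then $\overline{p}(5p^{8\alpha+7}N)\equiv 0 \pmod 5$.
   Context: An overpartition of a nonnegative integer $n$ is a partition of $n$ in which the first occurrence of each distinct part may (or may not) be overlined; $\overline{p}(n)$ denotes the number of overpartitions of $n$ (with $\overline{p}(0)=1$). Equivalently, $\sum_{n\ge0}\overline{p}(n)q^n=\prod_{k\ge1}\frac{1+q^k}{1-q^k}$. -}

module Defs where

open import Data.Bool using (Bool; true; false; T)
open import Data.Bool.Properties using (T?)
open import Data.List using (List; []; _∷_; map; concatMap; filter; length)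
open import Data.List.Relation.Binary.Disjoint.Propositional using (Disjoint)
open import Data.List.Membership.Propositional using (_∈_; lose)
open import Data.List.Membership.Propositional.Properties using (∈-concatMap⁺; ∈-filter⁺; ∈-filter⁻)
open import Data.List.Relation.Unary.All as All using (All; []; _∷_)
import Data.List.Relation.Unary.All.Properties as All
open import Data.List.Relation.Unary.AllPairs as AllPairs using (AllPairs; []; _∷_; allPairs?)
import Data.List.Relation.Unary.AllPairs.Properties as AllPairs
open import Data.List.Relation.Unary.Any using (here; there)
open import Data.List.Relation.Unary.Unique.Propositional using (Unique)
import Data.List.Relation.Unary.Unique.Propositional.Properties as Unique
open import Data.Nat using (ℕ; zero; suc; _≤_; z≤n; s≤s; _≤?_; _≟_)
open import Data.Nat.ListAction using (sum)
open import Data.Nat.Properties using (suc-injective)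
open import Data.Product using (_×_; _,_; proj₂)
open import Function.Bundles using (_⇔_; mk⇔)
open import Relation.Binary.PropositionalEquality using (_≡_; _≢_; refl; sym; trans)
open import Relation.Nullary using (Dec; ¬?)
open import Relation.Nullary.Decidable using (map′; _×-dec_; _→-dec_)

record Part : Set where
  constructor part
  field
    size      : ℕ
    overlined : Bool

open Part public

-- The requirement on a part a listed anywhere before a part b: sizes do not
-- increase, and b may be overlined only if a is not an earlier occurrence of
-- the same size.
_Precedes_ : Part → Part → Set
a Precedes b = size b ≤ size a × (T (overlined b) → size a ≢ size b)

record IsOverpartition (n : ℕ) (π : List Part) : Set where
  field
    positive : All (λ a → 1 ≤ size a) π
    ordered  : AllPairs _Precedes_ π
    total    : sum (map size π) ≡ n

isOverpartition? : ∀ n π → Dec (IsOverpartition n π)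
isOverpartition? n π = map′
  (λ (p , o , t) → record { positive = p ; ordered = o ; total = t })
  (λ w → let open IsOverpartition w in positive , ordered , total)
  (All.all? (λ a → 1 ≤? size a) π
    ×-dec allPairs? precedes? π
    ×-dec sum (map size π) ≟ n)
  where
  precedes? : ∀ a b → Dec (a Precedes b)
  precedes? a b =
    (size b ≤? size a) ×-dec (T? (overlined b) →-dec ¬? (size a ≟ size b))

-- A composition of n + 1 (an ordered sum of positive parts, here with
-- arbitrary overlining) arises from exactly one composition of n, either by
-- prepending a part 1 or by adding 1 to the first part.
enlarge : List Part → List (List Part)
enlarge (part (suc s) o ∷ π) = (part (suc (suc s)) o ∷ π) ∷ []
enlarge _                    = []

extend : List Part → List (List Part)
extend π = (part 1 false ∷ π) ∷ (part 1 true ∷ π) ∷ enlarge π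

compositions : ℕ → List (List Part)
compositions zero    = [] ∷ []
compositions (suc n) = concatMap extend (compositions n)

overpartitions : ℕ → List (List Part)
overpartitions n = filter (isOverpartition? n) (compositions n)

p̄ : ℕ → ℕ
p̄ n = length (overpartitions n)

-- The list overpartitions n contains every overpartition of n exactly once:
-- see ∈-overpartitions and overpartitions-unique below.

private
  unextend : List Part → List Part
  unextend (part 1 o ∷ π)             = π
  unextend (part (suc (suc s)) o ∷ π) = part (suc s) o ∷ π
  unextend _                          = []

  unextend-extend : ∀ {π} ρ → π ∈ extend ρ → unextend π ≡ ρ
  unextend-extend ρ (here refl)                                       = refl
  unextend-extend ρ (there (here refl))                               = refl
  unextend-extend (part (suc s) o ∷ ρ) (there (there (here refl)))    = refl

  extend-unique : ∀ π → Unique (extend π)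
  extend-unique []                     = ((λ ()) ∷ []) ∷ [] ∷ []
  extend-unique (part zero o ∷ π)      = ((λ ()) ∷ []) ∷ [] ∷ []
  extend-unique (part (suc s) o ∷ π)   =
    ((λ ()) ∷ (λ ()) ∷ []) ∷ ((λ ()) ∷ []) ∷ [] ∷ []

  extend-disjoint : ∀ {ρ σ} → ρ ≢ σ → Disjoint (extend ρ) (extend σ)
  extend-disjoint {ρ} {σ} ρ≢σ (∈ρ , ∈σ) =
    ρ≢σ (trans (sym (unextend-extend ρ ∈ρ)) (unextend-extend σ ∈σ))

  compositions-unique : ∀ n → Unique (compositions n)
  compositions-unique zero    = [] ∷ []
  compositions-unique (suc n) = Unique.concat⁺
    (All.map⁺ (All.universal extend-unique (compositions n)))
    (AllPairs.map⁺ (AllPairs.map extend-disjoint (compositions-unique n)))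

  ∈-compositions : ∀ n π → All (λ a → 1 ≤ size a) π →
                   sum (map size π) ≡ n → π ∈ compositions n
  ∈-compositions zero    []                          _        _ = here refl
  ∈-compositions zero    (part zero o ∷ π)           (() ∷ _) _
  ∈-compositions zero    (part (suc s) o ∷ π)        _        ()
  ∈-compositions (suc n) (part 1 false ∷ π)          (_ ∷ ps) t =
    ∈-concatMap⁺ extend
      (lose (∈-compositions n π ps (suc-injective t)) (here refl))
  ∈-compositions (suc n) (part 1 true ∷ π)           (_ ∷ ps) t =
    ∈-concatMap⁺ extend
      (lose (∈-compositions n π ps (suc-injective t)) (there (here refl)))
  ∈-compositions (suc n) (part (suc (suc s)) o ∷ π)  (_ ∷ ps) t =
    ∈-concatMap⁺ extend
      (lose (∈-compositions n (part (suc s) o ∷ π) (s≤s z≤n ∷ ps) (suc-injective t))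
            (there (there (here refl))))

∈-overpartitions : ∀ {n π} → π ∈ overpartitions n ⇔ IsOverpartition n π
∈-overpartitions {n} {π} = mk⇔
  (λ π∈ → proj₂ (∈-filter⁻ (isOverpartition? n) {xs = compositions n} π∈))
  (λ w → let open IsOverpartition w in
    ∈-filter⁺ (isOverpartition? n) (∈-compositions n π positive total) w)

overpartitions-unique : ∀ n → Unique (overpartitions n)
overpartitions-unique n =
  Unique.filter⁺ (isOverpartition? n) (compositions-unique n)

{-# OPTIONS --safe #-}

-- Write θ for the sum of q^(j²) over all integers j, and r_k(n) for the number
-- of representations of n as a sum of k squares. By Gauss' identity, the series
-- with coefficients (-1)^n p̄(n) is the inverse of θ. Since θ⁵ ≡ θ(q⁵) and
-- r₄(5n) ≡ r₄(n) modulo 5, taking every fifth coefficient of θ⁻¹ θ⁵ = θ⁴ yields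
-- (-1)^n p̄(5n) ≡ r₃(n) modulo 5. If p divides n, then
--   r₃(p² n) = (p + 1) r₃(n) - p r₃(n / p²),
-- so that r₃(p^(2k+1) N) = (1 + p + ⋯ + p^k) r₃(p N), and the first factor is
-- divisible by 5 for the exponents in question. The relations for r₃ and r₄
-- come from double counting: an integral quaternion that is not divisible by p,
-- but whose norm is, has exactly 8 left divisors of norm p (they generate the
-- same right ideal), and there are 8 (p + 1) quaternions of norm p altogether.

module Submission where

open import Defs
open import Data.Nat.Coprimality using (Coprime)
open import Algebra.Bundles using (CommutativeRing)
open import Data.Integer.Tactic.RingSolver using (solve-∀)
import Data.Integer.Properties as ℤ
open import Data.List.Relation.Unary.All as All using (All; []; _∷_)
open import Data.List.Relation.Unary.AllPairs using ([]; _∷_)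
open import Data.List.Relation.Unary.Any using (here; there)
open import Data.Nat as ℕ using (ℕ; zero; suc; z≤n; s≤s)
import Data.Nat.Divisibility as ℕ
import Data.Nat.DivMod as ℕ
open import Data.Nat.Primality using (Prime; prime⇒nonZero; prime⇒irreducible; euclidsLemma; prime?)
import Data.Nat.Properties as ℕ
import Data.Nat.Tactic.RingSolver as ℕ using (solve-∀)
open import Data.Product using (∃; ∃-syntax; _×_; _,_; proj₁; proj₂)
open import Data.Sum using (_⊎_; inj₁; inj₂; [_,_]′)
open import Relation.Binary.PropositionalEquality
  using (_≡_; _≢_; refl; sym; trans; cong; cong₂; subst; setoid; module ≡-Reasoning)
open import Relation.Nullary using (Dec; yes; no; ¬_; ¬?; contradiction)

-- Not every right ideal of the integer quaternions is principal. Only ideals generated by some `x`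
-- and an odd prime `p` are needed, and they enter through a divisibility test modulo `p`, the
-- relation `_≼_`. The descent to a generator replaces norm `p k` by norm `p l` with `l < k`. It
-- could stall only at a balanced remainder modulo `k` whose four coordinates are all half of `k` up
-- to sign; but then `k²` divides `p k`, which is impossible for `1 < k < p`. The number 8 (p + 1)
-- comes from a solution of 1 + α² + β² = 0 modulo `p`: it turns the projective line over ℤ/p into a
-- list of `p + 1` quaternions, one for each right ideal. For r₃ the pairs counted are those with
-- `x = π y π⋆`, where `y` and `x` are pure. The delicate `x` are the multiples of `p` that are not
-- multiples of `p²`: they must have 8 partners `π` as well. The multiples of `p²`, for which every
-- `π` works, are responsible for the term with n / p². Gauss' identity is an identity of infinite
-- products; it is obtained from a closed formula for finite sums, read modulo growing powers of q.

-- Integer quaternions and a solver for their identities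

module Quaternions where
  open import Data.Fin using (Fin; zero; suc; _↑ʳ_)
  open import Data.Integer using (ℤ; +_; -_; _+_; _-_; _*_; 0ℤ; 1ℤ)
  import Data.Integer.Solver as ℤ
  open import Data.Vec using (Vec; []; _∷_; lookup)
  import Relation.Binary.Reflection

  -- Without eta the operations do not unfold on variables, so products stay folded in goals until
  -- `quat` is matched. The coordinates have arbitrary type because the solver computes with
  -- quaternions of polynomials.
  record Quaternion {a} (A : Set a) : Set a where
    no-eta-equality; pattern
    constructor quat
    field re im jm km : A
  open Quaternion public

  quat-≡ : ∀ {a b c d e f g h : ℤ} → a ≡ e → b ≡ f → c ≡ g → d ≡ h →
           quat a b c d ≡ quat e f g h
  quat-≡ refl refl refl refl = refl

  module QuaternionOps {a} {A : Set a} (_+_ _-_ _*_ : A → A → A) (-_ : A → A) where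

    _+ᴴ_ _-ᴴ_ _*ᴴ_ : Quaternion A → Quaternion A → Quaternion A
    quat a b c d +ᴴ quat e f g h = quat (a + e) (b + f) (c + g) (d + h)
    quat a b c d -ᴴ quat e f g h = quat (a - e) (b - f) (c - g) (d - h)
    quat a b c d *ᴴ quat e f g h = quat
      ((((a * e) - (b * f)) - (c * g)) - (d * h))
      ((((a * f) + (b * e)) + (c * h)) - (d * g))
      ((((a * g) - (b * h)) + (c * e)) + (d * f))
      ((((a * h) + (b * g)) - (c * f)) + (d * e))

    -ᴴ_ conjugate : Quaternion A → Quaternion A
    -ᴴ quat a b c d = quat (- a) (- b) (- c) (- d)
    conjugate (quat a b c d) = quat a (- b) (- c) (- d)

    scale : A → Quaternion A → Quaternion A
    scale k (quat a b c d) = quat (k * a) (k * b) (k * c) (k * d)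

    norm : Quaternion A → A
    norm (quat a b c d) = (((a * a) + (b * b)) + (c * c)) + (d * d)

  ℍ : Set
  ℍ = Quaternion ℤ

  open QuaternionOps _+_ _-_ _*_ (-_) public using (norm)
    renaming (_+ᴴ_ to infixl 6 _⊕_; _-ᴴ_ to infixl 6 _⊖_; _*ᴴ_ to infixl 7 _·_;
              -ᴴ_ to ⊝_; scale to infixr 7.5 _•_; conjugate to infix 9 _⋆)

  ι : ℤ → ℍ
  ι k = quat k 0ℤ 0ℤ 0ℤ

  0ᴴ 1ᴴ : ℍ
  0ᴴ = ι 0ℤ
  1ᴴ = ι 1ℤ

  -- Identities between quaternions are decided by normalising their four
  -- components as polynomials in the components of the variables. A scalar k
  -- is represented by re x with x instantiated to ι k.
  module ℍ-Solver where
    open ℤ.+-*-Solver using (Polynomial; ⟦_⟧; ⟦_⟧↓; correct; _:+_; _:-_; _:*_; :-_; con; var)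
    module P {n} = QuaternionOps {A = Polynomial n} _:+_ _:-_ _:*_ :-_

    data Sort : Set where
      scalar quaternion : Sort

    infixl 6 _:⊕_ _:⊖_ _:+′_ _:-′_
    infixl 7 _:·_ _:*′_
    infixr 7.5 _:•_
    infix 9 _:⋆
    data Expr (n : ℕ) : Sort → Set where
      :var            : Fin n → Expr n quaternion
      _:⊕_ _:⊖_ _:·_  : (x y : Expr n quaternion) → Expr n quaternion
      :⊝_ _:⋆         : (x : Expr n quaternion) → Expr n quaternion
      _:•_            : (k : Expr n scalar) (x : Expr n quaternion) → Expr n quaternion
      :ι              : Expr n scalar → Expr n quaternion
      :norm :re       : Expr n quaternion → Expr n scalar
      :con            : ℤ → Expr n scalar
      _:+′_ _:-′_ _:*′_ : (k l : Expr n scalar) → Expr n scalar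

    Value : Sort → Set
    Value scalar     = ℤ
    Value quaternion = ℍ

    eval : ∀ {n s} → Expr n s → Vec ℍ n → Value s
    eval (:var i) ρ   = lookup ρ i
    eval (x :⊕ y) ρ   = eval x ρ ⊕ eval y ρ
    eval (x :⊖ y) ρ   = eval x ρ ⊖ eval y ρ
    eval (x :· y) ρ   = eval x ρ · eval y ρ
    eval (:⊝ x) ρ     = ⊝ eval x ρ
    eval (x :⋆) ρ     = eval x ρ ⋆
    eval (k :• x) ρ   = eval k ρ • eval x ρ
    eval (:ι k) ρ     = ι (eval k ρ)
    eval (:norm x) ρ  = norm (eval x ρ)
    eval (:re x) ρ    = re (eval x ρ)
    eval (:con k) ρ   = k
    eval (k :+′ l) ρ  = eval k ρ + eval l ρ
    eval (k :-′ l) ρ  = eval k ρ - eval l ρ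
    eval (k :*′ l) ρ  = eval k ρ * eval l ρ

    components : ∀ {n} → Vec ℍ n → Vec ℤ (n ℕ.* 4)
    components []                    = []
    components (quat a b c d ∷ ρ)    = a ∷ b ∷ c ∷ d ∷ components ρ

    mapQ : ∀ {a b} {A : Set a} {B : Set b} → (A → B) → Quaternion A → Quaternion B
    mapQ f (quat a b c d) = quat (f a) (f b) (f c) (f d)

    positions : ∀ {n} → Fin n → Quaternion (Fin (n ℕ.* 4))
    positions zero    = quat zero (suc zero) (suc (suc zero)) (suc (suc (suc zero)))
    positions (suc i) = mapQ (4 ↑ʳ_) (positions i)

    lookup-components : ∀ {n} (i : Fin n) ρ →
                        mapQ (lookup (components ρ)) (positions i) ≡ lookup ρ i
    lookup-components zero    (quat a b c d ∷ ρ) = refl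
    lookup-components (suc i) (quat a b c d ∷ ρ) with positions i | lookup-components i ρ
    ... | quat _ _ _ _ | eq = eq

    Reified : ℕ → Sort → Set
    Reified n scalar     = Polynomial (n ℕ.* 4)
    Reified n quaternion = Quaternion (Polynomial (n ℕ.* 4))

    reify : ∀ {n s} → Expr n s → Reified n s
    reify (:var i)  = mapQ var (positions i)
    reify (x :⊕ y)  = reify x P.+ᴴ reify y
    reify (x :⊖ y)  = reify x P.-ᴴ reify y
    reify (x :· y)  = reify x P.*ᴴ reify y
    reify (:⊝ x)    = P.-ᴴ reify x
    reify (x :⋆)    = P.conjugate (reify x)
    reify (k :• x)  = P.scale (reify k) (reify x)
    reify (:ι k)    = quat (reify k) (con 0ℤ) (con 0ℤ) (con 0ℤ)
    reify (:norm x) = P.norm (reify x)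
    reify (:re x)   = re (reify x)
    reify (:con k)  = con k
    reify (k :+′ l) = reify k :+ reify l
    reify (k :-′ l) = reify k :- reify l
    reify (k :*′ l) = reify k :* reify l

    value : ∀ {n} s → Vec ℍ n → Reified n s → Value s
    value scalar     ρ p = ⟦ p ⟧ (components ρ)
    value quaternion ρ x = mapQ (λ p → ⟦ p ⟧ (components ρ)) x

    value-reify : ∀ {n s} (e : Expr n s) ρ → value s ρ (reify e) ≡ eval e ρ
    value-reify (:var i) ρ with positions i | lookup-components i ρ
    ... | quat _ _ _ _ | eq = eq
    value-reify (x :⊕ y) ρ with reify x | value-reify x ρ | reify y | value-reify y ρ
    ... | quat _ _ _ _ | eqx | quat _ _ _ _ | eqy = cong₂ _⊕_ eqx eqy
    value-reify (x :⊖ y) ρ with reify x | value-reify x ρ | reify y | value-reify y ρ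
    ... | quat _ _ _ _ | eqx | quat _ _ _ _ | eqy = cong₂ _⊖_ eqx eqy
    value-reify (x :· y) ρ with reify x | value-reify x ρ | reify y | value-reify y ρ
    ... | quat _ _ _ _ | eqx | quat _ _ _ _ | eqy = cong₂ _·_ eqx eqy
    value-reify (:⊝ x) ρ with reify x | value-reify x ρ
    ... | quat _ _ _ _ | eq = cong ⊝_ eq
    value-reify (x :⋆) ρ with reify x | value-reify x ρ
    ... | quat _ _ _ _ | eq = cong _⋆ eq
    value-reify (:norm x) ρ with reify x | value-reify x ρ
    ... | quat _ _ _ _ | eq = cong norm eq
    value-reify (:re x) ρ with reify x | value-reify x ρ
    ... | quat _ _ _ _ | eq = cong re eq
    value-reify (k :• x) ρ with reify x | value-reify x ρ
    ... | quat _ _ _ _ | eq = cong₂ _•_ (value-reify k ρ) eq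
    value-reify (:ι k) ρ    = cong ι (value-reify k ρ)
    value-reify (:con k) ρ  = refl
    value-reify (k :+′ l) ρ = cong₂ _+_ (value-reify k ρ) (value-reify l ρ)
    value-reify (k :-′ l) ρ = cong₂ _-_ (value-reify k ρ) (value-reify l ρ)
    value-reify (k :*′ l) ρ = cong₂ _*_ (value-reify k ρ) (value-reify l ρ)

    normalised : ∀ {n} → Expr n quaternion → Vec ℍ n → ℍ
    normalised e ρ = mapQ (λ p → ⟦ p ⟧↓ (components ρ)) (reify e)

    normalised-correct : ∀ {n} (e : Expr n quaternion) ρ → normalised e ρ ≡ eval e ρ
    normalised-correct e ρ with reify e | value-reify e ρ
    ... | quat a b c d | eq = trans
      (quat-≡ (correct a _) (correct b _) (correct c _) (correct d _)) eq

    open Relation.Binary.Reflection {Expr = λ n → Expr n quaternion} (setoid ℍ) :var eval normalised normalised-correct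
      public using (solve) renaming (_⊜_ to infix 4 _:=_)

  open ℍ-Solver

  ·-assoc : ∀ x y z → (x · y) · z ≡ x · (y · z)
  ·-assoc = solve 3 (λ x y z → (x :· y) :· z := x :· (y :· z)) refl

  norm-· : ∀ x y → norm (x · y) ≡ norm x * norm y
  norm-· x y = cong re (solve 2 (λ x y → :ι (:norm (x :· y)) := :ι (:norm x :*′ :norm y)) refl x y)

-- Finite cardinalities and double counting

module Counting where
  open import Data.List using (List; []; _∷_; _++_; map; filter; length; cartesianProduct)
  open import Data.List.Membership.Propositional using (_∈_)
  open import Data.List.Membership.Propositional.Properties using (∈-map⁺; ∈-map⁻; ∈-++⁺ˡ; ∈-++⁺ʳ; ∈-++⁻; ∈-filter⁺;
      ∈-filter⁻; ∈-cartesianProduct⁺; ∈-cartesianProduct⁻)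
  open import Data.List.Membership.Propositional.Properties.WithK using (unique∧set⇒bag)
  open import Data.List.Properties using (length-map; length-++)
  open import Data.List.Relation.Binary.BagAndSetEquality using (∼bag⇒↭)
  open import Data.List.Relation.Binary.Permutation.Propositional.Properties using (↭-length)
  open import Data.List.Relation.Unary.Unique.Propositional using (Unique)
  import Data.List.Relation.Unary.Unique.Propositional.Properties as Unique
  open import Data.Nat using (_+_; _*_)
  open import Data.Nat.ListAction using (sum)
  open import Function.Bundles using (mk⇔)
  open import Relation.Nullary.Decidable using ()

  infix 4 _HasSize_
  -- Only the elements are counted, not the proofs of `P x`, so `P` need not be proposition-valued.
  record _HasSize_ {A : Set} (P : A → Set) (k : ℕ) : Set where
    field
      elements : List A
      unique   : Unique elements
      size≡    : length elements ≡ k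
      sound    : ∀ {x} → x ∈ elements → P x
      complete : ∀ {x} → P x → x ∈ elements
  open _HasSize_

  private variable
    A B : Set
    P Q : A → Set
    k l : ℕ

  enumeration : {P : A → Set} (xs : List A) → Unique xs → (∀ {x} → x ∈ xs → P x) → (∀ {x} → P x → x ∈ xs) →
                P HasSize length xs
  enumeration xs u s c = record
    { elements = xs ; unique = u ; size≡ = refl ; sound = s ; complete = c }

  HasSize-≡ : P HasSize k → k ≡ l → P HasSize l
  HasSize-≡ s refl = s

  HasSize-map : {P : A → Set} {Q : B → Set} (f : A → B) → (∀ x → P x → Q (f x)) →
    (∀ x y → P x → P y → f x ≡ f y → x ≡ y) →
    (∀ y → Q y → ∃ λ x → P x × f x ≡ y) → P HasSize k → Q HasSize k
  HasSize-map {Q = Q} f to injective onto s = HasSize-≡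
    (enumeration (map f (elements s)) (unique-map _ (unique s) (All.tabulate (sound s)))
       (λ y∈ → case-∈ (∈-map⁻ f y∈))
       (λ q → let x , px , fx≡y = onto _ q in subst (_∈ map f (elements s)) fx≡y (∈-map⁺ f (complete s px))))
    (trans (length-map f (elements s)) (size≡ s))
    where
    case-∈ : ∀ {y} → (∃ λ x → x ∈ elements s × y ≡ f x) → Q y
    case-∈ (x , x∈ , refl) = to x (sound s x∈)
    unique-map : ∀ xs → Unique xs → All _ xs → Unique (map f xs)
    unique-map []       _        _        = []
    unique-map (x ∷ xs) (x∉ ∷ u) (px ∷ ps) = separate xs x∉ ps ∷ unique-map xs u ps
      where
      separate : ∀ ys → All (x ≢_) ys → All _ ys → All (f x ≢_) (map f ys)
      separate []       _          _         = []
      separate (y ∷ ys) (x≢y ∷ ne) (py ∷ ps) = (λ eq → x≢y (injective x y px py eq)) ∷ separate ys ne ps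

  HasSize-⇔ : (∀ x → P x → Q x) → (∀ x → Q x → P x) → P HasSize k → Q HasSize k
  HasSize-⇔ to from = HasSize-map (λ x → x) to (λ _ _ _ _ eq → eq) (λ y q → y , from y q , refl)

  -- Two duplicate-free lists with the same members are permutations of each other.
  HasSize-unique : P HasSize k → P HasSize l → k ≡ l
  HasSize-unique s t = trans (sym (size≡ s)) (trans
    (↭-length (∼bag⇒↭ (unique∧set⇒bag (unique s) (unique t)
      (mk⇔ (λ x∈ → complete t (sound s x∈)) (λ x∈ → complete s (sound t x∈))))))
    (size≡ t))

  HasSize-∅ : (∀ x → ¬ P x) → P HasSize 0
  HasSize-∅ empty = enumeration [] [] (λ ()) (λ p → contradiction p (empty _))

  HasSize-⊎ : (∀ x → P x → ¬ Q x) → P HasSize k → Q HasSize l →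
              (λ x → P x ⊎ Q x) HasSize (k + l)
  HasSize-⊎ {P = P} {Q = Q} disjoint s t = HasSize-≡
    (enumeration (elements s ++ elements t)
      (Unique.++⁺ (unique s) (unique t) (λ (x∈s , x∈t) → disjoint _ (sound s x∈s) (sound t x∈t)))
      (λ x∈ → [ (λ x∈s → inj₁ (sound s x∈s)) , (λ x∈t → inj₂ (sound t x∈t)) ]′ (∈-++⁻ (elements s) x∈))
      [ (λ p → ∈-++⁺ˡ (complete s p)) , (λ q → ∈-++⁺ʳ (elements s) (complete t q)) ]′)
    (trans (length-++ (elements s)) (cong₂ _+_ (size≡ s) (size≡ t)))

  length-cartesianProduct : ∀ (xs : List A) (ys : List B) →
                            length (cartesianProduct xs ys) ≡ length xs * length ys
  length-cartesianProduct []       ys = refl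
  length-cartesianProduct (x ∷ xs) ys = trans (length-++ (map (x ,_) ys))
    (cong₂ _+_ (length-map (x ,_) ys) (length-cartesianProduct xs ys))

  HasSize-× : {P : A → Set} {Q : B → Set} → P HasSize k → Q HasSize l →
              (λ ((x , y) : A × B) → P x × Q y) HasSize (k * l)
  HasSize-× s t = HasSize-≡
    (enumeration (cartesianProduct (elements s) (elements t))
      (Unique.cartesianProduct⁺ (unique s) (unique t))
      (λ xy∈ → let x∈ , y∈ = ∈-cartesianProduct⁻ (elements s) (elements t) xy∈ in sound s x∈ , sound t y∈)
      (λ (p , q) → ∈-cartesianProduct⁺ (complete s p) (complete t q)))
    (trans (length-cartesianProduct (elements s) (elements t)) (cong₂ _*_ (size≡ s) (size≡ t)))

  HasSize-filter : {Q : A → Set} → P HasSize k → (Q? : ∀ x → Dec (Q x)) →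
                   ∃ λ l → (λ x → P x × Q x) HasSize l
  HasSize-filter s Q? = _ , enumeration (filter Q? (elements s)) (Unique.filter⁺ Q? (unique s))
    (λ x∈ → let x∈s , q = ∈-filter⁻ Q? x∈ in sound s x∈s , q)
    (λ (p , q) → ∈-filter⁺ Q? (complete s p) q)

  count : {P : A → Set} → (∀ x → Dec (P x)) → List A → ℕ
  count P? xs = length (filter P? xs)

  count-≡ : {R : A → Set} → P HasSize k → (R? : ∀ x → Dec (R x)) (xs : List A) → Unique xs →
            (∀ {x} → x ∈ xs → R x → P x) → (∀ {x} → P x → x ∈ xs × R x) → count R? xs ≡ k
  count-≡ s R? xs u to from = HasSize-unique
    (enumeration (filter R? xs) (Unique.filter⁺ R? u)
      (λ x∈ → let x∈xs , r = ∈-filter⁻ R? x∈ in to x∈xs r)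
      (λ p → let x∈ , r = from p in ∈-filter⁺ R? x∈ r)) s

  -- Both sides count the ones of the 0-1 matrix of `R`. The induction removes one row, and `split`
  -- distributes its entries over the columns.
  count-swap : {R : A → B → Set} (R? : ∀ x y → Dec (R x y)) (xs : List A) (ys : List B) →
    sum (map (λ x → count (R? x) ys) xs) ≡ sum (map (λ y → count (λ x → R? x y) xs) ys)
  count-swap R? [] ys = sym (sum-zero ys)
    where
    sum-zero : ∀ (ys : List _) → sum (map (λ _ → 0) ys) ≡ 0
    sum-zero []       = refl
    sum-zero (y ∷ ys) = sum-zero ys
  count-swap R? (x ∷ xs) ys = trans (cong (count (R? x) ys +_) (count-swap R? xs ys)) (split ys)
    where
    shuffle : ∀ a b c → a + (b + c) ≡ b + (a + c)
    shuffle = ℕ.solve-∀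
    split : ∀ ys → count (R? x) ys + sum (map (λ y → count (λ x → R? x y) xs) ys) ≡
            sum (map (λ y → count (λ x → R? x y) (x ∷ xs)) ys)
    split [] = refl
    split (y ∷ ys) with R? x y
    ... | yes _ = cong suc (trans (shuffle (count (R? x) ys) (count (λ x → R? x y) xs) _)
                    (cong (count (λ x → R? x y) xs +_) (split ys)))
    ... | no _  = trans (shuffle (count (R? x) ys) (count (λ x → R? x y) xs) _)
                    (cong (count (λ x → R? x y) xs +_) (split ys))

  sum-const : ∀ (f : A → ℕ) {c} xs → (∀ {x} → x ∈ xs → f x ≡ c) → sum (map f xs) ≡ length xs * c
  sum-const f []       eq = refl
  sum-const f (x ∷ xs) eq = cong₂ _+_ (eq (here refl)) (sum-const f xs (λ x∈ → eq (there x∈)))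

  sum-split : {C : A → Set} (C? : ∀ x → Dec (C x)) (f : A → ℕ) {c d : ℕ} (xs : List A) →
    (∀ {x} → x ∈ xs → C x → f x ≡ c) → (∀ {x} → x ∈ xs → ¬ C x → f x ≡ d) →
    ∃ λ l → count C? xs + l ≡ length xs × sum (map f xs) ≡ count C? xs * c + l * d
  sum-split C? f []       eqc eqd = 0 , refl , refl
  sum-split C? f {c} {d} (x ∷ xs) eqc eqd
    with C? x | sum-split C? f xs (λ x∈ → eqc (there x∈)) (λ x∈ → eqd (there x∈))
  ... | yes p | l , eql , eqs = l , cong suc eql , trans (cong₂ _+_ (eqc (here refl) p) eqs) (sym (ℕ.+-assoc c _ _))
  ... | no ¬p | l , eql , eqs = suc l , trans (ℕ.+-suc _ l) (cong suc eql) ,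
    trans (cong₂ _+_ (eqd (here refl) ¬p) eqs) (shuffle d (count C? xs * c) (l * d))
    where
    shuffle : ∀ a b e → a + (b + e) ≡ b + (a + e)
    shuffle = ℕ.solve-∀

  -- All rows have the same number of entries, but columns may be of two kinds, told apart by `C`.
  -- In the typical use `C` singles out the multiples of `p` or `p²`, whose columns are full.
  double-count : {P : A → Set} {Q C : B → Set} {R : A → B → Set} {a b r c d k : ℕ} →
    (∀ x y → Dec (R x y)) → (∀ y → Dec (C y)) → P HasSize a → Q HasSize b →
    (∀ x → P x → (λ y → Q y × R x y) HasSize r) →
    (∀ y → Q y → C y → (λ x → P x × R x y) HasSize c) →
    (∀ y → Q y → ¬ C y → (λ x → P x × R x y) HasSize d) →
    (λ y → Q y × C y) HasSize k →
    ∃ λ l → k + l ≡ b × a * r ≡ k * c + l * d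
  double-count {a = a} {r = r} {c} {d} R? C? p q row col col′ sub
    with l , eql , eqs ← sum-split C? (λ y → count (λ x → R? x y) (elements p)) (elements q)
           (λ y∈ cy → count-≡ (col _ (sound q y∈) cy) _ _ (unique p) (λ x∈ rxy → sound p x∈ , rxy) (λ (px , rxy) →
               complete p px , rxy))
           (λ y∈ cy → count-≡ (col′ _ (sound q y∈) cy) _ _ (unique p) (λ x∈ rxy → sound p x∈ , rxy) (λ (px , rxy) →
               complete p px , rxy))
    rewrite count-≡ sub C? (elements q) (unique q) (λ y∈ cy → sound q y∈ , cy) (λ (qy , cy) → complete q qy , cy)
    = l , trans eql (size≡ q) , (begin
      a * r                                                      ≡⟨ cong (_* r) (size≡ p) ⟨
      length (elements p) * r                                    ≡⟨ sum-const _ (elements p) (λ x∈ →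
         count-≡ (row _ (sound p x∈)) _ _ (unique q) (λ y∈ rxy → sound q y∈ , rxy) (λ (qy , rxy) → complete q qy , rxy)) ⟨
      sum (map (λ x → count (R? x) (elements q)) (elements p))   ≡⟨ count-swap R? (elements p) (elements q) ⟩
      _                                                          ≡⟨ eqs ⟩
      _                                                          ∎)
    where open ≡-Reasoning

-- Divisibility of quaternions and generators by descent on the norm

module Descent where
  open Quaternions
  open ℍ-Solver
  open import Data.Integer as ℤ using (ℤ; +_; -_; _+_; _-_; _*_; 0ℤ; 1ℤ; ∣_∣)
  open import Data.Integer.DivMod using (_/ℕ_; _%ℕ_; a≡a%ℕn+[a/ℕn]*n; n%ℕd<d)
  open import Data.Integer.Divisibility.Signed using (divides; _∣?_; ∣⇒∣ᵤ; ∣ᵤ⇒∣) renaming (_∣_ to infix 4 _∣ᶻ_)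
  open import Data.Nat.Induction using (Acc; acc; <-wellFounded)
  open import Relation.Nullary.Decidable using (map′; _×-dec_)

  infix 4 _∣ᴴ_
  _∣ᴴ_ : ℤ → ℍ → Set
  k ∣ᴴ x = ∃[ y ] x ≡ k • y

  components⇒∣ᴴ : ∀ {k a b c d} → k ∣ᶻ a → k ∣ᶻ b → k ∣ᶻ c → k ∣ᶻ d → k ∣ᴴ quat a b c d
  components⇒∣ᴴ (divides a′ refl) (divides b′ refl) (divides c′ refl) (divides d′ refl) =
    quat a′ b′ c′ d′ , quat-≡ (ℤ.*-comm a′ _) (ℤ.*-comm b′ _) (ℤ.*-comm c′ _) (ℤ.*-comm d′ _)

  ∣ᴴ⇒components : ∀ {k a b c d} → k ∣ᴴ quat a b c d → k ∣ᶻ a × k ∣ᶻ b × k ∣ᶻ c × k ∣ᶻ d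
  ∣ᴴ⇒components {k} (quat a b c d , refl) =
    divides a (ℤ.*-comm k a) , divides b (ℤ.*-comm k b) , divides c (ℤ.*-comm k c) , divides d (ℤ.*-comm k d)

  _∣ᴴ?_ : ∀ k x → Dec (k ∣ᴴ x)
  k ∣ᴴ? quat a b c d = map′ (λ (p , q , r , s) → components⇒∣ᴴ p q r s) ∣ᴴ⇒components
    ((k ∣? a) ×-dec (k ∣? b) ×-dec (k ∣? c) ×-dec (k ∣? d))

  •-cancel : ∀ k .{{_ : ℤ.NonZero k}} {x y} → k • x ≡ k • y → x ≡ y
  •-cancel k {quat _ _ _ _} {quat _ _ _ _} eq = quat-≡
    (ℤ.*-cancelˡ-≡ k _ _ (cong re eq)) (ℤ.*-cancelˡ-≡ k _ _ (cong im eq))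
    (ℤ.*-cancelˡ-≡ k _ _ (cong jm eq)) (ℤ.*-cancelˡ-≡ k _ _ (cong km eq))

  ·-• : ∀ k x y → x · k • y ≡ k • (x · y)
  ·-• k = solve 3 (λ k x y → x :· (:re k :• y) := :re k :• (x :· y)) refl (ι k)

  •-· : ∀ k x y → (k • x) · y ≡ k • (x · y)
  •-· k = solve 3 (λ k x y → (:re k :• x) :· y := :re k :• (x :· y)) refl (ι k)

  •-• : ∀ k l x → k • l • x ≡ (k * l) • x
  •-• k l = solve 3 (λ k l x → :re k :• :re l :• x := (:re k :*′ :re l) :• x) refl (ι k) (ι l)

  •-⋆ : ∀ k x → (k • x) ⋆ ≡ k • x ⋆
  •-⋆ k = solve 2 (λ k x → (:re k :• x) :⋆ := :re k :• x :⋆) refl (ι k)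

  norm-• : ∀ k x → norm (k • x) ≡ k * k * norm x
  norm-• k x = cong re (solve 2 (λ k x → :ι (:norm (:re k :• x)) := :ι (:re k :*′ :re k :*′ :norm x)) refl (ι k) x)

  norm-⋆ : ∀ x → norm (x ⋆) ≡ norm x
  norm-⋆ x = cong re (solve 1 (λ x → :ι (:norm (x :⋆)) := :ι (:norm x)) refl x)

  ·-⋆-norm : ∀ x → x · x ⋆ ≡ norm x • 1ᴴ
  ·-⋆-norm = solve 1 (λ x → x :· x :⋆ := :norm x :• :ι (:con 1ℤ)) refl

  ⋆-·-norm : ∀ x → x ⋆ · x ≡ norm x • 1ᴴ
  ⋆-·-norm = solve 1 (λ x → x :⋆ :· x := :norm x :• :ι (:con 1ℤ)) refl

  ·-⋆ : ∀ x y → (x · y) ⋆ ≡ y ⋆ · x ⋆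
  ·-⋆ = solve 2 (λ x y → (x :· y) :⋆ := y :⋆ :· x :⋆) refl

  ⋆-⋆ : ∀ x → x ⋆ ⋆ ≡ x
  ⋆-⋆ = solve 1 (λ x → x :⋆ :⋆ := x) refl

  normℕ : ℍ → ℕ
  normℕ (quat a b c d) = ∣ a ∣ ℕ.* ∣ a ∣ ℕ.+ ∣ b ∣ ℕ.* ∣ b ∣ ℕ.+ ∣ c ∣ ℕ.* ∣ c ∣ ℕ.+ ∣ d ∣ ℕ.* ∣ d ∣

  +∣i∣² : ∀ i → + (∣ i ∣ ℕ.* ∣ i ∣) ≡ i * i
  +∣i∣² i with ℤ.+∣i∣≡i⊎+∣i∣≡-i i
  ... | inj₁ eq = trans (ℤ.pos-* (∣ i ∣) (∣ i ∣)) (cong₂ _*_ eq eq)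
  ... | inj₂ eq = trans (ℤ.pos-* (∣ i ∣) (∣ i ∣)) (trans (cong₂ _*_ eq eq) (neg-neg i))
    where
    neg-neg : ∀ i → - i * - i ≡ i * i
    neg-neg = solve-∀

  +normℕ : ∀ x → + normℕ x ≡ norm x
  +normℕ (quat a b c d) = cong₂ _+_ (cong₂ _+_ (cong₂ _+_ (+∣i∣² a) (+∣i∣² b)) (+∣i∣² c)) (+∣i∣² d)

  normℕ≡0 : ∀ x → normℕ x ≡ 0 → x ≡ 0ᴴ
  normℕ≡0 (quat a b c d) eq = quat-≡ (square-zero a (ℕ.m+n≡0⇒m≡0 _ eq₁)) (square-zero b (ℕ.m+n≡0⇒n≡0 (∣ a ∣ ℕ.* ∣ a ∣) eq₁))
    (square-zero c (ℕ.m+n≡0⇒n≡0 (∣ a ∣ ℕ.* ∣ a ∣ ℕ.+ _) eq₂)) (square-zero d (ℕ.m+n≡0⇒n≡0 (∣ a ∣ ℕ.* ∣ a ∣ ℕ.+ _ ℕ.+ _) eq))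
    where
    eq₂ = ℕ.m+n≡0⇒m≡0 _ eq
    eq₁ = ℕ.m+n≡0⇒m≡0 _ eq₂
    square-zero : ∀ i → ∣ i ∣ ℕ.* ∣ i ∣ ≡ 0 → i ≡ 0ℤ
    square-zero i eq with ℕ.m*n≡0⇒m≡0∨n≡0 ∣ i ∣ eq
    ... | inj₁ eq = ℤ.∣i∣≡0⇒i≡0 eq
    ... | inj₂ eq = ℤ.∣i∣≡0⇒i≡0 eq

  -- Remainders of least absolute value: with ordinary remainders the sum of four squares would not
  -- stay within `k²`.
  balanced : ∀ k .{{_ : ℕ.NonZero k}} z → ∃[ r ] ∃[ t ] z ≡ r + + k * t × 2 ℕ.* ∣ r ∣ ℕ.≤ k
  balanced k z with 2 ℕ.* (z %ℕ k) ℕ.≤? k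
  ... | yes small = + (z %ℕ k) , z /ℕ k ,
    trans (a≡a%ℕn+[a/ℕn]*n z k) (cong (λ i → + (z %ℕ k) + i) (ℤ.*-comm (z /ℕ k) (+ k))) , small
  ... | no large = + (z %ℕ k) - + k , z /ℕ k + 1ℤ ,
    trans (a≡a%ℕn+[a/ℕn]*n z k) (shift (+ (z %ℕ k)) (z /ℕ k) (+ k)) , small
    where
    open ℕ.≤-Reasoning
    shift : ∀ m q k → m + q * k ≡ m - k + k * (q + 1ℤ)
    shift = solve-∀
    small : 2 ℕ.* ∣ + (z %ℕ k) - + k ∣ ℕ.≤ k
    small = begin
      2 ℕ.* ∣ + (z %ℕ k) - + k ∣     ≡⟨ cong (λ i → 2 ℕ.* ∣ i ∣) (ℤ.m-n≡m⊖n (z %ℕ k) k) ⟩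
      2 ℕ.* ∣ (z %ℕ k) ℤ.⊖ k ∣       ≡⟨ cong (2 ℕ.*_) (ℤ.∣⊖∣-≤ (ℕ.<⇒≤ (n%ℕd<d z k))) ⟩
      2 ℕ.* (k ℕ.∸ z %ℕ k)           ≡⟨ ℕ.*-distribˡ-∸ 2 k (z %ℕ k) ⟩
      2 ℕ.* k ℕ.∸ 2 ℕ.* (z %ℕ k)     ≤⟨ ℕ.∸-monoʳ-≤ (2 ℕ.* k) (ℕ.<⇒≤ (ℕ.≰⇒> large)) ⟩
      2 ℕ.* k ℕ.∸ k                  ≡⟨ cong (ℕ._∸ k) (cong (k ℕ.+_) (ℕ.+-identityʳ k)) ⟩
      k ℕ.+ k ℕ.∸ k                  ≡⟨ ℕ.m+n∸n≡m k k ⟩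
      k                              ∎

  data Balanced (k : ℕ) : ℍ → Set where
    bounds : ∀ {a b c d} → 2 ℕ.* ∣ a ∣ ℕ.≤ k → 2 ℕ.* ∣ b ∣ ℕ.≤ k →
             2 ℕ.* ∣ c ∣ ℕ.≤ k → 2 ℕ.* ∣ d ∣ ℕ.≤ k → Balanced k (quat a b c d)

  -- The only case in which reduction modulo k fails to decrease the norm.
  data Extremal (k : ℕ) : ℍ → Set where
    equalities : ∀ {a b c d} → 2 ℕ.* ∣ a ∣ ≡ k → 2 ℕ.* ∣ b ∣ ≡ k →
                 2 ℕ.* ∣ c ∣ ≡ k → 2 ℕ.* ∣ d ∣ ≡ k → Extremal k (quat a b c d)

  balancedᴴ : ∀ k .{{_ : ℕ.NonZero k}} z → ∃[ r ] ∃[ t ] z ≡ r ⊕ + k • t × Balanced k r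
  balancedᴴ k (quat a b c d)
    with ra , ta , eqa , ba ← balanced k a | rb , tb , eqb , bb ← balanced k b
       | rc , tc , eqc , bc ← balanced k c | rd , td , eqd , bd ← balanced k d
    = quat ra rb rc rd , quat ta tb tc td , quat-≡ eqa eqb eqc eqd , bounds ba bb bc bd

  four-squares-< : ∀ {k a b c d} → a ℕ.< k → b ℕ.≤ k → c ℕ.≤ k → d ℕ.≤ k →
                   a ℕ.* a ℕ.+ b ℕ.* b ℕ.+ c ℕ.* c ℕ.+ d ℕ.* d ℕ.< 4 ℕ.* (k ℕ.* k)
  four-squares-< {k} {a} {b} {c} {d} a<k b≤k c≤k d≤k = begin-strict
    a ℕ.* a ℕ.+ b ℕ.* b ℕ.+ c ℕ.* c ℕ.+ d ℕ.* d  <⟨ ℕ.+-mono-<-≤ (ℕ.+-mono-<-≤ (ℕ.+-mono-<-≤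
        (ℕ.*-mono-< a<k a<k) (ℕ.*-mono-≤ b≤k b≤k)) (ℕ.*-mono-≤ c≤k c≤k)) (ℕ.*-mono-≤ d≤k d≤k) ⟩
    k ℕ.* k ℕ.+ k ℕ.* k ℕ.+ k ℕ.* k ℕ.+ k ℕ.* k  ≡⟨ four (k ℕ.* k) ⟩
    4 ℕ.* (k ℕ.* k)                              ∎
    where
    open ℕ.≤-Reasoning
    four : ∀ s → s ℕ.+ s ℕ.+ s ℕ.+ s ≡ 4 ℕ.* s
    four = ℕ.solve-∀

  -- The doubled coordinates are at most `k`, so four times the norm is at most `4 k²`. If `l` is
  -- not below `k`, equality holds throughout, and no coordinate can be strictly below its bound.
  norm-balanced : ∀ {k l} r → Balanced k r → normℕ r ≡ k ℕ.* l → l ℕ.< k ⊎ Extremal k r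
  norm-balanced {k} {l} (quat a b c d) (bounds ba bb bc bd) eq with l ℕ.<? k
  ... | yes l<k = inj₁ l<k
  ... | no  l≮k = inj₂ (equalities
      (attained ba (λ lt → no-less (four-squares-< lt bb bc bd)))
      -- `four-squares-<` expects the strict bound at the first coordinate, hence the
      -- transpositions.
      (attained bb (λ lt → no-less (subst (ℕ._< 4 ℕ.* (k ℕ.* k)) (swap₂ (square a) (square b) (square c) (square d))
          (four-squares-< lt ba bc bd))))
      (attained bc (λ lt → no-less (subst (ℕ._< 4 ℕ.* (k ℕ.* k)) (swap₃ (square a) (square b) (square c) (square d))
          (four-squares-< lt bb ba bd))))
      (attained bd (λ lt → no-less (subst (ℕ._< 4 ℕ.* (k ℕ.* k)) (swap₄ (square a) (square b) (square c) (square d))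
          (four-squares-< lt bb bc ba)))))
    where
    square : ℤ → ℕ
    square x = 2 ℕ.* ∣ x ∣ ℕ.* (2 ℕ.* ∣ x ∣)
    attained : ∀ {m} → m ℕ.≤ k → ¬ m ℕ.< k → m ≡ k
    attained m≤k m≮k = ℕ.≤∧≮⇒≡ m≤k m≮k
    double : ∀ a b c d → let s = λ x → 2 ℕ.* x ℕ.* (2 ℕ.* x) in
      s a ℕ.+ s b ℕ.+ s c ℕ.+ s d ≡ 4 ℕ.* (a ℕ.* a ℕ.+ b ℕ.* b ℕ.+ c ℕ.* c ℕ.+ d ℕ.* d)
    double = ℕ.solve-∀
    swap₂ : ∀ a b c d → b ℕ.+ a ℕ.+ c ℕ.+ d ≡ a ℕ.+ b ℕ.+ c ℕ.+ d
    swap₂ = ℕ.solve-∀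
    swap₃ : ∀ a b c d → c ℕ.+ b ℕ.+ a ℕ.+ d ≡ a ℕ.+ b ℕ.+ c ℕ.+ d
    swap₃ = ℕ.solve-∀
    swap₄ : ∀ a b c d → d ℕ.+ b ℕ.+ c ℕ.+ a ≡ a ℕ.+ b ℕ.+ c ℕ.+ d
    swap₄ = ℕ.solve-∀
    open ℕ.≤-Reasoning
    no-less : ¬ (square a ℕ.+ square b ℕ.+ square c ℕ.+ square d ℕ.< 4 ℕ.* (k ℕ.* k))
    no-less lt = ℕ.<-irrefl refl (begin-strict
      4 ℕ.* (k ℕ.* k)            ≤⟨ ℕ.*-monoʳ-≤ 4 (ℕ.*-monoʳ-≤ k (ℕ.≮⇒≥ l≮k)) ⟩
      4 ℕ.* (k ℕ.* l)            ≡⟨ cong (4 ℕ.*_) eq ⟨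
      4 ℕ.* normℕ (quat a b c d) ≡⟨ double (∣ a ∣) (∣ b ∣) (∣ c ∣) (∣ d ∣) ⟨
      _                          <⟨ lt ⟩
      4 ℕ.* (k ℕ.* k)            ∎)

  module _ {k : ℕ} where
    -- Here `2 a` is `k` or `- k`; accordingly `u` is `t` or `t - 1`.
    half : ∀ a t → 2 ℕ.* ∣ a ∣ ≡ k → ∃[ u ] (+ 2) * (a + + k * t) ≡ + k * (+ 2 * u + 1ℤ)
    half a t eq with ℤ.+∣i∣≡i⊎+∣i∣≡-i a
    ... | inj₁ e = t , trans (expand a (+ k) t) (trans (cong (λ i → i + + k * (+ 2 * t)) (double-a e)) (collect (+ k) t))
      where
      double-a : + ∣ a ∣ ≡ a → + 2 * a ≡ + k
      double-a e = trans (cong (λ i → + 2 * i) (sym e)) (trans (sym (ℤ.pos-* 2 ∣ a ∣)) (cong +_ eq))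
      expand : ∀ a k t → + 2 * (a + k * t) ≡ + 2 * a + k * (+ 2 * t)
      expand = solve-∀
      collect : ∀ k t → k + k * (+ 2 * t) ≡ k * (+ 2 * t + 1ℤ)
      collect = solve-∀
    ... | inj₂ e = t - 1ℤ , trans (expand a (+ k) t) (trans (cong (λ i → + k * (+ 2 * t) - i) (double-a e)) (collect (+ k) t))
      where
      double-a : + ∣ a ∣ ≡ - a → + 2 * - a ≡ + k
      double-a e = trans (cong (λ i → + 2 * i) (sym e)) (trans (sym (ℤ.pos-* 2 ∣ a ∣)) (cong +_ eq))
      expand : ∀ a k t → + 2 * (a + k * t) ≡ k * (+ 2 * t) - + 2 * - a
      expand = solve-∀
      collect : ∀ k t → k * (+ 2 * t) - k ≡ k * (+ 2 * (t - 1ℤ) + 1ℤ)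
      collect = solve-∀

  -- Doubling r + k t gives k times a quaternion with odd components, and four
  -- odd squares add up to a multiple of 4.
  extremal-norm : ∀ {k} .{{_ : ℕ.NonZero k}} r t → Extremal k r → ∃[ m ] norm (r ⊕ + k • t) ≡ + k * + k * m
  extremal-norm {k} (quat a b c d) (quat e f g h) (equalities ea eb ec ed)
    with ua , eqa ← half a e ea | ub , eqb ← half b f eb | uc , eqc ← half c g ec | ud , eqd ← half d h ed
    = norm u + re (u · o ⋆) + 1ℤ , ℤ.*-cancelˡ-≡ (+ 4) _ _ (begin
        + 4 * norm z                      ≡⟨ norm-• (+ 2) z ⟨
        norm (+ 2 • z)                    ≡⟨ cong norm (quat-≡ eqa eqb eqc eqd) ⟩
        norm (+ k • (+ 2 • u ⊕ o))        ≡⟨ norm-• (+ k) _ ⟩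
        + k * + k * norm (+ 2 • u ⊕ o)    ≡⟨ cong (λ i → + k * + k * i) (odd-norm u o) ⟩
        _                                 ≡⟨ four (+ k * + k) (norm u) (re (u · o ⋆)) ⟩
        + 4 * (+ k * + k * (norm u + re (u · o ⋆) + 1ℤ)) ∎)
    where
    open ≡-Reasoning
    z = quat a b c d ⊕ + k • quat e f g h
    u = quat ua ub uc ud
    o = quat 1ℤ 1ℤ 1ℤ 1ℤ
    odd-norm : ∀ u o → norm (+ 2 • u ⊕ o) ≡ + 4 * (norm u + re (u · o ⋆)) + norm o
    odd-norm u o = cong re (solve 2 (λ u o → :ι (:norm (:con (+ 2) :• u :⊕ o)) :=
      :ι (:con (+ 4) :*′ (:norm u :+′ :re (u :· o :⋆)) :+′ :norm o)) refl u o)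
    four : ∀ s n m → s * (+ 4 * (n + m) + + 4) ≡ + 4 * (s * (n + m + 1ℤ))
    four = solve-∀

  module Primes {p : ℕ} (p-prime : Prime p) where
    private
      P : ℤ
      P = + p
      instance
        p≢0 : ℕ.NonZero p
        p≢0 = prime⇒nonZero p-prime

    euclid : ∀ k a → P ∣ᶻ k * a → P ∣ᶻ k ⊎ P ∣ᶻ a
    euclid k a p∣ka with euclidsLemma (∣ k ∣) (∣ a ∣) p-prime (subst (p ℕ.∣_) (ℤ.abs-* k a) (∣⇒∣ᵤ p∣ka))
    ... | inj₁ p∣k = inj₁ (∣ᵤ⇒∣ p∣k)
    ... | inj₂ p∣a = inj₂ (∣ᵤ⇒∣ p∣a)

    euclid-cancel : ∀ {k} a → ¬ P ∣ᶻ k → P ∣ᶻ k * a → P ∣ᶻ a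
    euclid-cancel {k} a p∤k p∣ka with euclid k a p∣ka
    ... | inj₁ p∣k = contradiction p∣k p∤k
    ... | inj₂ p∣a = p∣a

    euclidᴴ : ∀ {k} x → ¬ P ∣ᶻ k → P ∣ᴴ k • x → P ∣ᴴ x
    euclidᴴ (quat a b c d) p∤k p∣kx with pa , pb , pc , pd ← ∣ᴴ⇒components p∣kx =
      components⇒∣ᴴ (euclid-cancel a p∤k pa) (euclid-cancel b p∤k pb) (euclid-cancel c p∤k pc) (euclid-cancel d p∤k pd)

    small-∤ : ∀ {k} .{{_ : ℕ.NonZero k}} → k ℕ.< p → ¬ P ∣ᶻ + k
    small-∤ k<p p∣k = ℕ.<⇒≱ k<p (ℕ.∣⇒≤ (∣⇒∣ᵤ p∣k))

    proper-∤ : ∀ k → 1 ℕ.< k → k ℕ.< p → ¬ + k ∣ᶻ P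
    proper-∤ k 1<k k<p k∣p with prime⇒irreducible p-prime (∣⇒∣ᵤ k∣p)
    ... | inj₁ refl = ℕ.<-irrefl refl 1<k
    ... | inj₂ refl = ℕ.<-irrefl refl k<p

    -- For p ∤ x this says that z lies in the right ideal generated by x and p.
    infix 4 _≼_
    _≼_ : ℍ → ℍ → Set
    x ≼ z = ∀ y → P ∣ᴴ y · x → P ∣ᴴ y · z

    -- Right multiplication stays inside a right ideal, and a factor prime to `p` can be cancelled
    -- modulo `p`.
    ≼-descend : ∀ {x z w r k} → ¬ P ∣ᶻ k → z · r ≡ k • w → x ≼ z → x ≼ w
    ≼-descend {x} {z} {w} {r} {k} p∤k zr≡kw x≼z y p∣yx with x≼z y p∣yx
    ... | u , yz≡pu = euclidᴴ (y · w) p∤k (u · r , (begin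
      k • (y · w)     ≡⟨ ·-• k y w ⟨
      y · k • w       ≡⟨ cong (y ·_) zr≡kw ⟨
      y · (z · r)     ≡⟨ ·-assoc y z r ⟨
      (y · z) · r     ≡⟨ cong (_· r) yz≡pu ⟩
      (P • u) · r     ≡⟨ •-· P u r ⟩
      P • (u · r)     ∎))
      where open ≡-Reasoning

    norm-remainder : ∀ k (r t : ℍ) → norm r ≡ norm (r ⊕ k • t) - k * (+ 2 * re (r · t ⋆) + k * norm t)
    norm-remainder k r t = cong re (solve 3 (λ k r t → :ι (:norm r) :=
      :ι (:norm (r :⊕ :re k :• t) :-′ :re k :*′ (:con (+ 2) :*′ :re (r :· t :⋆) :+′ :re k :*′ :norm t))) refl (ι k) r t)

    -- Reduction modulo `k` changes the norm by a multiple of `k`. Passing to absolute values makes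
    -- the quotient a natural number without a separate proof that `L` is nonnegative.
    remainder-multiple : ∀ {k : ℕ} .{{_ : ℕ.NonZero k}} r t → + k ∣ᶻ norm (r ⊕ + k • t) →
                         ∃[ l ] norm r ≡ + k * + l × normℕ r ≡ k ℕ.* l
    remainder-multiple {k} r t (divides m eq) = ∣ L ∣ , trans (sym (+normℕ r)) (trans (cong +_ normℕ≡)
        (ℤ.pos-* k (∣ L ∣))) , normℕ≡
      where
      L = m - (+ 2 * re (r · t ⋆) + + k * norm t)
      factor : ∀ m k s → m * k - k * s ≡ k * (m - s)
      factor = solve-∀
      norm≡ : norm r ≡ + k * L
      norm≡ = trans (norm-remainder (+ k) r t) (trans (cong (_- _) eq) (factor m (+ k) _))
      normℕ≡ : normℕ r ≡ k ℕ.* ∣ L ∣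
      normℕ≡ = trans (cong ∣_∣ (trans (+normℕ r) norm≡)) (ℤ.abs-* (+ k) L)

    zero-remainder : ∀ k t → norm (0ᴴ ⊕ k • t) ≡ k * (norm t * k)
    zero-remainder k t = cong re (solve 2 (λ k t → :ι (:norm (:ι (:con 0ℤ) :⊕ :re k :• t)) :=
      :ι (:re k :*′ (:norm t :*′ :re k))) refl (ι k) t)

    -- The term `r r⋆` is the norm of `r`, itself a multiple of `k`. This is the division step of
    -- the classical four-square descent.
    remainder-· : ∀ k l r t → norm r ≡ k * l → (r ⊕ k • t) · r ⋆ ≡ k • (ι l ⊕ t · r ⋆)
    remainder-· k l r t norm-r = begin
      (r ⊕ k • t) · r ⋆                ≡⟨ solve 3 (λ k r t → (r :⊕ :re k :• t) :· r :⋆ :=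
                                          :ι (:norm r) :⊕ :re k :• (t :· r :⋆)) refl (ι k) r t ⟩
      ι (norm r) ⊕ k • (t · r ⋆)       ≡⟨ cong (λ n → ι n ⊕ k • (t · r ⋆)) norm-r ⟩
      ι (k * l) ⊕ k • (t · r ⋆)        ≡⟨ solve 3 (λ k l s → :ι (:re k :*′ :re l) :⊕ :re k :• s :=
                                          :re k :• (:ι (:re l) :⊕ s)) refl (ι k) (ι l) (t · r ⋆) ⟩
      k • (ι l ⊕ t · r ⋆)              ∎
      where open ≡-Reasoning

    norm-quotient : ∀ k .{{_ : ℤ.NonZero k}} m l z r w → z · r ⋆ ≡ k • w → norm z ≡ m * k → norm r ≡ k * l →
                    norm w ≡ m * l
    norm-quotient k m l z r w eq norm-z norm-r = ℤ.*-cancelˡ-≡ (k * k) _ _ {{ℤ.i*j≢0 k k}} (begin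
      k * k * norm w         ≡⟨ norm-• k w ⟨
      norm (k • w)           ≡⟨ cong norm eq ⟨
      norm (z · r ⋆)         ≡⟨ norm-· z (r ⋆) ⟩
      norm z * norm (r ⋆)    ≡⟨ cong₂ _*_ norm-z (trans (norm-⋆ r) norm-r) ⟩
      m * k * (k * l)        ≡⟨ rearrange m k l ⟩
      k * k * (m * l)        ∎)
      where
      open ≡-Reasoning
      rearrange : ∀ p k l → p * k * (k * l) ≡ k * k * (p * l)
      rearrange = solve-∀

    not-multiple : ∀ k .{{_ : ℤ.NonZero k}} m s → ¬ k ∣ᶻ m → m * k ≢ k * (s * k)
    not-multiple k m s k∤m eq = k∤m (divides s (ℤ.*-cancelˡ-≡ k _ _ (trans (ℤ.*-comm k m) eq)))

    Smaller : ℍ → ℕ → Set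
    Smaller x k = ∃[ l ] ∃[ w ] ℕ.NonZero l × l ℕ.< k × norm w ≡ P * + l × x ≼ w

    extremal-absurd : ∀ k .{{_ : ℕ.NonZero k}} → ¬ + k ∣ᶻ P → ∀ {n} → n ≡ P * + k →
                      ¬ (∃[ m ] n ≡ + k * + k * m)
    extremal-absurd k k∤p n≡ (m , eq) = not-multiple (+ k) P m k∤p (trans (sym n≡) (trans eq (rearrange (+ k) m)))
      where
      rearrange : ∀ k m → k * k * m ≡ k * (m * k)
      rearrange = solve-∀

    nonzero-remainder : ∀ k .{{_ : ℕ.NonZero k}} → ¬ + k ∣ᶻ P → ∀ {z r t l} → norm z ≡ P * + k →
                        z ≡ r ⊕ + k • t → normℕ r ≡ k ℕ.* l → l ≢ 0
    nonzero-remainder k k∤p {z} {r} {t} norm-z z≡ normℕ-r refl = not-multiple (+ k) P (norm t) k∤p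
      (trans (sym norm-z) (trans (cong norm (trans z≡ (cong (_⊕ + k • t) r≡0))) (zero-remainder (+ k) t)))
      where
      r≡0 : r ≡ 0ᴴ
      r≡0 = normℕ≡0 r (trans normℕ-r (ℕ.*-zeroʳ k))

    -- With `z = r + k t`, the product `z r⋆` is `k w` for an integral `w` of norm `p l`. A zero
    -- remainder and an extremal one would both make `k²` divide `p k`, and `k` would be a proper
    -- divisor of `p`.
    descent-step : ∀ {x} k .{{_ : ℕ.NonZero k}} → 1 ℕ.< k → k ℕ.< p → ∀ z → norm z ≡ P * + k → x ≼ z →
                   Smaller x k
    descent-step {x} k 1<k k<p z norm-z x≼z = reduce (balancedᴴ k z)
      where
      k∤p : ¬ + k ∣ᶻ P
      k∤p = proper-∤ k 1<k k<p
      reduce : (∃[ r ] ∃[ t ] z ≡ r ⊕ + k • t × Balanced k r) → Smaller x k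
      reduce (r , t , z≡ , bal) = finish (remainder-multiple r t (divides P (trans (sym (cong norm z≡)) norm-z)))
        where
        finish : (∃[ l ] norm r ≡ + k * + l × normℕ r ≡ k ℕ.* l) → Smaller x k
        finish (l , norm-r , normℕ-r) = compare (norm-balanced r bal normℕ-r)
          where
          w : ℍ
          w = ι (+ l) ⊕ t · r ⋆
          zr≡kw : z · r ⋆ ≡ + k • w
          zr≡kw = trans (cong (_· r ⋆) z≡) (remainder-· (+ k) (+ l) r t norm-r)
          compare : l ℕ.< k ⊎ Extremal k r → Smaller x k
          compare (inj₂ ext) = contradiction (subst (λ z → ∃[ m ] norm z ≡ + k * + k * m) (sym z≡) (extremal-norm r t ext))
            (extremal-absurd k k∤p norm-z)
          compare (inj₁ l<k) = l , w , ℕ.≢-nonZero (nonzero-remainder k k∤p norm-z z≡ normℕ-r) , l<k ,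
            norm-quotient (+ k) P (+ l) z r w zr≡kw norm-z norm-r ,
            ≼-descend (small-∤ k<p) zr≡kw x≼z

    descend : ∀ {x} k → Acc ℕ._<_ k → ℕ.NonZero k → k ℕ.< p → ∀ z →
              norm z ≡ P * + k → x ≼ z → ∃[ π ] norm π ≡ P × x ≼ π
    descend {x} k (acc smaller) k≢0 k<p z norm-z x≼z = continue (k ℕ.≟ 1)
      where
      recurse : Smaller x k → ∃[ π ] norm π ≡ P × x ≼ π
      recurse (l , w , l≢0 , l<k , norm-w , x≼w) =
        descend l (smaller l<k) l≢0 (ℕ.<-trans l<k k<p) w norm-w x≼w
      continue : Dec (k ≡ 1) → ∃[ π ] norm π ≡ P × x ≼ π
      continue (yes k≡1) = z , trans norm-z (trans (cong (λ k → P * + k) k≡1) (ℤ.*-identityʳ P)) , x≼z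
      continue (no k≢1)  = recurse (descent-step k {{k≢0}}
        (ℕ.≤∧≢⇒< (ℕ.>-nonZero⁻¹ k {{k≢0}}) (λ eq → k≢1 (sym eq))) k<p z norm-z x≼z)

    odd-∤2 : 3 ℕ.≤ p → ¬ P ∣ᶻ + 2
    odd-∤2 3≤p = small-∤ 3≤p

    half-∤ : 3 ℕ.≤ p → ∀ a → 2 ℕ.* a ≢ p
    half-∤ 3≤p a 2a≡p with prime⇒irreducible p-prime (ℕ.divides a (trans (sym 2a≡p) (ℕ.*-comm 2 a)))
    ... | inj₁ ()
    ... | inj₂ refl = ℕ.<-irrefl refl 3≤p

    ≼-remainder : ∀ r t → (r ⊕ P • t) ≼ r
    ≼-remainder r t y (u , eq) = u ⊖ y · t , trans (isolate (ι P) r t y) (trans (cong (_⊖ P • (y · t)) eq) (factor (ι P) u t y))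
      where
      isolate : ∀ p r t y → y · r ≡ y · (r ⊕ re p • t) ⊖ re p • (y · t)
      isolate = solve 4 (λ p r t y → y :· r := y :· (r :⊕ :re p :• t) :⊖ :re p :• (y :· t)) refl
      factor : ∀ p u t y → re p • u ⊖ re p • (y · t) ≡ re p • (u ⊖ y · t)
      factor = solve 4 (λ p u t y → :re p :• u :⊖ :re p :• (y :· t) := :re p :• (u :⊖ y :· t)) refl

    0-⊕ : ∀ y → 0ᴴ ⊕ y ≡ y
    0-⊕ = solve 1 (λ t → :ι (:con 0ℤ) :⊕ t := t) refl

    -- The balanced remainder of `x` modulo `p` starts the descent with a cofactor below `p`: it is
    -- nonzero because `p` does not divide `x`, and not extremal because `p` is odd.
    generator : 3 ℕ.≤ p → ∀ x → ¬ P ∣ᴴ x → P ∣ᶻ norm x → ∃[ π ] norm π ≡ P × x ≼ π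
    generator 3≤p x p∤x p∣norm = reduce (balancedᴴ p x)
      where
      reduce : (∃[ r ] ∃[ t ] x ≡ r ⊕ P • t × Balanced p r) → ∃[ π ] norm π ≡ P × x ≼ π
      reduce (r , t , x≡ , bal) = finish (remainder-multiple r t (subst (λ x → P ∣ᶻ norm x) x≡ p∣norm))
        where
        finish : (∃[ l ] norm r ≡ P * + l × normℕ r ≡ p ℕ.* l) → ∃[ π ] norm π ≡ P × x ≼ π
        finish (l , norm-r , normℕ-r) = compare (norm-balanced r bal normℕ-r)
          where
          l≢0 : l ≢ 0
          l≢0 refl = p∤x (t , trans x≡ (trans (cong (_⊕ P • t) (normℕ≡0 r (trans normℕ-r (ℕ.*-zeroʳ p)))) (0-⊕ (P • t))))
          compare : l ℕ.< p ⊎ Extremal p r → ∃[ π ] norm π ≡ P × x ≼ π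
          compare (inj₂ (equalities {a} e _ _ _)) = contradiction e (half-∤ 3≤p (∣ a ∣))
          compare (inj₁ l<p) = descend l (<-wellFounded l) (ℕ.≢-nonZero l≢0) l<p r norm-r
            (λ y p∣yx → ≼-remainder r t y (subst (λ x → P ∣ᴴ y · x) x≡ p∣yx))

-- Left divisors of norm p and the double counts for four and three squares

module Representations where
  open Quaternions
  open ℍ-Solver
  open Counting
  open Descent
  open import Data.Integer as ℤ using (ℤ; +_; -_; _+_; _-_; _*_; 0ℤ; 1ℤ; ∣_∣)
  open import Data.Integer.Divisibility.Signed using (divides; _∣?_) renaming (_∣_ to infix 4 _∣ᶻ_)

  ·-1ᴴ : ∀ x → x · 1ᴴ ≡ x
  ·-1ᴴ = solve 1 (λ x → x :· :ι (:con 1ℤ) := x) refl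

  1-• : ∀ x → 1ℤ • x ≡ x
  1-• = solve 1 (λ x → :con 1ℤ :• x := x) refl

  ·-⋆-· : ∀ x y → x · (x ⋆ · y) ≡ norm x • y
  ·-⋆-· = solve 2 (λ x y → x :· (x :⋆ :· y) := :norm x :• y) refl

  ⋆-·-· : ∀ x y → x ⋆ · (x · y) ≡ norm x • y
  ⋆-·-· = solve 2 (λ x y → x :⋆ :· (x :· y) := :norm x :• y) refl

  ·-·-⋆ : ∀ x y → (x · y) · y ⋆ ≡ norm y • x
  ·-·-⋆ = solve 2 (λ x y → (x :· y) :· y :⋆ := :norm y :• x) refl

  ∣ᴴ-·ˡ : ∀ {k} y {x} → k ∣ᴴ x → k ∣ᴴ y · x
  ∣ᴴ-·ˡ {k} y (u , refl) = y · u , ·-• k y u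

  ∣ᴴ-·ʳ : ∀ {k} y {x} → k ∣ᴴ x → k ∣ᴴ x · y
  ∣ᴴ-·ʳ {k} y (u , refl) = u · y , •-· k u y

  ∣ᴴ-⋆ : ∀ {k x} → k ∣ᴴ x → k ∣ᴴ x ⋆
  ∣ᴴ-⋆ {k} (u , refl) = u ⋆ , •-⋆ k u

  ∣ᴴ-• : ∀ {k l} x → k ∣ᶻ l → k ∣ᴴ l • x
  ∣ᴴ-• {k} x (divides q refl) = q • x , trans (cong (_• x) (ℤ.*-comm q k)) (sym (•-• k q x))

  re-• : ∀ k x → re (k • x) ≡ k * re x
  re-• k (quat _ _ _ _) = refl

  im-• : ∀ k x → im (k • x) ≡ k * im x
  im-• k (quat _ _ _ _) = refl

  -- The number of units is a parameter here; it is read off later as the coefficient of q in θ⁴.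
  module Sandwich {p : ℕ} (p-prime : Prime p) (3≤p : 3 ℕ.≤ p)
                  (units : (λ u → norm u ≡ 1ℤ) HasSize 8) where
    open Primes p-prime
    P : ℤ
    P = + p
    instance
      p≢0 : ℕ.NonZero p
      p≢0 = prime⇒nonZero p-prime

    Associate : ℍ → ℍ → Set
    Associate π σ = ∃[ u ] norm u ≡ 1ℤ × π · u ≡ σ

    -- Testing `x ≼ π` on `x⋆` shows that `p` divides `x⋆ π`; conjugate.
    ≼⇒∣ : ∀ {x π} → P ∣ᶻ norm x → x ≼ π → P ∣ᴴ π ⋆ · x
    ≼⇒∣ {x} {π} p∣norm x≼π = subst (P ∣ᴴ_) (trans (·-⋆ (x ⋆) π) (cong (π ⋆ ·_) (⋆-⋆ x)))
      (∣ᴴ-⋆ (x≼π (x ⋆) (subst (P ∣ᴴ_) (sym (⋆-·-norm x)) (∣ᴴ-• 1ᴴ p∣norm))))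

    -- Testing `x ≼ π` on `σ⋆` gives `σ⋆ π = p v`. Multiplication by `σ` yields `π = σ v`, and the
    -- norms show that `v` is a unit.
    associated : ∀ {x π σ} → x ≼ π → norm π ≡ P → norm σ ≡ P → P ∣ᴴ σ ⋆ · x → Associate π σ
    associated {x} {π} {σ} x≼π norm-π norm-σ p∣σ⋆x = fromQuotient (x≼π (σ ⋆) p∣σ⋆x)
      where
      open ≡-Reasoning
      fromQuotient : P ∣ᴴ σ ⋆ · π → Associate π σ
      fromQuotient (v , σ⋆π≡pv) = v ⋆ , trans (norm-⋆ v) norm-v , (begin
        π · v ⋆           ≡⟨ cong (_· v ⋆) π≡σv ⟩
        (σ · v) · v ⋆     ≡⟨ ·-·-⋆ σ v ⟩
        norm v • σ        ≡⟨ cong (_• σ) norm-v ⟩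
        1ℤ • σ            ≡⟨ 1-• σ ⟩
        σ                 ∎)
        where
        π≡σv : π ≡ σ · v
        π≡σv = •-cancel P (begin
          P • π             ≡⟨ cong (_• π) norm-σ ⟨
          norm σ • π        ≡⟨ ·-⋆-· σ π ⟨
          σ · (σ ⋆ · π)     ≡⟨ cong (σ ·_) σ⋆π≡pv ⟩
          σ · P • v         ≡⟨ ·-• P σ v ⟩
          P • (σ · v)       ∎)
        norm-v : norm v ≡ 1ℤ
        norm-v = ℤ.*-cancelˡ-≡ P (norm v) 1ℤ (begin
          P * norm v        ≡⟨ cong (_* norm v) norm-σ ⟨
          norm σ * norm v   ≡⟨ norm-· σ v ⟨
          norm (σ · v)      ≡⟨ cong norm π≡σv ⟨
          norm π            ≡⟨ norm-π ⟩
          P                 ≡⟨ ℤ.*-identityʳ P ⟨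
          P * 1ℤ            ∎)

    ≼-associate : ∀ {x π σ} → x ≼ π → Associate π σ → x ≼ σ
    ≼-associate {x} {π} x≼π (u , _ , refl) y p∣yx =
      subst (P ∣ᴴ_) (·-assoc y π u) (∣ᴴ-·ʳ u (x≼π y p∣yx))

    -- Every such `σ` is associated to the generator found by descent, and units preserve `≼`.
    ∣⇒≼ : ∀ {x σ} → ¬ P ∣ᴴ x → P ∣ᶻ norm x → norm σ ≡ P → P ∣ᴴ σ ⋆ · x → x ≼ σ
    ∣⇒≼ {x} {σ} p∤x p∣norm norm-σ p∣σ⋆x = via (generator 3≤p x p∤x p∣norm)
      where
      via : (∃[ π ] norm π ≡ P × x ≼ π) → x ≼ σ
      via (π , norm-π , x≼π) = ≼-associate x≼π (associated x≼π norm-π norm-σ p∣σ⋆x)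

    -- Since `σ σ⋆ = p`, the condition `P ∣ᴴ σ ⋆ · x` expresses that `σ` divides `x` from the left.
    -- By `associated` these `σ` are the products of one generator with the units.
    left-divisors : ∀ {x} → ¬ P ∣ᴴ x → P ∣ᶻ norm x → (λ σ → norm σ ≡ P × P ∣ᴴ σ ⋆ · x) HasSize 8
    left-divisors {x} p∤x p∣norm = via (generator 3≤p x p∤x p∣norm)
      where
      open ≡-Reasoning
      via : (∃[ π ] norm π ≡ P × x ≼ π) → (λ σ → norm σ ≡ P × P ∣ᴴ σ ⋆ · x) HasSize 8
      via (π , norm-π , x≼π) = HasSize-map (π ·_) to
        (λ u v _ _ eq → •-cancel P (trans (⋆π· u) (trans (cong (π ⋆ ·_) eq) (sym (⋆π· v)))))
        (λ σ (norm-σ , p∣σ⋆x) → associated x≼π norm-π norm-σ p∣σ⋆x) units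
        where
        ⋆π· : ∀ u → P • u ≡ π ⋆ · (π · u)
        ⋆π· u = trans (cong (_• u) (sym norm-π)) (sym (⋆-·-· π u))
        to : ∀ u → norm u ≡ 1ℤ → norm (π · u) ≡ P × P ∣ᴴ (π · u) ⋆ · x
        to u norm-u = trans (norm-· π u) (trans (cong₂ _*_ norm-π norm-u) (ℤ.*-identityʳ P)) ,
          subst (P ∣ᴴ_) (trans (sym (·-assoc (u ⋆) (π ⋆) x)) (cong (_· x) (sym (·-⋆ π u))))
            (∣ᴴ-·ˡ (u ⋆) (≼⇒∣ {x} {π} p∣norm x≼π))

    p∣⇒norm : ∀ {x} → P ∣ᴴ x → ∃[ m ] norm x ≡ P * P * m
    p∣⇒norm (y , refl) = norm y , norm-• P y

    ∣ᴴ-all : ∀ {x} → P ∣ᴴ x → ∀ {a} → (λ σ → norm σ ≡ P) HasSize a → (λ σ → norm σ ≡ P × P ∣ᴴ σ ⋆ · x) HasSize a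
    ∣ᴴ-all p∣x = HasSize-⇔ (λ σ n → n , ∣ᴴ-·ˡ (σ ⋆) p∣x) (λ _ → proj₁)

    -- Count pairs with `x = π y`. For fixed `π` they correspond to the `y` of norm `m`; for fixed
    -- `x`, every `π` occurs if `p` divides `x`, and eight occur otherwise.
    norm-multiple-count : ∀ {m A a b} → (λ σ → norm σ ≡ P) HasSize A → (λ x → norm x ≡ m) HasSize a →
      (λ x → norm x ≡ P * m) HasSize b → ∃[ k ] ∃[ l ] k ℕ.+ l ≡ b × A ℕ.* a ≡ k ℕ.* A ℕ.+ l ℕ.* 8
    norm-multiple-count {m} hA ha hb = k , double-count (λ π x → P ∣ᴴ? (π ⋆ · x)) (P ∣ᴴ?_) hA hb row
      (λ x _ p∣x → ∣ᴴ-all p∣x hA)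
      (λ x norm-x p∤x → left-divisors p∤x (divides m (trans norm-x (ℤ.*-comm P m))))
      hk
      where
      k = proj₁ (HasSize-filter hb (P ∣ᴴ?_))
      hk = proj₂ (HasSize-filter hb (P ∣ᴴ?_))
      row : ∀ π → norm π ≡ P → (λ x → norm x ≡ P * m × P ∣ᴴ π ⋆ · x) HasSize _
      row π norm-π = HasSize-map (π ·_)
        (λ y norm-y → trans (norm-· π y) (cong₂ _*_ norm-π norm-y) , y , ⋆π· y)
        (λ y z _ _ eq → •-cancel P (trans (sym (⋆π· y)) (trans (cong (π ⋆ ·_) eq) (⋆π· z))))
        (λ x (norm-x , y , π⋆x≡py) → y , norm-factor y x norm-x (π·≡ x y π⋆x≡py) , π·≡ x y π⋆x≡py) ha
        where
        open ≡-Reasoning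
        ⋆π· : ∀ u → π ⋆ · (π · u) ≡ P • u
        ⋆π· u = trans (⋆-·-· π u) (cong (_• u) norm-π)
        π·≡ : ∀ x y → π ⋆ · x ≡ P • y → π · y ≡ x
        π·≡ x y eq = •-cancel P (begin
          P • (π · y)       ≡⟨ ·-• P π y ⟨
          π · P • y         ≡⟨ cong (π ·_) eq ⟨
          π · (π ⋆ · x)     ≡⟨ ·-⋆-· π x ⟩
          norm π • x        ≡⟨ cong (_• x) norm-π ⟩
          P • x             ∎)
        norm-factor : ∀ y x → norm x ≡ P * m → π · y ≡ x → norm y ≡ m
        norm-factor y x norm-x eq = ℤ.*-cancelˡ-≡ P (norm y) m
          (trans (cong (_* norm y) (sym norm-π)) (trans (sym (norm-· π y)) (trans (cong norm eq) norm-x)))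

    -- The pure quaternions play the role of ℤ³.
    Pure : ℍ → Set
    Pure x = re x ≡ 0ℤ

    pure-⋆ : ∀ {x} → Pure x → x ⋆ ≡ ⊝ x
    pure-⋆ {quat a b c d} refl = refl

    pure-· : ∀ {x} → Pure x → x · x ≡ (- norm x) • 1ᴴ
    pure-· {x} pure = begin
      x · x                  ≡⟨ solve 1 (λ x → x :· x := :⊝ (x :· :⊝ x)) refl x ⟩
      ⊝ (x · ⊝ x)            ≡⟨ cong (λ y → ⊝ (x · y)) (pure-⋆ pure) ⟨
      ⊝ (x · x ⋆)            ≡⟨ cong ⊝_ (·-⋆-norm x) ⟩
      ⊝ (norm x • 1ᴴ)        ≡⟨ quat-≡ (neg 1ℤ) (neg 0ℤ) (neg 0ℤ) (neg 0ℤ) ⟩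
      (- norm x) • 1ᴴ        ∎
      where
      open ≡-Reasoning
      neg = ℤ.neg-distribˡ-* (norm x)

    sandwich-re : ∀ x y → re (x · y · x ⋆) ≡ norm x * re y
    sandwich-re x y = cong re (solve 2 (λ x y → :ι (:re (x :· y :· x :⋆)) := :ι (:norm x :*′ :re y)) refl x y)

    sandwich-norm : ∀ x y → norm (x · y · x ⋆) ≡ norm x * norm x * norm y
    sandwich-norm x y = begin
      norm (x · y · x ⋆)               ≡⟨ norm-· (x · y) (x ⋆) ⟩
      norm (x · y) * norm (x ⋆)        ≡⟨ cong₂ _*_ (norm-· x y) (norm-⋆ x) ⟩
      norm x * norm y * norm x         ≡⟨ rearrange (norm x) (norm y) ⟩
      norm x * norm x * norm y         ∎
      where
      open ≡-Reasoning
      rearrange : ∀ m n → m * n * m ≡ m * m * n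
      rearrange = solve-∀

    ⋆-sandwich : ∀ x y → x ⋆ · (x · y · x ⋆) · x ≡ norm x • norm x • y
    ⋆-sandwich = solve 2 (λ x y → x :⋆ :· (x :· y :· x :⋆) :· x := :norm x :• :norm x :• y) refl

    sandwich-⋆ : ∀ x y → x · (x ⋆ · y · x) · x ⋆ ≡ norm x • norm x • y
    sandwich-⋆ = solve 2 (λ x y → x :· (x :⋆ :· y :· x) :· x :⋆ := :norm x :• :norm x :• y) refl

    -- The trace formula `w c + c⋆ w⋆ = 2 re (w c)`, multiplied by `w` from the right.
    twist : ∀ w c → w · c · w ≡ (+ 2 * re (w · c)) • w ⊖ norm w • c ⋆
    twist = solve 2 (λ w c → w :· c :· w := (:con (+ 2) :*′ :re (w :· c)) :• w :⊖ :norm w :• c :⋆) refl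

    -- Multiply `twist` for `c = b π⋆` by `π` from the right. The left side contains `π⋆ w π`, and
    -- `norm w` is a multiple of `p`, so `p` divides `2 re (w c) (w π)`. As it divides neither 2 nor
    -- `w π`, it divides `re (w c)`, which is `re (π⋆ w b)` because the real part is cyclic.
    p∣re : ∀ {π w} → P ∣ᶻ norm w → ¬ P ∣ᴴ w · π → P ∣ᴴ π ⋆ · w · π → ∀ b → P ∣ᶻ re (π ⋆ · w · b)
    p∣re {π} {w} (divides n norm-w) p∤wπ (u , eq) b = fromDec (P ∣? re (π ⋆ · w · b))
      where
      open ≡-Reasoning
      s : ℤ
      s = re (π ⋆ · w · b)
      cyclic : s ≡ re (w · (b · π ⋆))
      cyclic = cong re (solve 3 (λ π w b → :ι (:re (π :⋆ :· w :· b)) := :ι (:re (w :· (b :· π :⋆)))) refl π w b)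
      2s-multiple : P ∣ᴴ (+ 2 * s) • (w · π)
      2s-multiple = w · b · u ⊕ n • (π · b ⋆ · π) , (begin
        (+ 2 * s) • (w · π)                                          ≡⟨ cong (λ s → (+ 2 * s) • (w · π)) cyclic ⟩
        (+ 2 * re (w · c)) • (w · π)                                 ≡⟨ solve 4 (λ n w c π →
           (:con (+ 2) :*′ :re (w :· c)) :• (w :· π) := ((:con (+ 2) :*′ :re (w :· c)) :• w :⊖ :re n :• c :⋆) :· π :⊕
               :re n :• (c :⋆ :· π)) refl (ι (norm w)) w c π ⟩
        ((+ 2 * re (w · c)) • w ⊖ norm w • c ⋆) · π ⊕ norm w • (c ⋆ · π) ≡⟨ cong (λ x → x · π ⊕ norm w • (c ⋆ · π)) (twist w c) ⟨
        w · c · w · π ⊕ norm w • (c ⋆ · π)                           ≡⟨ cong₂ _⊕_ (regroup w b (π ⋆) π)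
            (cong₂ _•_ norm-w (cong (_· π) (trans (·-⋆ b (π ⋆)) (cong (_· b ⋆) (⋆-⋆ π))))) ⟩
        w · b · (π ⋆ · w · π) ⊕ (n * P) • (π · b ⋆ · π)              ≡⟨ cong (λ x → w · b · x ⊕ (n * P) • (π · b ⋆ · π)) eq ⟩
        w · b · P • u ⊕ (n * P) • (π · b ⋆ · π)                      ≡⟨ cong₂ _⊕_ (·-• P (w · b) u)
            (trans (cong (_• (π · b ⋆ · π)) (ℤ.*-comm n P)) (sym (•-• P n _))) ⟩
        P • (w · b · u) ⊕ P • n • (π · b ⋆ · π)                      ≡⟨ •-⊕ P _ _ ⟩
        P • (w · b · u ⊕ n • (π · b ⋆ · π))                          ∎)
        where
        c = b · π ⋆
        •-⊕ : ∀ k x y → k • x ⊕ k • y ≡ k • (x ⊕ y)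
        •-⊕ k = solve 3 (λ k x y → :re k :• x :⊕ :re k :• y := :re k :• (x :⊕ y)) refl (ι k)
        regroup : ∀ w b q π → w · (b · q) · w · π ≡ w · b · (q · w · π)
        regroup w b q π = begin
          w · (b · q) · w · π      ≡⟨ cong (λ x → x · w · π) (·-assoc w b q) ⟨
          w · b · q · w · π        ≡⟨ cong (_· π) (·-assoc (w · b) q w) ⟩
          w · b · (q · w) · π      ≡⟨ ·-assoc (w · b) (q · w) π ⟩
          w · b · (q · w · π)      ∎
      fromDec : Dec (P ∣ᶻ s) → P ∣ᶻ s
      fromDec (yes p∣s) = p∣s
      fromDec (no p∤s)  = contradiction (euclidᴴ (w · π) p∤2s 2s-multiple) p∤wπ
        where
        p∤2s : ¬ P ∣ᶻ + 2 * s
        p∤2s p∣2s = p∤s (euclid-cancel s (odd-∤2 3≤p) p∣2s)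

    -- For `b` equal to 1, -i, -j and -k the real part of `x b` is a coordinate of `x`.
    re-basis : ∀ {k x} → (∀ b → k ∣ᶻ re (x · b)) → k ∣ᴴ x
    re-basis {k} {quat a b c d} f = components⇒∣ᴴ
      (subst (k ∣ᶻ_) (r₀ a b c d) (f 1ᴴ)) (subst (k ∣ᶻ_) (r₁ a b c d) (f (quat 0ℤ (- 1ℤ) 0ℤ 0ℤ)))
      (subst (k ∣ᶻ_) (r₂ a b c d) (f (quat 0ℤ 0ℤ (- 1ℤ) 0ℤ))) (subst (k ∣ᶻ_) (r₃ a b c d) (f (quat 0ℤ 0ℤ 0ℤ (- 1ℤ))))
      where
      r₀ : ∀ a b c d → a * 1ℤ - b * 0ℤ - c * 0ℤ - d * 0ℤ ≡ a
      r₀ = solve-∀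
      r₁ : ∀ a b c d → a * 0ℤ - b * (- 1ℤ) - c * 0ℤ - d * 0ℤ ≡ b
      r₁ = solve-∀
      r₂ : ∀ a b c d → a * 0ℤ - b * 0ℤ - c * (- 1ℤ) - d * 0ℤ ≡ c
      r₂ = solve-∀
      r₃ : ∀ a b c d → a * 0ℤ - b * 0ℤ - c * 0ℤ - d * (- 1ℤ) ≡ d
      r₃ = solve-∀

    -- For pure `w`, minus the conjugate of `w π` is `π⋆ w`. So if `p` did not divide `π⋆ w`, it
    -- would not divide `w π`, and `p∣re` for all `b` would force it to divide `π⋆ w` after all.
    ∣-sandwich⇒∣ : ∀ {π w} → Pure w → P ∣ᶻ norm w → P ∣ᴴ π ⋆ · w · π → P ∣ᴴ π ⋆ · w
    ∣-sandwich⇒∣ {π} {w} pure p∣norm p∣π⋆wπ = fromDec (P ∣ᴴ? (π ⋆ · w))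
      where
      wπ⇒π⋆w : P ∣ᴴ w · π → P ∣ᴴ π ⋆ · w
      wπ⇒π⋆w p∣wπ = subst (P ∣ᴴ_) (trans (cong ⊝_ (·-⋆ w π)) (trans (cong (λ x → ⊝ (π ⋆ · x)) (pure-⋆ pure))
        (solve 2 (λ π w → :⊝ (π :⋆ :· :⊝ w) := π :⋆ :· w) refl π w))) (negate (∣ᴴ-⋆ p∣wπ))
        where
        negate : ∀ {x} → P ∣ᴴ x → P ∣ᴴ ⊝ x
        negate (y , refl) = ⊝ y , solve 2 (λ p y → :⊝ (:re p :• y) := :re p :• :⊝ y) refl (ι P) y
      fromDec : Dec (P ∣ᴴ π ⋆ · w) → P ∣ᴴ π ⋆ · w
      fromDec (yes p∣) = p∣
      fromDec (no p∤)  = re-basis (p∣re p∣norm (λ p∣wπ → p∤ (wπ⇒π⋆w p∣wπ)) p∣π⋆wπ)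

    p²∣⇒ : ∀ {π x} → norm π ≡ P → P * P ∣ᴴ π ⋆ · x · π → P ∣ᴴ π ⋆ · x
    p²∣⇒ {π} {x} norm-π (y , eq) = y · π ⋆ , •-cancel P (begin
      P • (π ⋆ · x)           ≡⟨ cong (_• (π ⋆ · x)) norm-π ⟨
      norm π • (π ⋆ · x)      ≡⟨ ·-·-⋆ (π ⋆ · x) π ⟨
      π ⋆ · x · π · π ⋆       ≡⟨ cong (_· π ⋆) eq ⟩
      ((P * P) • y) · π ⋆     ≡⟨ •-· (P * P) y (π ⋆) ⟩
      (P * P) • (y · π ⋆)     ≡⟨ •-• P P (y · π ⋆) ⟨
      P • P • (y · π ⋆)       ∎)
      where open ≡-Reasoning

    -- Write `π⋆ x = p z`. Since `x` is pure, its square is `- norm x`, so `p z x` is a multiple of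
    -- `p² π⋆` and `p` divides `z x`. Now `x ≼ π` lets it divide `z π`, which is the second factor
    -- `p`.
    ⇒p²∣ : ∀ {π x n} → Pure x → ¬ P ∣ᴴ x → norm x ≡ P * P * n → norm π ≡ P → P ∣ᴴ π ⋆ · x → P * P ∣ᴴ π ⋆ · x · π
    ⇒p²∣ {π} {x} {n} pure p∤x norm-x norm-π p∣π⋆x@(z , π⋆x≡pz) = collect (x≼π z (- n • π ⋆ , zx≡))
      where
      open ≡-Reasoning
      x≼π : x ≼ π
      x≼π = ∣⇒≼ p∤x (divides (P * n) (trans norm-x (rearrange P n))) norm-π p∣π⋆x
        where
        rearrange : ∀ p n → p * p * n ≡ p * n * p
        rearrange = solve-∀
      zx≡ : z · x ≡ P • - n • π ⋆
      zx≡ = •-cancel P (begin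
        P • (z · x)               ≡⟨ •-· P z x ⟨
        (P • z) · x               ≡⟨ cong (_· x) π⋆x≡pz ⟨
        π ⋆ · x · x               ≡⟨ ·-assoc (π ⋆) x x ⟩
        π ⋆ · (x · x)             ≡⟨ cong (π ⋆ ·_) (pure-· pure) ⟩
        π ⋆ · (- norm x) • 1ᴴ     ≡⟨ cong (λ n → π ⋆ · (- n) • 1ᴴ) norm-x ⟩
        π ⋆ · (- (P * P * n)) • 1ᴴ ≡⟨ trans (·-• (- (P * P * n)) (π ⋆) 1ᴴ) (cong ((- (P * P * n)) •_) (·-1ᴴ (π ⋆))) ⟩
        (- (P * P * n)) • π ⋆     ≡⟨ cong (_• π ⋆) (rearrange P n) ⟩
        (P * (P * - n)) • π ⋆     ≡⟨ trans (cong (P •_) (•-• P (- n) (π ⋆))) (•-• P (P * - n) (π ⋆)) ⟨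
        P • P • - n • π ⋆         ∎)
        where
        rearrange : ∀ p n → - (p * p * n) ≡ p * (p * - n)
        rearrange = solve-∀
      collect : P ∣ᴴ z · π → P * P ∣ᴴ π ⋆ · x · π
      collect (v , zπ≡pv) = v , (begin
        π ⋆ · x · π       ≡⟨ cong (_· π) π⋆x≡pz ⟩
        (P • z) · π       ≡⟨ •-· P z π ⟩
        P • (z · π)       ≡⟨ cong (P •_) zπ≡pv ⟩
        P • P • v         ≡⟨ •-• P P v ⟩
        (P * P) • v       ∎)

    -- The condition P * P ∣ᴴ π ⋆ · x · π says that x = π y π⋆ for an integral y.
    sandwich-divisors : ∀ {n x} → P ∣ᶻ n → Pure x → norm x ≡ P * P * n → ¬ P * P ∣ᴴ x →
      (λ π → norm π ≡ P × P * P ∣ᴴ π ⋆ · x · π) HasSize 8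
    sandwich-divisors {n} {x} p∣n pure norm-x p²∤x = cases (P ∣ᴴ? x)
      where
      cases : Dec (P ∣ᴴ x) → (λ π → norm π ≡ P × P * P ∣ᴴ π ⋆ · x · π) HasSize 8
      cases (no p∤x) = HasSize-⇔
        (λ π (norm-π , p∣) → norm-π , ⇒p²∣ pure p∤x norm-x norm-π p∣)
        (λ π (norm-π , p²∣) → norm-π , p²∣⇒ norm-π p²∣)
        (left-divisors p∤x (divides (P * n) (trans norm-x (rearrange P n))))
        where
        rearrange : ∀ p n → p * p * n ≡ p * n * p
        rearrange = solve-∀
      -- For `x = p w` one factor `p` cancels and `w` has norm `n`. The divisibility of `n` by `p`
      -- is what gives `w` its left divisors.
      cases (yes (w , refl)) = HasSize-⇔
        (λ π (norm-π , p∣) → norm-π , up p∣)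
        (λ π (norm-π , p²∣) → norm-π , ∣-sandwich⇒∣ pure-w p∣norm-w (down p²∣))
        (left-divisors (λ (v , eq) → p²∤x (v , trans (cong (P •_) eq) (•-• P P v))) p∣norm-w)
        where
        open ≡-Reasoning
        p∣norm-w : P ∣ᶻ norm w
        p∣norm-w = subst (P ∣ᶻ_) (sym (ℤ.*-cancelˡ-≡ (P * P) (norm w) n {{ℤ.i*j≢0 P P}} (trans (sym (norm-• P w)) norm-x))) p∣n
        pure-w : Pure w
        pure-w = ℤ.*-cancelˡ-≡ P (re w) 0ℤ (trans (sym (re-• P w)) (trans pure (sym (ℤ.*-zeroʳ P))))
        pull : ∀ π → π ⋆ · P • w · π ≡ P • (π ⋆ · w · π)
        pull π = trans (cong (_· π) (·-• P (π ⋆) w)) (•-· P (π ⋆ · w) π)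
        up : ∀ {π} → P ∣ᴴ π ⋆ · w → P * P ∣ᴴ π ⋆ · P • w · π
        up {π} (v , eq) = v · π , (begin
          π ⋆ · P • w · π         ≡⟨ pull π ⟩
          P • (π ⋆ · w · π)       ≡⟨ cong (λ y → P • (y · π)) eq ⟩
          P • ((P • v) · π)       ≡⟨ cong (P •_) (•-· P v π) ⟩
          P • P • (v · π)         ≡⟨ •-• P P (v · π) ⟩
          (P * P) • (v · π)       ∎)
        down : ∀ {π} → P * P ∣ᴴ π ⋆ · P • w · π → P ∣ᴴ π ⋆ · w · π
        down {π} (v , eq) = v , •-cancel P (trans (sym (pull π)) (trans eq (sym (•-• P P v))))

    -- Sending `y` to `π y π⋆` multiplies the norm by `p²` and keeps pure quaternions pure, so a row
    -- is a copy of the pure `y` of norm `n`. A column is full for multiples of `p²` and has eight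
    -- entries otherwise.
    pure-count : ∀ {n A a b k} → P ∣ᶻ n → (λ σ → norm σ ≡ P) HasSize A →
      (λ x → Pure x × norm x ≡ n) HasSize a → (λ x → Pure x × norm x ≡ P * P * n) HasSize b →
      (λ x → (Pure x × norm x ≡ P * P * n) × P * P ∣ᴴ x) HasSize k →
      ∃[ l ] k ℕ.+ l ≡ b × A ℕ.* a ≡ k ℕ.* A ℕ.+ l ℕ.* 8
    pure-count {n} p∣n hA ha hb hk = double-count (λ π x → (P * P) ∣ᴴ? (π ⋆ · x · π)) ((P * P) ∣ᴴ?_) hA hb row
      (λ x _ p²∣x → HasSize-⇔ (λ π norm-π → norm-π , ∣ᴴ-·ʳ π (∣ᴴ-·ˡ (π ⋆) p²∣x)) (λ _ → proj₁) hA)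
      (λ x (pure , norm-x) p²∤x → sandwich-divisors p∣n pure norm-x p²∤x) hk
      where
      row : ∀ π → norm π ≡ P → (λ x → (Pure x × norm x ≡ P * P * n) × P * P ∣ᴴ π ⋆ · x · π) HasSize _
      row π norm-π = HasSize-map (λ y → π · y · π ⋆)
        (λ y (pure , norm-y) → (trans (sandwich-re π y) (trans (cong (norm π *_) pure) (ℤ.*-zeroʳ (norm π))) ,
          trans (sandwich-norm π y) (cong₂ _*_ (cong₂ _*_ norm-π norm-π) norm-y)) , y , p²-sandwich y)
        (λ y z _ _ eq → •-cancel (P * P) {{p²≢0}} (trans (sym (p²-sandwich y)) (trans (cong (λ x → π ⋆ · x · π) eq)
            (p²-sandwich z))))
        (λ x ((pure , norm-x) , y , eq) → onto x y pure norm-x eq) ha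
        where
        open ≡-Reasoning
        p²≢0 : ℤ.NonZero (P * P)
        p²≢0 = ℤ.i*j≢0 P P
        norm-•² : ∀ y → norm π • norm π • y ≡ (P * P) • y
        norm-•² y = trans (cong (λ m → m • m • y) norm-π) (•-• P P y)
        p²-sandwich : ∀ y → π ⋆ · (π · y · π ⋆) · π ≡ (P * P) • y
        p²-sandwich y = trans (⋆-sandwich π y) (norm-•² y)
        onto : ∀ x y → Pure x → norm x ≡ P * P * n → π ⋆ · x · π ≡ (P * P) • y →
               ∃[ y ] (Pure y × norm y ≡ n) × π · y · π ⋆ ≡ x
        onto x y pure norm-x eq = y , (pure-y , norm-y) , πyπ⋆≡x
          where
          πyπ⋆≡x : π · y · π ⋆ ≡ x
          πyπ⋆≡x = •-cancel (P * P) {{p²≢0}} (begin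
            (P * P) • (π · y · π ⋆)      ≡⟨ •-· (P * P) (π · y) (π ⋆) ⟨
            ((P * P) • (π · y)) · π ⋆    ≡⟨ cong (_· π ⋆) (·-• (P * P) π y) ⟨
            π · (P * P) • y · π ⋆        ≡⟨ cong (λ y → π · y · π ⋆) eq ⟨
            π · (π ⋆ · x · π) · π ⋆      ≡⟨ sandwich-⋆ π x ⟩
            norm π • norm π • x          ≡⟨ norm-•² x ⟩
            (P * P) • x                  ∎)
          norm-y : norm y ≡ n
          norm-y = ℤ.*-cancelˡ-≡ (P * P) (norm y) n {{p²≢0}} (begin
            P * P * norm y               ≡⟨ cong (λ m → m * m * norm y) norm-π ⟨
            norm π * norm π * norm y     ≡⟨ sandwich-norm π y ⟨
            norm (π · y · π ⋆)           ≡⟨ cong norm πyπ⋆≡x ⟩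
            norm x                       ≡⟨ norm-x ⟩
            P * P * n                    ∎)
          pure-y : Pure y
          pure-y = ℤ.*-cancelˡ-≡ P (re y) 0ℤ (begin
            P * re y               ≡⟨ cong (_* re y) norm-π ⟨
            norm π * re y          ≡⟨ sandwich-re π y ⟨
            re (π · y · π ⋆)       ≡⟨ cong re πyπ⋆≡x ⟩
            re x                   ≡⟨ pure ⟩
            0ℤ                     ≡⟨ ℤ.*-zeroʳ P ⟨
            P * 0ℤ                 ∎)

-- A conic modulo p and the number of quaternions of norm p

module Conics where
  open Quaternions
  open ℍ-Solver using (module P)
  open Counting
  open Descent
  open Representations
  open import Data.Empty using (⊥)
  open import Data.Fin as Fin using (Fin; toℕ; fromℕ<; splitAt; join)
  import Data.Fin.Properties as Fin
  open import Data.Integer as ℤ using (ℤ; +_; -_; _+_; _-_; _*_; 0ℤ; 1ℤ; ∣_∣)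
  open import Data.Integer.DivMod using (_/ℕ_; _%ℕ_; a≡a%ℕn+[a/ℕn]*n; n%ℕd<d)
  open import Data.Integer.Divisibility.Signed using (divides; _∣?_; ∣⇒∣ᵤ; ∣m∣n⇒∣m+n; ∣m∣n⇒∣m-n; ∣n⇒∣m*n; ∣m⇒∣m*n;
      ∣m⇒∣-m) renaming (_∣_ to infix 4 _∣ᶻ_)
  import Data.Integer.Solver as ℤ
  open import Data.List using ([]; _∷_; upTo)
  open import Data.List.Membership.Propositional.Properties using (∈-upTo⁺; ∈-upTo⁻)
  open import Data.List.Properties using (length-upTo)
  import Data.List.Relation.Unary.Unique.Propositional.Properties as Unique
  open import Data.Nat.Coprimality using (prime⇒coprime; coprime-Bézout)
  open import Data.Nat.GCD using (module Bézout)

  HasSize-< : ∀ n → (ℕ._< n) HasSize n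
  HasSize-< n = HasSize-≡ (enumeration (upTo n) (Unique.upTo⁺ n) ∈-upTo⁻ ∈-upTo⁺) (length-upTo n)

  HasSize-singleton : {A : Set} {P : A → Set} (x : A) → P x → (∀ y → P y → y ≡ x) → P HasSize 1
  HasSize-singleton x px unique = enumeration (x ∷ []) ([] ∷ []) (λ { (here refl) → px }) (λ py → here (unique _ py))

  module Residues {p : ℕ} (p-prime : Prime p) (3≤p : 3 ℕ.≤ p) where
    open Primes p-prime
    private
      P : ℤ
      P = + p
      instance
        p≢0 : ℕ.NonZero p
        p≢0 = prime⇒nonZero p-prime

    p∤1 : ¬ P ∣ᶻ 1ℤ
    p∤1 = small-∤ (ℕ.≤-trans (s≤s (s≤s z≤n)) 3≤p)

    %≡⇒∣ : ∀ i j → i %ℕ p ≡ j %ℕ p → P ∣ᶻ i - j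
    %≡⇒∣ i j eq = divides (i /ℕ p - j /ℕ p) (begin
      i - j                                                        ≡⟨ cong₂ _-_ (a≡a%ℕn+[a/ℕn]*n i p) (a≡a%ℕn+[a/ℕn]*n j p) ⟩
      + (i %ℕ p) + i /ℕ p * P - (+ (j %ℕ p) + j /ℕ p * P)          ≡⟨ cong (λ r → + r + i /ℕ p * P - (+ (j %ℕ p) + j
          /ℕ p * P)) eq ⟩
      + (j %ℕ p) + i /ℕ p * P - (+ (j %ℕ p) + j /ℕ p * P)          ≡⟨ cancel (+ (j %ℕ p)) (i /ℕ p) (j /ℕ p) P ⟩
      (i /ℕ p - j /ℕ p) * P                                        ∎)
      where
      open ≡-Reasoning
      cancel : ∀ r a b k → r + a * k - (r + b * k) ≡ (a - b) * k
      cancel = solve-∀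

    small-multiple : ∀ {m} → p ℕ.∣ m → m ℕ.< p → m ≡ 0
    small-multiple {zero}  _   _   = refl
    small-multiple {suc m} p∣m m<p = contradiction (ℕ.∣⇒≤ p∣m) (ℕ.<⇒≱ m<p)

    congruent⇒≡ : ∀ {a b} → a ℕ.< p → b ℕ.< p → P ∣ᶻ + a - + b → a ≡ b
    congruent⇒≡ {a} {b} a<p b<p p∣a-b = ℤ.+-injective (ℤ.i-j≡0⇒i≡j (+ a) (+ b)
      (ℤ.∣i∣≡0⇒i≡0 (small-multiple (∣⇒∣ᵤ p∣a-b)
        (subst (λ i → ∣ i ∣ ℕ.< p) (sym (ℤ.m-n≡m⊖n a b)) (ℕ.≤-<-trans (ℤ.∣m⊝n∣≤m⊔n a b) (ℕ.⊔-lub a<p b<p))))))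

    half-p : ∃[ h ] p ≡ suc (h ℕ.+ h)
    half-p = p ℕ./ 2 , trans (ℕ.m≡m%n+[m/n]*n p 2) (parity (p ℕ.% 2) refl (ℕ.m%n<n p 2))
      where
      parity : ∀ r → r ≡ p ℕ.% 2 → r ℕ.< 2 → r ℕ.+ p ℕ./ 2 ℕ.* 2 ≡ suc (p ℕ./ 2 ℕ.+ p ℕ./ 2)
      parity 0 eq _ = contradiction (trans (ℕ.*-comm 2 (p ℕ./ 2)) (sym (trans (ℕ.m≡m%n+[m/n]*n p 2)
          (cong (ℕ._+ p ℕ./ 2 ℕ.* 2) (sym eq))))) (half-∤ 3≤p (p ℕ./ 2))
      parity 1 eq _ = cong suc (trans (ℕ.*-comm (p ℕ./ 2) 2) (cong (p ℕ./ 2 ℕ.+_) (ℕ.+-identityʳ _)))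
      parity (suc (suc _)) _ (s≤s (s≤s ()))

    Conic : ℤ → ℤ → Set
    Conic α β = P ∣ᶻ 1ℤ + α * α + β * β

    module _ {h : ℕ} (p≡ : p ≡ suc (h ℕ.+ h)) where
      -- Either `a - b` or `a + b` is a multiple of `p`, and both are below `p` in absolute value
      -- since `a + b ≤ 2 h = p - 1`.
      equal-squares : ∀ {a b} → a ℕ.≤ h → b ℕ.≤ h → P ∣ᶻ + a * + a - + b * + b → a ≡ b
      equal-squares {a} {b} a≤h b≤h p∣ = cases (euclid (+ a - + b) (+ a + + b) (subst (P ∣ᶻ_) (factor (+ a) (+ b)) p∣))
        where
        factor : ∀ a b → a * a - b * b ≡ (a - b) * (a + b)
        factor = solve-∀
        below : ∀ {c} → c ℕ.≤ h ℕ.+ h → c ℕ.< p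
        below c≤ = subst (_ ℕ.<_) (sym p≡) (s≤s c≤)
        cases : P ∣ᶻ + a - + b ⊎ P ∣ᶻ + a + + b → a ≡ b
        cases (inj₁ p∣) = congruent⇒≡ (below (ℕ.≤-trans a≤h (ℕ.m≤m+n h h))) (below (ℕ.≤-trans b≤h (ℕ.m≤m+n h h))) p∣
        cases (inj₂ p∣) = trans (ℕ.m+n≡0⇒m≡0 a a+b≡0) (sym (ℕ.m+n≡0⇒n≡0 a a+b≡0))
          where
          a+b≡0 : a ℕ.+ b ≡ 0
          a+b≡0 = small-multiple (∣⇒∣ᵤ p∣) (below (ℕ.+-mono-≤ a≤h b≤h))

      -- The values i² and -1 - j² with 0 ≤ i, j ≤ h are p + 1 integers, so two
      -- of them agree modulo p.
      value : Fin (suc h) ⊎ Fin (suc h) → ℤ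
      value (inj₁ i) = + toℕ i * + toℕ i
      value (inj₂ j) = - 1ℤ - + toℕ j * + toℕ j

      -- By `equal-squares` a collision cannot occur within one of the two families; one between the
      -- families is a point of the conic.
      value-collision : ∀ x y → x ≢ y → P ∣ᶻ value x - value y → ∃[ α ] ∃[ β ] Conic α β
      value-collision (inj₁ i) (inj₁ j) x≢y p∣ = contradiction
        (cong inj₁ (Fin.toℕ-injective (equal-squares (Fin.toℕ≤pred[n] i) (Fin.toℕ≤pred[n] j) p∣))) x≢y
      value-collision (inj₂ i) (inj₂ j) x≢y p∣ = contradiction
        (cong inj₂ (Fin.toℕ-injective (sym (equal-squares (Fin.toℕ≤pred[n] j) (Fin.toℕ≤pred[n] i)
          (subst (P ∣ᶻ_) (shift (+ toℕ i) (+ toℕ j)) p∣))))) x≢y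
        where
        shift : ∀ i j → - 1ℤ - i * i - (- 1ℤ - j * j) ≡ j * j - i * i
        shift = solve-∀
      value-collision (inj₁ i) (inj₂ j) x≢y p∣ = + toℕ i , + toℕ j , subst (P ∣ᶻ_) (shift (+ toℕ i) (+ toℕ j)) p∣
        where
        shift : ∀ i j → i * i - (- 1ℤ - j * j) ≡ 1ℤ + i * i + j * j
        shift = solve-∀
      value-collision (inj₂ i) (inj₁ j) x≢y p∣ = + toℕ i , + toℕ j , subst (P ∣ᶻ_) (shift (+ toℕ i) (+ toℕ j)) (∣m⇒∣-m p∣)
        where
        shift : ∀ i j → - (- 1ℤ - i * i - j * j) ≡ 1ℤ + i * i + j * j
        shift = solve-∀

      conic-point : ∃[ α ] ∃[ β ] Conic α β
      conic-point = collide (Fin.pigeonhole p<2h+2 residue)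
        where
        p<2h+2 : p ℕ.< suc h ℕ.+ suc h
        p<2h+2 = ℕ.≤-reflexive (trans (cong suc p≡) (cong suc (sym (ℕ.+-suc h h))))
        residue : Fin (suc h ℕ.+ suc h) → Fin p
        residue i = fromℕ< (n%ℕd<d (value (splitAt (suc h) i)) p)
        toℕ-residue : ∀ i → toℕ (residue i) ≡ value (splitAt (suc h) i) %ℕ p
        toℕ-residue i = Fin.toℕ-fromℕ< (n%ℕd<d (value (splitAt (suc h) i)) p)
        split≢ : ∀ i j → i Fin.< j → splitAt (suc h) i ≢ splitAt (suc h) j
        split≢ i j i<j eq = ℕ.<-irrefl (cong toℕ (trans (sym (Fin.join-splitAt (suc h) (suc h) i))
          (trans (cong (join (suc h) (suc h)) eq) (Fin.join-splitAt (suc h) (suc h) j)))) i<j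
        collide : (∃[ i ] ∃[ j ] i Fin.< j × residue i ≡ residue j) → ∃[ α ] ∃[ β ] Conic α β
        collide (i , j , i<j , eq) = value-collision (splitAt (suc h) i) (splitAt (suc h) j) (split≢ i j i<j)
          (%≡⇒∣ (value (splitAt (suc h) i)) (value (splitAt (suc h) j)) (trans (sym (toℕ-residue i))
              (trans (cong toℕ eq) (toℕ-residue j))))

    -- If `p` divided both coordinates it would divide 1, so exchanging them if necessary makes `β`
    -- invertible. `∣-component` has to divide by `β`.
    smooth-conic-point : ∃[ α ] ∃[ β ] Conic α β × ¬ P ∣ᶻ β
    smooth-conic-point = smooth (conic-point {proj₁ half-p} (proj₂ half-p))
      where
      swap : ∀ α β → 1ℤ + α * α + β * β ≡ 1ℤ + β * β + α * α
      swap = solve-∀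
      isolate : ∀ α β → 1ℤ + α * α + β * β - α * α - β * β ≡ 1ℤ
      isolate = solve-∀
      smooth : (∃[ α ] ∃[ β ] Conic α β) → ∃[ α ] ∃[ β ] Conic α β × ¬ P ∣ᶻ β
      smooth (α , β , p∣) = choose (P ∣? β)
        where
        choose : Dec (P ∣ᶻ β) → ∃[ α ] ∃[ β ] Conic α β × ¬ P ∣ᶻ β
        choose (no p∤β)  = α , β , p∣ , p∤β
        choose (yes p∣β) = β , α , subst (P ∣ᶻ_) (swap α β) p∣ ,
          λ p∣α → p∤1 (subst (P ∣ᶻ_) (isolate α β) (∣m∣n⇒∣m-n (∣m∣n⇒∣m-n p∣ (∣n⇒∣m*n α p∣α)) (∣n⇒∣m*n β p∣β)))

    inverse : ∀ a → ¬ P ∣ᶻ a → ∃[ c ] P ∣ᶻ a * c - 1ℤ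
    inverse a p∤a = finish (coprime-Bézout (prime⇒coprime p-prime {{ℕ.≢-nonZero r≢0}} (n%ℕd<d a p)))
      where
      r : ℕ
      r = a %ℕ p
      a≡ : a ≡ + r + a /ℕ p * P
      a≡ = a≡a%ℕn+[a/ℕn]*n a p
      r≢0 : r ≢ 0
      r≢0 r≡0 = p∤a (divides (a /ℕ p) (trans a≡ (trans (cong (λ r → + r + a /ℕ p * P) r≡0) (ℤ.+-identityˡ _))))
      finish : Bézout.Identity 1 p r → ∃[ c ] P ∣ᶻ a * c - 1ℤ
      finish (Bézout.+- x y eq) = - + y , divides (- (+ x) - a /ℕ p * + y)
        (trans (cong (λ a → a * - + y - 1ℤ) a≡) (trans (expand (+ r) (a /ℕ p) P (+ y))
          (trans (cong (λ s → - s - a /ℕ p * + y * P) eqℤ) (collect (+ x) (a /ℕ p) P (+ y)))))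
        where
        eqℤ : 1ℤ + + y * + r ≡ + x * P
        eqℤ = trans (cong (λ i → 1ℤ + i) (sym (ℤ.pos-* y r))) (trans (cong +_ eq) (ℤ.pos-* x p))
        expand : ∀ r q p y → (r + q * p) * - y - 1ℤ ≡ - (1ℤ + y * r) - q * y * p
        expand = solve-∀
        collect : ∀ x q p y → - (x * p) - q * y * p ≡ (- x - q * y) * p
        collect = solve-∀
      finish (Bézout.-+ x y eq) = + y , divides (+ x + a /ℕ p * + y)
        (trans (cong (λ a → a * + y - 1ℤ) a≡) (trans (expand (+ r) (a /ℕ p) P (+ y))
          (trans (cong (λ s → s - 1ℤ + a /ℕ p * + y * P) (sym eqℤ)) (collect (+ x) (a /ℕ p) P (+ y)))))
        where
        eqℤ : 1ℤ + + x * P ≡ + y * + r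
        eqℤ = trans (cong (λ i → 1ℤ + i) (sym (ℤ.pos-* x p))) (trans (cong +_ eq) (ℤ.pos-* y r))
        expand : ∀ r q p y → (r + q * p) * y - 1ℤ ≡ y * r - 1ℤ + q * y * p
        expand = solve-∀
        collect : ∀ x q p y → 1ℤ + x * p - 1ℤ + q * y * p ≡ (x + q * y) * p
        collect = solve-∀

    linear-root : ∀ a b → ¬ P ∣ᶻ a → ∃[ t ] t ℕ.< p × P ∣ᶻ + t * a + b
    linear-root a b p∤a = root (inverse a p∤a)
      where
      open ≡-Reasoning
      remainder : ∀ r m → r ≡ r + m - m
      remainder = solve-∀
      expand : ∀ a b c m p → (- (b * c) - m * p) * a + b ≡ - (b * (a * c - 1ℤ)) - m * p * a
      expand = solve-∀
      collect : ∀ a b q m p → - (b * (q * p)) - m * p * a ≡ (- (b * q) - m * a) * p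
      collect = solve-∀
      root : (∃[ c ] P ∣ᶻ a * c - 1ℤ) → ∃[ t ] t ℕ.< p × P ∣ᶻ + t * a + b
      root (c , divides q ac-1≡) = s %ℕ p , n%ℕd<d s p , divides (- (b * q) - s /ℕ p * a) (begin
        + (s %ℕ p) * a + b                                      ≡⟨ cong (λ t → t * a + b) (remainder (+ (s %ℕ p)) (s /ℕ p * P)) ⟩
        (+ (s %ℕ p) + s /ℕ p * P - s /ℕ p * P) * a + b          ≡⟨ cong (λ s′ → (s′ - s /ℕ p * P) * a + b) (a≡a%ℕn+[a/ℕn]*n s p) ⟨
        (s - s /ℕ p * P) * a + b                                ≡⟨ expand a b c (s /ℕ p) P ⟩
        - (b * (a * c - 1ℤ)) - s /ℕ p * P * a                   ≡⟨ cong (λ m → - (b * m) - s /ℕ p * P * a) ac-1≡ ⟩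
        - (b * (q * P)) - s /ℕ p * P * a                        ≡⟨ collect a b q (s /ℕ p) P ⟩
        (- (b * q) - s /ℕ p * a) * P                            ∎)
        where
        s : ℤ
        s = - (b * c)

    -- The indices 0 and suc t stand for the points (1 : 0) and (t : 1) of the
    -- projective line over ℤ/p.
    Root : (e₀ e₁ f₀ f₁ : ℤ) → ℕ → Set
    Root e₀ e₁ f₀ f₁ zero    = P ∣ᶻ e₀ × P ∣ᶻ e₁
    Root e₀ e₁ f₀ f₁ (suc t) = P ∣ᶻ + t * e₀ + f₀ × P ∣ᶻ + t * e₁ + f₁

    -- The first equation has exactly one solution because `e₀` is invertible; the vanishing
    -- determinant makes it solve the second.
    one-finite-root : ∀ e₀ e₁ f₀ f₁ → P ∣ᶻ e₀ * f₁ - e₁ * f₀ → ¬ P ∣ᶻ e₀ →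
                      (λ t → t ℕ.< suc p × Root e₀ e₁ f₀ f₁ t) HasSize 1
    one-finite-root e₀ e₁ f₀ f₁ p∣det p∤e₀ = only-root (linear-root e₀ f₀ p∤e₀)
      where
      combine : ∀ e₀ e₁ f₀ f₁ t → e₀ * f₁ - e₁ * f₀ + e₁ * (t * e₀ + f₀) ≡ e₀ * (t * e₁ + f₁)
      combine = solve-∀
      difference : ∀ e f s t → s * e + f - (t * e + f) ≡ e * (s - t)
      difference = solve-∀
      only-root : (∃[ t ] t ℕ.< p × P ∣ᶻ + t * e₀ + f₀) → (λ t → t ℕ.< suc p × Root e₀ e₁ f₀ f₁ t) HasSize 1
      only-root (t , t<p , p∣₀) = HasSize-singleton (suc t) (s≤s t<p , p∣₀ , p∣₁) only
        where
        p∣₁ : P ∣ᶻ + t * e₁ + f₁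
        p∣₁ = euclid-cancel (+ t * e₁ + f₁) p∤e₀ (subst (P ∣ᶻ_) (combine e₀ e₁ f₀ f₁ (+ t)) (∣m∣n⇒∣m+n p∣det (∣n⇒∣m*n e₁ p∣₀)))
        only : ∀ s → s ℕ.< suc p × Root e₀ e₁ f₀ f₁ s → s ≡ suc t
        only zero    (_ , p∣e₀ , _) = contradiction p∣e₀ p∤e₀
        only (suc s) (s≤s s<p , p∣ , _) = cong suc (congruent⇒≡ s<p t<p
          (euclid-cancel (+ s - + t) p∤e₀ (subst (P ∣ᶻ_) (difference e₀ f₀ (+ s) (+ t)) (∣m∣n⇒∣m-n p∣ p∣₀))))

    -- A nonzero singular 2 by 2 matrix over ℤ/p has rank 1, so its kernel is one point of the
    -- projective line. It is (1 : 0) exactly if `e₀` and `e₁` vanish.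
    one-root : ∀ e₀ e₁ f₀ f₁ → P ∣ᶻ e₀ * f₁ - e₁ * f₀ →
               ¬ (P ∣ᶻ e₀ × P ∣ᶻ e₁ × P ∣ᶻ f₀ × P ∣ᶻ f₁) →
               (λ t → t ℕ.< suc p × Root e₀ e₁ f₀ f₁ t) HasSize 1
    one-root e₀ e₁ f₀ f₁ p∣det nonzero = cases (P ∣? e₀) (P ∣? e₁)
      where
      flip-det : ∀ e₀ e₁ f₀ f₁ → - (e₀ * f₁ - e₁ * f₀) ≡ e₁ * f₀ - e₀ * f₁
      flip-det = solve-∀
      swap : ∀ {e₀ e₁ f₀ f₁} t → Root e₁ e₀ f₁ f₀ t → Root e₀ e₁ f₀ f₁ t
      swap zero    (r₁ , r₂) = r₂ , r₁
      swap (suc t) (r₁ , r₂) = r₂ , r₁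
      subtract : ∀ e f s → s * e + f - s * e ≡ f
      subtract = solve-∀
      isolate : ∀ s e f → P ∣ᶻ + s * e + f → P ∣ᶻ e → P ∣ᶻ f
      isolate s e f p∣ p∣e = subst (P ∣ᶻ_) (subtract e f (+ s)) (∣m∣n⇒∣m-n p∣ (∣n⇒∣m*n (+ s) p∣e))
      cases : Dec (P ∣ᶻ e₀) → Dec (P ∣ᶻ e₁) → (λ t → t ℕ.< suc p × Root e₀ e₁ f₀ f₁ t) HasSize 1
      cases (no p∤e₀) _ = one-finite-root e₀ e₁ f₀ f₁ p∣det p∤e₀
      cases (yes _) (no p∤e₁) = HasSize-⇔ (λ t (t< , root) → t< , swap t root) (λ t (t< , root) → t< , swap t root)
        (one-finite-root e₁ e₀ f₁ f₀ (subst (P ∣ᶻ_) (flip-det e₀ e₁ f₀ f₁) (∣m⇒∣-m p∣det)) p∤e₁)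
      cases (yes p∣e₀) (yes p∣e₁) = HasSize-singleton 0 (s≤s z≤n , p∣e₀ , p∣e₁) only
        where
        only : ∀ s → s ℕ.< suc p × Root e₀ e₁ f₀ f₁ s → s ≡ 0
        only zero    _ = refl
        only (suc s) (_ , p∣₀ , p∣₁) = contradiction
          (p∣e₀ , p∣e₁ , isolate s e₀ f₀ p∣₀ p∣e₀ , isolate s e₁ f₁ p∣₁ p∣e₁) nonzero

  module ConicSolver where
    open ℤ.+-*-Solver using (Polynomial; solve; con; _:=_; _:+_; _:-_; _:*_) public
    open P using () renaming (_*ᴴ_ to _:·_) public
    I : ∀ {n} → Quaternion (Polynomial n)
    I = quat (con 0ℤ) (con 1ℤ) (con 0ℤ) (con 0ℤ)
    R : ∀ {n} (a b : Polynomial n) → Quaternion (Polynomial n)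
    R a b = quat (con 1ℤ) a b (con 0ℤ)

  iᴴ : ℍ
  iᴴ = quat 0ℤ 1ℤ 0ℤ 0ℤ

  module ConicPoint {p : ℕ} (p-prime : Prime p) (3≤p : 3 ℕ.≤ p)
                    (units : (λ u → norm u ≡ 1ℤ) HasSize 8)
                    (α β : ℤ) (on-conic : + p ∣ᶻ 1ℤ + α * α + β * β) (p∤β : ¬ + p ∣ᶻ β) where
    open Primes p-prime
    open Sandwich p-prime 3≤p units
    open Residues p-prime 3≤p

    ρ : ℍ
    ρ = quat 1ℤ α β 0ℤ

    -- The Gaussian integers 1 and t + i represent the points of the projective line, indexed as for
    -- `Root`.
    direction : ℕ → ℍ
    direction zero    = 1ᴴ
    direction (suc t) = ι (+ t) ⊕ iᴴ

    p∣norm-ρ : P ∣ᶻ norm ρ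
    p∣norm-ρ = subst (P ∣ᶻ_) (sym (ℤ.+-identityʳ (1ℤ + α * α + β * β))) on-conic

    -- Modulo `p`, the equation `ρ⋆ E = 0` expresses `β` times each of the last two coordinates of
    -- `E` through the first two. This reduces four conditions on `image t` to two linear ones in
    -- `t`.
    ∣-component : ∀ E → P ∣ᴴ ρ ⋆ · E → P ∣ᶻ re E → P ∣ᶻ im E → P ∣ᴴ E
    ∣-component (quat a b c d) p∣ρ⋆E p∣a p∣b = components⇒∣ᴴ p∣a p∣b
      (euclid-cancel c p∤β (subst (P ∣ᶻ_) (real α β a b c d) (∣m∣n⇒∣m-n (∣m∣n⇒∣m-n (proj₁ parts) p∣a) (∣n⇒∣m*n α p∣b))))
      (euclid-cancel d p∤β (subst (P ∣ᶻ_) (imaginary α β a b c d) (∣m∣n⇒∣m-n (∣m∣n⇒∣m-n p∣b (∣n⇒∣m*n α p∣a))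
          (proj₁ (proj₂ parts)))))
      where
      parts = ∣ᴴ⇒components p∣ρ⋆E
      real : ∀ α β a b c d → 1ℤ * a - (- α) * b - (- β) * c - (- 0ℤ) * d - a - α * b ≡ β * c
      real = solve-∀
      imaginary : ∀ α β a b c d → b - α * a - (1ℤ * b + (- α) * a + (- β) * d - (- 0ℤ) * c) ≡ β * d
      imaginary = solve-∀

    re-⊕ : ∀ k x y → re (k • x ⊕ y) ≡ k * re x + re y
    re-⊕ k (quat _ _ _ _) (quat _ _ _ _) = refl

    im-⊕ : ∀ k x y → im (k • x ⊕ y) ≡ k * im x + im y
    im-⊕ k (quat _ _ _ _) (quat _ _ _ _) = refl

    module _ (σ : ℍ) where
      e f : ℍ
      e = ρ · σ
      f = ρ · (iᴴ · σ)

      image : ℕ → ℍ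
      image t = ρ · direction t · σ

      image-suc : ∀ t → image (suc t) ≡ + t • e ⊕ f
      image-suc t = ℍ-Solver.solve 4 (λ ρ σ t i → ρ :· (:ι (:re t) :⊕ i) :· σ := :re t :• (ρ :· σ) :⊕ ρ :· (i :· σ))
          refl ρ σ (ι (+ t)) iᴴ
        where open ℍ-Solver

      Rootσ : ℕ → Set
      Rootσ = Root (re e) (im e) (re f) (im f)

      image⇒root : ∀ t → P ∣ᴴ image t → Rootσ t
      image⇒root t (y , eq) = root t (divides-component re (re-• P y)) (divides-component im (im-• P y))
        where
        divides-component : (c : ℍ → ℤ) → c (P • y) ≡ P * c y → P ∣ᶻ c (image t)
        divides-component c eq′ = divides (c y) (trans (cong c eq) (trans eq′ (ℤ.*-comm P (c y))))
        root : ∀ t → P ∣ᶻ re (image t) → P ∣ᶻ im (image t) → Rootσ t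
        root zero    p∣re p∣im = subst (λ x → P ∣ᶻ re x) (cong (_· σ) (·-1ᴴ ρ)) p∣re , subst (λ x → P ∣ᶻ im x)
            (cong (_· σ) (·-1ᴴ ρ)) p∣im
        root (suc t) p∣re p∣im = subst (P ∣ᶻ_) (trans (cong re (image-suc t)) (re-⊕ (+ t) e f)) p∣re ,
                                 subst (P ∣ᶻ_) (trans (cong im (image-suc t)) (im-⊕ (+ t) e f)) p∣im

      root⇒image : ∀ t → Rootσ t → P ∣ᴴ image t
      root⇒image t r = ∣-component (image t)
        (subst (P ∣ᴴ_) (trans (sym (⋆-·-· ρ (direction t · σ))) (cong (ρ ⋆ ·_) (sym (·-assoc ρ (direction t) σ))))
          (∣ᴴ-• (direction t · σ) p∣norm-ρ))
        (proj₁ (parts t r)) (proj₂ (parts t r))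
        where
        parts : ∀ t → Rootσ t → P ∣ᶻ re (image t) × P ∣ᶻ im (image t)
        parts zero    (p∣re , p∣im) = subst (λ x → P ∣ᶻ re x) (cong (_· σ) (sym (·-1ᴴ ρ))) p∣re , subst (λ x → P ∣ᶻ im
            x) (cong (_· σ) (sym (·-1ᴴ ρ))) p∣im
        parts (suc t) (p∣re , p∣im) = subst (P ∣ᶻ_) (sym (trans (cong re (image-suc t)) (re-⊕ (+ t) e f))) p∣re ,
                                      subst (P ∣ᶻ_) (sym (trans (cong im (image-suc t)) (im-⊕ (+ t) e f))) p∣im

    -- The determinant is `norm ρ (a² + b²) - β² norm σ`, and `p` divides both norms.
    determinant : ∀ σ → P ∣ᶻ norm σ → P ∣ᶻ re (e σ) * im (f σ) - im (e σ) * re (f σ)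
    determinant (quat a b c d) p∣norm = subst (P ∣ᶻ_) (expand α β a b c d)
      (∣m∣n⇒∣m-n (∣m⇒∣m*n (a * a + b * b) on-conic) (∣n⇒∣m*n (β * β) p∣norm))
      where
      open ConicSolver
      expand : ∀ α β a b c d → let ρ = quat 1ℤ α β 0ℤ ; σ = quat a b c d in
        (1ℤ + α * α + β * β) * (a * a + b * b) - β * β * (a * a + b * b + c * c + d * d) ≡
        re (ρ · σ) * im (ρ · (iᴴ · σ)) - im (ρ · σ) * re (ρ · (iᴴ · σ))
      expand = solve 6 (λ α β a b c d → let ρ = R α β ; σ = quat a b c d in
        (con 1ℤ :+ α :* α :+ β :* β) :* (a :* a :+ b :* b) :- β :* β :* (a :* a :+ b :* b :+ c :* c :+ d :* d) :=
        re (ρ :· σ) :* im (ρ :· (I :· σ)) :- im (ρ :· σ) :* re (ρ :· (I :· σ))) refl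

    -- Otherwise the four entries can be solved modulo `p` for `2 β c`, `2 β d`, `2 β² a` and then
    -- `2 b`. So `p` would divide `σ`, and `p²` its norm `p`.
    nondegenerate : ∀ σ → norm σ ≡ P →
      ¬ (P ∣ᶻ re (e σ) × P ∣ᶻ im (e σ) × P ∣ᶻ re (f σ) × P ∣ᶻ im (f σ))
    nondegenerate (quat a b c d) norm-σ (p∣e₀ , p∣e₁ , p∣f₀ , p∣f₁) = p∤σ (components⇒∣ᴴ p∣a p∣b
        (cancel-β c (cancel-2 (β * c) (subst (P ∣ᶻ_) (get-c α β a b c d) (∣m∣n⇒∣m-n p∣f₁ p∣e₀))))
        (cancel-β d (cancel-2 (β * d) (subst (P ∣ᶻ_) (get-d α β a b c d) (∣m∣n⇒∣m+n p∣e₁ p∣f₀)))))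
      where
      open ConicSolver
      p∤σ : ¬ P ∣ᴴ quat a b c d
      p∤σ p∣σ = p∤1 (divides (proj₁ (p∣⇒norm p∣σ)) (ℤ.*-cancelˡ-≡ P 1ℤ _ (trans (ℤ.*-identityʳ P)
        (trans (sym norm-σ) (trans (proj₂ (p∣⇒norm p∣σ)) (rearrange P (proj₁ (p∣⇒norm p∣σ))))))))
        where
        rearrange : ∀ p m → p * p * m ≡ p * (m * p)
        rearrange = solve-∀
      cancel-2 : ∀ x → P ∣ᶻ + 2 * x → P ∣ᶻ x
      cancel-2 x = euclid-cancel x (odd-∤2 3≤p)
      cancel-β : ∀ x → P ∣ᶻ β * x → P ∣ᶻ x
      cancel-β x = euclid-cancel x p∤β
      E F : ∀ (α β a b c d : ℤ) → ℍ
      E α β a b c d = quat 1ℤ α β 0ℤ · quat a b c d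
      F α β a b c d = quat 1ℤ α β 0ℤ · (iᴴ · quat a b c d)
      get-c : ∀ α β a b c d → im (F α β a b c d) - re (E α β a b c d) ≡ + 2 * (β * c)
      get-c = solve 6 (λ α β a b c d → im (R α β :· (I :· quat a b c d)) :- re (R α β :· quat a b c d) := con (+ 2) :*
          (β :* c)) refl
      get-d : ∀ α β a b c d → im (E α β a b c d) + re (F α β a b c d) ≡ + 2 * (β * d)
      get-d = solve 6 (λ α β a b c d → im (R α β :· quat a b c d) :+ re (R α β :· (I :· quat a b c d)) := con (+ 2) :*
          (β :* d)) refl
      get-a : ∀ α β a b c d → (1ℤ + α * α + β * β) * (+ 2 * a) -
        (re (E α β a b c d) + im (F α β a b c d) + α * (im (E α β a b c d) - re (F α β a b c d))) ≡ + 2 * (β * (β * a))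
      get-a = solve 6 (λ α β a b c d → let x = R α β :· quat a b c d ; y = R α β :· (I :· quat a b c d) in
        (con 1ℤ :+ α :* α :+ β :* β) :* (con (+ 2) :* a) :- (re x :+ im y :+ α :* (im x :- re y)) := con (+ 2) :*
            (β :* (β :* a))) refl
      get-b : ∀ α β a b c d → im (E α β a b c d) - re (F α β a b c d) - + 2 * α * a ≡ + 2 * b
      get-b = solve 6 (λ α β a b c d → let x = R α β :· quat a b c d ; y = R α β :· (I :· quat a b c d) in
        im x :- re y :- con (+ 2) :* α :* a := con (+ 2) :* b) refl
      p∣a : P ∣ᶻ a
      p∣a = cancel-β a (cancel-β (β * a) (cancel-2 (β * (β * a)) (subst (P ∣ᶻ_) (get-a α β a b c d)
        (∣m∣n⇒∣m-n (∣m⇒∣m*n (+ 2 * a) on-conic) (∣m∣n⇒∣m+n (∣m∣n⇒∣m+n p∣e₀ p∣f₁) (∣n⇒∣m*n α (∣m∣n⇒∣m-n p∣e₁ p∣f₀)))))))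
      p∣b : P ∣ᶻ b
      p∣b = cancel-2 b (subst (P ∣ᶻ_) (get-b α β a b c d) (∣m∣n⇒∣m-n (∣m∣n⇒∣m-n p∣e₁ p∣f₀) (∣n⇒∣m*n (+ 2 * α) p∣a)))

    -- Together with p, these generate the p + 1 right ideals of norm p.
    point : ℕ → ℍ
    point t = (ρ · direction t) ⋆

    point-∤ : ∀ t → ¬ P ∣ᴴ point t
    point-∤ zero    p∣ = p∤1 (proj₁ (∣ᴴ⇒components (subst (P ∣ᴴ_) (trans (⋆-⋆ (ρ · 1ᴴ)) (·-1ᴴ ρ)) (∣ᴴ-⋆ p∣))))
    point-∤ (suc t) p∣ = p∤β (subst (P ∣ᶻ_) (fourth α β (+ t)) (proj₂ (proj₂ (proj₂ (∣ᴴ⇒components p∣)))))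
      where
      fourth : ∀ α β t → - (1ℤ * 0ℤ + α * 0ℤ - β * (0ℤ + 1ℤ) + 0ℤ * (t + 0ℤ)) ≡ β
      fourth = solve-∀

    point-norm : ∀ t → P ∣ᶻ norm (point t)
    point-norm t = subst (P ∣ᶻ_) (sym (trans (norm-⋆ (ρ · direction t)) (norm-· ρ (direction t))))
        (∣m⇒∣m*n (norm (direction t)) p∣norm-ρ)

    -- By `one-root` each `σ` of norm `p` divides exactly one of the points from the left, and by
    -- `left-divisors` each point has eight such divisors.
    norm-p-count : ∀ {A} → (λ σ → norm σ ≡ P) HasSize A → A ≡ suc p ℕ.* 8
    -- No column is exceptional: `C` is empty and the value 0 of `c` is arbitrary.
    norm-p-count {A} hA = finish (double-count {C = λ _ → ⊥} {R = λ σ t → P ∣ᴴ σ ⋆ · point t} {c = 0} (λ σ t → P ∣ᴴ?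
        (σ ⋆ · point t)) (λ _ → no (λ ())) hA (HasSize-< (suc p))
        row (λ _ _ ()) (λ t _ _ → left-divisors (point-∤ t) (point-norm t)) (HasSize-∅ (λ _ ())))
      where
      finish : (∃[ l ] l ≡ suc p × A ℕ.* 1 ≡ l ℕ.* 8) → A ≡ suc p ℕ.* 8
      finish (l , refl , eq) = trans (sym (ℕ.*-identityʳ A)) eq
      swap : ∀ σ t → (ρ · direction t · σ) ⋆ ≡ σ ⋆ · point t
      swap σ t = ·-⋆ (ρ · direction t) σ
      row : ∀ σ → norm σ ≡ P → (λ t → t ℕ.< suc p × P ∣ᴴ σ ⋆ · point t) HasSize 1
      row σ norm-σ = HasSize-⇔
        (λ t (t< , root) → t< , subst (P ∣ᴴ_) (swap σ t) (∣ᴴ-⋆ (root⇒image σ t root)))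
        (λ t (t< , p∣) → t< , image⇒root σ t (subst (P ∣ᴴ_) (trans (cong _⋆ (sym (swap σ t))) (⋆-⋆ (image σ t))) (∣ᴴ-⋆ p∣)))
        (one-root (re (e σ)) (im (e σ)) (re (f σ)) (im (f σ))
          (determinant σ (divides 1ℤ (trans norm-σ (sym (ℤ.*-identityˡ P))))) (nondegenerate σ norm-σ))

  norm-p-count : ∀ {p A} → Prime p → 3 ℕ.≤ p → (λ u → norm u ≡ 1ℤ) HasSize 8 →
                 (λ σ → norm σ ≡ + p) HasSize A → A ≡ suc p ℕ.* 8
  norm-p-count {p} {A} p-prime 3≤p units hA = at (Residues.smooth-conic-point p-prime 3≤p)
    where
    at : (∃[ α ] ∃[ β ] + p ∣ᶻ 1ℤ + α * α + β * β × ¬ + p ∣ᶻ β) → A ≡ suc p ℕ.* 8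
    at (α , β , on-conic , p∤β) = ConicPoint.norm-p-count p-prime 3≤p units α β on-conic p∤β hA

-- The ring of formal power series over ℤ

module PowerSeries where
  import Algebra.Solver.Ring as RingSolver
  import Algebra.Solver.Ring.AlmostCommutativeRing as ACR
  open import Data.Integer as ℤ using (ℤ; +_; -_; _+_; _-_; _*_; 0ℤ; 1ℤ)
  open import Data.Maybe using (Maybe; just; nothing)
  open import Level using (0ℓ)

  Series : Set
  Series = ℕ → ℤ

  infix 4 _≈_
  _≈_ : Series → Series → Set
  f ≈ g = ∀ n → f n ≡ g n

  constant : ℤ → Series
  constant k zero    = k
  constant k (suc n) = 0ℤ

  tail : Series → Series
  tail f n = f (suc n)

  infixl 6 _⊞_
  infixl 7 _⊠_
  -- The Cauchy product through `f g = f 0 g + q (tail f) g`. The recursion replaces finite sums, so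
  -- the ring laws are inductions on the index.
  _⊞_ _⊠_ : Series → Series → Series
  (f ⊞ g) n = f n + g n
  (f ⊠ g) zero    = f 0 * g 0
  (f ⊠ g) (suc n) = f 0 * g (suc n) + (tail f ⊠ g) n

  infix 8 ⊟_
  ⊟_ : Series → Series
  (⊟ f) n = - f n

  -- Lets a series be exchanged for a truncation that agrees with it only up to degree `n`.
  ⊠-cong-≤ : ∀ n {f f′ g g′} → (∀ i → i ℕ.≤ n → f i ≡ f′ i) → (∀ i → i ℕ.≤ n → g i ≡ g′ i) →
             (f ⊠ g) n ≡ (f′ ⊠ g′) n
  ⊠-cong-≤ zero    f≡ g≡ = cong₂ _*_ (f≡ 0 z≤n) (g≡ 0 z≤n)
  ⊠-cong-≤ (suc n) f≡ g≡ = cong₂ _+_ (cong₂ _*_ (f≡ 0 z≤n) (g≡ (suc n) ℕ.≤-refl))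
    (⊠-cong-≤ n (λ i i≤n → f≡ (suc i) (s≤s i≤n)) (λ i i≤n → g≡ i (ℕ.m≤n⇒m≤1+n i≤n)))

  ⊠-cong : ∀ {f f′ g g′} → f ≈ f′ → g ≈ g′ → f ⊠ g ≈ f′ ⊠ g′
  ⊠-cong f≈ g≈ n = ⊠-cong-≤ n (λ i _ → f≈ i) (λ i _ → g≈ i)

  ⊠-distribʳ : ∀ h f g → (f ⊞ g) ⊠ h ≈ f ⊠ h ⊞ g ⊠ h
  ⊠-distribʳ h f g zero    = ℤ.*-distribʳ-+ (h 0) (f 0) (g 0)
  ⊠-distribʳ h f g (suc n) = trans (cong (λ x → (f 0 + g 0) * h (suc n) + x) (⊠-distribʳ h (tail f) (tail g) n))
    (rearrange (f 0) (g 0) (h (suc n)) ((tail f ⊠ h) n) ((tail g ⊠ h) n))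
    where
    rearrange : ∀ a b c x y → (a + b) * c + (x + y) ≡ (a * c + x) + (b * c + y)
    rearrange = solve-∀

  scale-⊠ : ∀ k f g → (λ i → k * f i) ⊠ g ≈ (λ i → k * (f ⊠ g) i)
  scale-⊠ k f g zero    = ℤ.*-assoc k (f 0) (g 0)
  scale-⊠ k f g (suc n) = trans (cong (λ x → k * f 0 * g (suc n) + x) (scale-⊠ k (tail f) g n))
    (rearrange k (f 0) (g (suc n)) ((tail f ⊠ g) n))
    where
    rearrange : ∀ k a b x → k * a * b + k * x ≡ k * (a * b + x)
    rearrange = solve-∀

  ⊠-assoc : ∀ f g h → (f ⊠ g) ⊠ h ≈ f ⊠ (g ⊠ h)
  ⊠-assoc f g h zero    = ℤ.*-assoc (f 0) (g 0) (h 0)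
  ⊠-assoc f g h (suc n) = begin
    f 0 * g 0 * h (suc n) + (tail (f ⊠ g) ⊠ h) n
      ≡⟨ cong (λ x → f 0 * g 0 * h (suc n) + x) (⊠-distribʳ h (λ i → f 0 * g (suc i)) (tail f ⊠ g) n) ⟩
    f 0 * g 0 * h (suc n) + (((λ i → f 0 * g (suc i)) ⊠ h) n + ((tail f ⊠ g) ⊠ h) n)
      ≡⟨ cong (λ x → f 0 * g 0 * h (suc n) + x) (cong₂ _+_ (scale-⊠ (f 0) (tail g) h n) (⊠-assoc (tail f) g h n)) ⟩
    f 0 * g 0 * h (suc n) + (f 0 * (tail g ⊠ h) n + (tail f ⊠ (g ⊠ h)) n)
      ≡⟨ rearrange (f 0) (g 0) (h (suc n)) ((tail g ⊠ h) n) ((tail f ⊠ (g ⊠ h)) n) ⟩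
    f 0 * (g 0 * h (suc n) + (tail g ⊠ h) n) + (tail f ⊠ (g ⊠ h)) n ∎
    where
    open ≡-Reasoning
    rearrange : ∀ a b c x y → a * b * c + (a * x + y) ≡ a * (b * c + x) + y
    rearrange = solve-∀

  -- The mirror image of the defining recursion; commutativity follows by comparing the two.
  ⊠-last : ∀ f g n → (f ⊠ g) (suc n) ≡ (f ⊠ tail g) n + f (suc n) * g 0
  ⊠-last f g zero    = refl
  ⊠-last f g (suc n) = trans (cong (λ x → f 0 * g (suc (suc n)) + x) (⊠-last (tail f) g n))
    (sym (ℤ.+-assoc (f 0 * g (suc (suc n))) ((tail f ⊠ tail g) n) (f (suc (suc n)) * g 0)))

  ⊠-comm : ∀ f g → f ⊠ g ≈ g ⊠ f
  ⊠-comm f g zero    = ℤ.*-comm (f 0) (g 0)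
  ⊠-comm f g (suc n) = begin
    f 0 * g (suc n) + (tail f ⊠ g) n    ≡⟨ cong₂ _+_ (ℤ.*-comm (f 0) (g (suc n))) (⊠-comm (tail f) g n) ⟩
    g (suc n) * f 0 + (g ⊠ tail f) n    ≡⟨ ℤ.+-comm (g (suc n) * f 0) ((g ⊠ tail f) n) ⟩
    (g ⊠ tail f) n + g (suc n) * f 0    ≡⟨ ⊠-last g f n ⟨
    (g ⊠ f) (suc n)                     ∎
    where open ≡-Reasoning

  0-⊠ : ∀ g → (λ _ → 0ℤ) ⊠ g ≈ (λ _ → 0ℤ)
  0-⊠ g zero    = ℤ.*-zeroˡ (g 0)
  0-⊠ g (suc n) = cong₂ _+_ (ℤ.*-zeroˡ (g (suc n))) (0-⊠ g n)

  constant-⊠ : ∀ k g n → (constant k ⊠ g) n ≡ k * g n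
  constant-⊠ k g zero    = refl
  constant-⊠ k g (suc n) = trans (cong (λ x → k * g (suc n) + x) (0-⊠ g n)) (ℤ.+-identityʳ (k * g (suc n)))

  constant-0 : constant 0ℤ ≈ (λ _ → 0ℤ)
  constant-0 zero    = refl
  constant-0 (suc n) = refl

  ⊠-identityˡ : ∀ g → constant 1ℤ ⊠ g ≈ g
  ⊠-identityˡ g n = trans (constant-⊠ 1ℤ g n) (ℤ.*-identityˡ (g n))

  ⊠-identityʳ : ∀ g → g ⊠ constant 1ℤ ≈ g
  ⊠-identityʳ g n = trans (⊠-comm g (constant 1ℤ) n) (⊠-identityˡ g n)

  ⊠-distribˡ : ∀ h f g → h ⊠ (f ⊞ g) ≈ h ⊠ f ⊞ h ⊠ g
  ⊠-distribˡ h f g n = trans (⊠-comm h (f ⊞ g) n)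
    (trans (⊠-distribʳ h f g n) (cong₂ _+_ (⊠-comm f h n) (⊠-comm g h n)))

  seriesRing : CommutativeRing 0ℓ 0ℓ
  seriesRing = record
    { Carrier = Series ; _≈_ = _≈_ ; _+_ = _⊞_ ; _*_ = _⊠_ ; -_ = ⊟_
    ; 0# = constant 0ℤ ; 1# = constant 1ℤ
    ; isCommutativeRing = record
      { isRing = record
        { +-isAbelianGroup = record
          { isGroup = record
            { isMonoid = record
              { isSemigroup = record
                { isMagma = record
                  { isEquivalence = record { refl = λ _ → refl ; sym = λ e n → sym (e n) ; trans = λ e e′ n → trans (e n) (e′ n) }
                  ; ∙-cong = λ e e′ n → cong₂ _+_ (e n) (e′ n) }
                ; assoc = λ f g h n → ℤ.+-assoc (f n) (g n) (h n) }
              ; identity = (λ f n → trans (cong (_+ f n) (constant-0 n)) (ℤ.+-identityˡ (f n))) ,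
                           (λ f n → trans (cong (λ x → f n + x) (constant-0 n)) (ℤ.+-identityʳ (f n))) }
            ; inverse = (λ f n → trans (ℤ.+-inverseˡ (f n)) (sym (constant-0 n))) , (λ f n → trans (ℤ.+-inverseʳ
                (f n)) (sym (constant-0 n)))
            ; ⁻¹-cong = λ e n → cong -_ (e n) }
          ; comm = λ f g n → ℤ.+-comm (f n) (g n) }
        ; *-cong = ⊠-cong
        ; *-assoc = ⊠-assoc
        ; *-identity = ⊠-identityˡ , ⊠-identityʳ
        ; distrib = ⊠-distribˡ , ⊠-distribʳ }
      ; *-comm = ⊠-comm } }

  constant-morphism : CommutativeRing.rawRing ℤ.+-*-commutativeRing ACR.-Raw-AlmostCommutative⟶ ACR.fromCommutativeRing seriesRing
  constant-morphism = record
    { ⟦_⟧    = constant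
    ; +-homo = λ { k l zero → refl ; k l (suc n) → refl }
    ; *-homo = λ { k l zero → refl ; k l (suc n) → sym (trans (constant-⊠ k (constant l) (suc n)) (ℤ.*-zeroʳ k)) }
    ; -‿homo = λ { k zero → refl ; k (suc n) → refl }
    ; 0-homo = λ _ → refl
    ; 1-homo = λ _ → refl
    }

  constant-≟ : ∀ k l → Maybe (constant k ≈ constant l)
  constant-≟ k l with k ℤ.≟ l
  ... | yes refl = just (λ _ → refl)
  ... | no _     = nothing

  module Series-Solver = RingSolver (CommutativeRing.rawRing ℤ.+-*-commutativeRing)
    (ACR.fromCommutativeRing seriesRing) constant-morphism constant-≟

-- A finite form of Gauss' identity

module GaussIdentity where
  open PowerSeries
  open Series-Solver using (solve; _:=_; _:+_; _:*_; _:-_; :-_; con)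
  open import Data.Integer as ℤ using (ℤ; +_; -_; _+_; _-_; _*_; 0ℤ; 1ℤ)
  open import Data.Nat using (⌊_/2⌋)
  open import Data.Nat.DivMod using (_%_; [m+n]%n≡m%n; m<n⇒m%n≡m)
  open import Function using (flip; case_of_)
  open CommutativeRing seriesRing using () renaming
    (refl to ≈-refl; sym to ≈-sym; trans to ≈-trans; +-cong to ⊞-cong; -‿cong to ⊟-cong)
  open import Relation.Binary.Reasoning.Setoid (CommutativeRing.setoid seriesRing)

  one : Series
  one = constant 1ℤ

  X : Series
  X 0             = 0ℤ
  X 1             = 1ℤ
  X (suc (suc _)) = 0ℤ

  q : ℕ → Series
  q zero    = one
  q (suc k) = X ⊠ q k

  X-⊠-zero : ∀ f → (X ⊠ f) 0 ≡ 0ℤ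
  X-⊠-zero f = ℤ.*-zeroˡ (f 0)

  tail-X : ∀ n → tail X n ≡ one n
  tail-X zero    = refl
  tail-X (suc n) = refl

  X-⊠-suc : ∀ f n → (X ⊠ f) (suc n) ≡ f n
  X-⊠-suc f n = trans (ℤ.+-identityˡ ((tail X ⊠ f) n))
    (trans (⊠-cong {g = f} {g′ = f} tail-X (λ _ → refl) n) (⊠-identityˡ f n))

  q-⊠-< : ∀ {k} f {n} → n ℕ.< k → (q k ⊠ f) n ≡ 0ℤ
  q-⊠-< {suc k} f {zero}  _         = trans (⊠-assoc X (q k) f 0) (X-⊠-zero (q k ⊠ f))
  q-⊠-< {suc k} f {suc n} (s≤s n<k) = trans (⊠-assoc X (q k) f (suc n)) (trans (X-⊠-suc (q k ⊠ f) n) (q-⊠-< f n<k))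

  q-⊠-+ : ∀ k f n → (q k ⊠ f) (k ℕ.+ n) ≡ f n
  q-⊠-+ zero    f n = ⊠-identityˡ f n
  q-⊠-+ (suc k) f n = trans (⊠-assoc X (q k) f (suc k ℕ.+ n)) (trans (X-⊠-suc (q k ⊠ f) (k ℕ.+ n)) (q-⊠-+ k f n))

  q-+ : ∀ m n → q (m ℕ.+ n) ≈ q m ⊠ q n
  q-+ zero    n = ≈-sym (⊠-identityˡ (q n))
  q-+ (suc m) n = ≈-trans (⊠-cong {f = X} ≈-refl (q-+ m n)) (≈-sym (⊠-assoc X (q m) (q n)))

  δ : ℕ → ℕ → ℤ
  δ zero    zero    = 1ℤ
  δ (suc k) (suc i) = δ k i
  δ zero    (suc i) = 0ℤ
  δ (suc k) zero    = 0ℤ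

  q-δ : ∀ k i → q k i ≡ δ k i
  q-δ zero    zero    = refl
  q-δ zero    (suc i) = refl
  q-δ (suc k) zero    = X-⊠-zero (q k)
  q-δ (suc k) (suc i) = trans (X-⊠-suc (q k) i) (q-δ k i)

  infix 4 _≡_[mod_]
  -- One notion for two purposes: for `c = q k` it is agreement below degree `k`, and for a constant
  -- `c` it is congruence of all coefficients.
  record _≡_[mod_] (f g c : Series) : Set where
    constructor multiple
    field
      quotient : Series
      equation : f ≈ g ⊞ c ⊠ quotient

  mod-coefficient : ∀ {k f g} → f ≡ g [mod q k ] → ∀ {i} → i ℕ.< k → f i ≡ g i
  mod-coefficient {k} {f} {g} (multiple h f≈) {i} i<k = trans (f≈ i)
    (trans (cong (λ x → g i + x) (q-⊠-< h i<k)) (ℤ.+-identityʳ (g i)))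

  mod-⊠ : ∀ {c f g f′ g′} → f ≡ g [mod c ] → f′ ≡ g′ [mod c ] → f ⊠ f′ ≡ g ⊠ g′ [mod c ]
  mod-⊠ {c} {f} {g} {f′} {g′} (multiple h f≈) (multiple h′ f′≈) = multiple (g ⊠ h′ ⊞ h ⊠ g′ ⊞ h ⊠ (c ⊠ h′))
    (≈-trans (⊠-cong f≈ f′≈) (solve 5 (λ g h g′ h′ q → (g :+ q :* h) :* (g′ :+ q :* h′) :=
      g :* g′ :+ q :* (g :* h′ :+ h :* g′ :+ h :* (q :* h′))) (λ _ → refl) g h g′ h′ c))

  mod-⊞ : ∀ {c f g f′ g′} → f ≡ g [mod c ] → f′ ≡ g′ [mod c ] → f ⊞ f′ ≡ g ⊞ g′ [mod c ]
  mod-⊞ {c} {f} {g} {f′} {g′} (multiple h f≈) (multiple h′ f′≈) = multiple (h ⊞ h′)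
    (≈-trans (⊞-cong f≈ f′≈) (solve 5 (λ g h g′ h′ q → (g :+ q :* h) :+ (g′ :+ q :* h′) :=
      g :+ g′ :+ q :* (h :+ h′)) (λ _ → refl) g h g′ h′ c))

  mod-trans : ∀ {c f g h} → f ≡ g [mod c ] → g ≡ h [mod c ] → f ≡ h [mod c ]
  mod-trans {c} {f} {g} {h} (multiple a f≈) (multiple b g≈) = multiple (a ⊞ b) (≈-trans f≈ (≈-trans (⊞-cong g≈ ≈-refl)
    (solve 4 (λ h a b q → h :+ q :* b :+ q :* a := h :+ q :* (a :+ b)) (λ _ → refl) h a b c)))

  mod-sym : ∀ {c f g} → f ≡ g [mod c ] → g ≡ f [mod c ]
  mod-sym {c} {f} {g} (multiple a f≈) = multiple (⊟ a) (≈-trans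
    (solve 3 (λ g a q → g := g :+ q :* a :+ q :* :- a) (λ _ → refl) g a c) (⊞-cong (≈-sym f≈) ≈-refl))

  ≈⇒mod : ∀ {c f g} → f ≈ g → f ≡ g [mod c ]
  ≈⇒mod {c} {f} {g} f≈g = multiple (constant 0ℤ) (≈-trans f≈g
    (solve 2 (λ g q → g := g :+ q :* con 0ℤ) (λ _ → refl) g c))

  -- The sum over all pairs with `a + b = m`; carrying both indices avoids subtraction.
  Σ₂ : (ℕ → ℕ → Series) → ℕ → Series
  Σ₂ F zero    = F 0 0
  Σ₂ F (suc m) = F 0 (suc m) ⊞ Σ₂ (λ a b → F (suc a) b) m

  module _ where
    private variable
      F G : ℕ → ℕ → Series

    Σ₂-cong : ∀ m → (∀ a b → a ℕ.+ b ≡ m → F a b ≈ G a b) → Σ₂ F m ≈ Σ₂ G m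
    Σ₂-cong zero    F≈G = F≈G 0 0 refl
    Σ₂-cong (suc m) F≈G = ⊞-cong (F≈G 0 (suc m) refl) (Σ₂-cong m (λ a b eq → F≈G (suc a) b (cong suc eq)))

    Σ₂-mod : ∀ {c} m → (∀ a b → a ℕ.+ b ≡ m → F a b ≡ G a b [mod c ]) → Σ₂ F m ≡ Σ₂ G m [mod c ]
    Σ₂-mod zero    F≡G = F≡G 0 0 refl
    Σ₂-mod {F} {G} {c} (suc m) F≡G = mod-⊞ (F≡G 0 (suc m) refl) (Σ₂-mod m (λ a b eq → F≡G (suc a) b (cong suc eq)))

    Σ₂-⊞ : ∀ m → Σ₂ (λ a b → F a b ⊞ G a b) m ≈ Σ₂ F m ⊞ Σ₂ G m
    Σ₂-⊞ zero = ≈-refl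
    Σ₂-⊞ {F} {G} (suc m) = ≈-trans (⊞-cong {x = F 0 (suc m) ⊞ G 0 (suc m)} ≈-refl (Σ₂-⊞ m))
      (solve 4 (λ a b c d → a :+ b :+ (c :+ d) := a :+ c :+ (b :+ d)) (λ _ → refl) (F 0 (suc m)) (G 0 (suc m))
          (Σ₂ (λ a b → F (suc a) b) m) (Σ₂ (λ a b → G (suc a) b) m))

    Σ₂-⊠ : ∀ c m → Σ₂ (λ a b → c ⊠ F a b) m ≈ c ⊠ Σ₂ F m
    Σ₂-⊠ c zero = ≈-refl
    Σ₂-⊠ {F} c (suc m) = ≈-trans (⊞-cong {x = c ⊠ F 0 (suc m)} ≈-refl (Σ₂-⊠ c m)) (≈-sym (⊠-distribˡ c (F 0 (suc m))
        (Σ₂ (λ a b → F (suc a) b) m)))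

    Σ₂-last : ∀ F m → Σ₂ F (suc m) ≈ Σ₂ (λ a b → F a (suc b)) m ⊞ F (suc m) 0
    Σ₂-last F zero    = ≈-refl
    Σ₂-last F (suc m) = ≈-trans (⊞-cong {x = F 0 (suc (suc m))} ≈-refl (Σ₂-last (λ a b → F (suc a) b) m))
      (λ n → sym (ℤ.+-assoc (F 0 (suc (suc m)) n) (Σ₂ (λ a b → F (suc a) (suc b)) m n) (F (suc (suc m)) 0 n)))

    Σ₂-flip : ∀ F m → Σ₂ F m ≈ Σ₂ (flip F) m
    Σ₂-flip F zero    = ≈-refl
    Σ₂-flip F (suc m) = ≈-trans (Σ₂-last F m) (≈-trans (λ n → ℤ.+-comm (Σ₂ (λ a b → F a (suc b)) m n) (F (suc m) 0 n))
      (⊞-cong {x = F (suc m) 0} ≈-refl (Σ₂-flip (λ a b → F a (suc b)) m)))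

    Σ₂-first-zero : ∀ F m → F 0 (suc m) ≈ constant 0ℤ → Σ₂ F (suc m) ≈ Σ₂ (λ a b → F (suc a) b) m
    Σ₂-first-zero F m F0≈0 = ≈-trans (⊞-cong F0≈0 ≈-refl) (solve 1 (λ x → con 0ℤ :+ x := x) (λ _ → refl)
        (Σ₂ (λ a b → F (suc a) b) m))

    Σ₂-last-zero : ∀ F m → F (suc m) 0 ≈ constant 0ℤ → Σ₂ F (suc m) ≈ Σ₂ (λ a b → F a (suc b)) m
    Σ₂-last-zero F m F0≈0 = ≈-trans (Σ₂-last F m) (≈-trans (⊞-cong {x = Σ₂ (λ a b → F a (suc b)) m} ≈-refl F0≈0)
      (solve 1 (λ x → x :+ con 0ℤ := x) (λ _ → refl) (Σ₂ (λ a b → F a (suc b)) m)))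

    -- Adding the reversed sum shows that twice the sum is zero.
    Σ₂-antisymmetric : ∀ F m → (∀ a b → a ℕ.+ b ≡ m → F a b ⊞ F b a ≈ constant 0ℤ) → Σ₂ F m ≈ constant 0ℤ
    Σ₂-antisymmetric F m anti n = trans (twice-zero (Σ₂ F m n) (trans (cong (λ x → Σ₂ F m n + x) (Σ₂-flip F m n))
      (trans (sym (Σ₂-⊞ {F} {flip F} m n)) (trans (Σ₂-cong m anti n) (trans (zero-sum m n) (constant-0 n))))))
          (sym (constant-0 n))
      where
      zero-sum : ∀ m → Σ₂ (λ _ _ → constant 0ℤ) m ≈ constant 0ℤ
      zero-sum zero    = ≈-refl
      zero-sum (suc m) n = trans (cong₂ _+_ (constant-0 n) (zero-sum m n)) (ℤ.+-identityˡ (constant 0ℤ n))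
      twice-zero : ∀ x → x + x ≡ 0ℤ → x ≡ 0ℤ
      twice-zero x eq = ℤ.*-cancelˡ-≡ (+ 2) x 0ℤ (trans (double x) eq)
        where
        double : ∀ x → + 2 * x ≡ x + x
        double = solve-∀

  cofactor : ℕ → Series
  cofactor a = one ⊞ ⊟ q a

  cofactor-0 : cofactor 0 ≈ constant 0ℤ
  cofactor-0 = solve 0 (con 1ℤ :- con 1ℤ := con 0ℤ) (λ _ → refl)

  -- The expansion of 1 / (1 - q^(m+1)).
  geometric : ℕ → Series
  geometric m i = δ 0 (i % suc m)

  geometric-unfold : ∀ m → geometric m ≈ one ⊞ q (suc m) ⊠ geometric m
  geometric-unfold m i with i ℕ.<? suc m
  ... | yes i<m = trans (trans (cong (δ 0) (m<n⇒m%n≡m i<m)) (δ-one i))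
      (sym (trans (cong (λ x → one i + x) (q-⊠-< (geometric m) i<m)) (ℤ.+-identityʳ (one i))))
    where
    δ-one : ∀ i → δ 0 i ≡ one i
    δ-one zero    = refl
    δ-one (suc i) = refl
  ... | no i≮m with j , refl ← ℕ.m≤n⇒∃[o]m+o≡n (ℕ.≮⇒≥ i≮m) =
    trans (cong (δ 0) (trans (cong (_% suc m) (ℕ.+-comm (suc m) j)) ([m+n]%n≡m%n j (suc m))))
      (sym (trans (ℤ.+-identityˡ _) (q-⊠-+ (suc m) (geometric m) j)))

  geometric-inverse : ∀ m → cofactor (suc m) ⊠ geometric m ≈ one
  geometric-inverse m = begin
    cofactor (suc m) ⊠ geometric m                              ≈⟨ solve 2 (λ q g → (con 1ℤ :- q) :* g := g :- q :* g)
        (λ _ → refl) (q (suc m)) (geometric m) ⟩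
    geometric m ⊞ ⊟ (q (suc m) ⊠ geometric m)                   ≈⟨ ⊞-cong (geometric-unfold m) ≈-refl ⟩
    one ⊞ q (suc m) ⊠ geometric m ⊞ ⊟ (q (suc m) ⊠ geometric m) ≈⟨ solve 1 (λ x → con 1ℤ :+ x :- x := con 1ℤ)
        (λ _ → refl) (q (suc m) ⊠ geometric m) ⟩
    one                                                         ∎

  -- The inverse of (1 - q) ⋯ (1 - q^a).
  e : ℕ → Series
  e zero    = one
  e (suc n) = e n ⊠ geometric n

  cofactor-e : ∀ n → cofactor (suc n) ⊠ e (suc n) ≈ e n
  cofactor-e n = begin
    cofactor (suc n) ⊠ (e n ⊠ geometric n)   ≈⟨ solve 3 (λ c e g → c :* (e :* g) := e :* (c :* g)) (λ _ → refl)
        (cofactor (suc n)) (e n) (geometric n) ⟩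
    e n ⊠ (cofactor (suc n) ⊠ geometric n)   ≈⟨ ⊠-cong {f = e n} ≈-refl (geometric-inverse n) ⟩
    e n ⊠ one                                ≈⟨ ⊠-identityʳ (e n) ⟩
    e n                                      ∎

  sgn : ℕ → ℤ
  sgn zero    = 1ℤ
  sgn (suc n) = - sgn n

  -- For a + b even this is ((b - a) / 2)².
  gap² : ℕ → ℕ → ℕ
  gap² (suc a) (suc b) = gap² a b
  gap² zero    b       = ⌊ b /2⌋ ℕ.* ⌊ b /2⌋
  gap² (suc a) zero    = ⌊ suc a /2⌋ ℕ.* ⌊ suc a /2⌋

  gap²-comm : ∀ a b → gap² a b ≡ gap² b a
  gap²-comm zero    zero    = refl
  gap²-comm zero    (suc b) = refl
  gap²-comm (suc a) zero    = refl
  gap²-comm (suc a) (suc b) = gap²-comm a b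

  half-double : ∀ n → ⌊ n ℕ.+ n /2⌋ ≡ n
  half-double n = sym (ℕ.n≡⌊n+n/2⌋ n)

  gap²-even : ∀ n → gap² 0 (n ℕ.+ n) ≡ n ℕ.* n
  gap²-even n = cong (λ h → h ℕ.* h) (half-double n)

  suc-pair : ∀ {a b c} → suc a ℕ.+ suc b ≡ suc (suc c) → a ℕ.+ b ≡ c
  suc-pair {a} {b} eq = ℕ.suc-injective (trans (sym (ℕ.+-suc a b)) (ℕ.suc-injective eq))

  suc-double : ∀ n → suc n ℕ.+ suc n ≡ suc (suc (n ℕ.+ n))
  suc-double n = cong suc (ℕ.+-suc n n)

  gap²-shift-0 : ∀ n → gap² 0 (suc (suc (n ℕ.+ n))) ℕ.+ 0 ≡ gap² (suc (n ℕ.+ n)) 1 ℕ.+ suc (n ℕ.+ n)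
  gap²-shift-0 n = trans (ℕ.+-identityʳ _) (trans (cong (λ h → suc h ℕ.* suc h) (half-double n))
    (trans (square n) (cong (ℕ._+ suc (n ℕ.+ n)) (sym (trans (gap²-comm (n ℕ.+ n) 0) (gap²-even n))))))
    where
    square : ∀ n → suc n ℕ.* suc n ≡ n ℕ.* n ℕ.+ suc (n ℕ.+ n)
    square = ℕ.solve-∀

  -- For the odd number d = b - a this is ((d + 1) / 2)² - ((d - 1) / 2)² = d.
  gap²-shift : ∀ n a b → a ℕ.+ b ≡ suc (n ℕ.+ n) → gap² a (suc b) ℕ.+ a ≡ gap² b (suc a) ℕ.+ b
  gap²-shift n zero b refl = gap²-shift-0 n
  gap²-shift n (suc a) zero eq with refl ← trans (sym (ℕ.+-identityʳ (suc a))) eq = sym (gap²-shift-0 n)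
  gap²-shift zero (suc a) (suc b) eq = contradiction (trans (sym (ℕ.+-suc a b)) (ℕ.suc-injective eq)) (λ ())
  gap²-shift (suc n) (suc a) (suc b) eq = trans (ℕ.+-suc (gap² a (suc b)) a) (trans (cong suc
    (gap²-shift n a b (suc-pair (trans eq (cong suc (suc-double n)))))) (sym (ℕ.+-suc (gap² b (suc a)) b)))

  square-≤ : ∀ m → m ℕ.≤ m ℕ.* m
  square-≤ zero    = z≤n
  square-≤ (suc m) = ℕ.m≤m*n (suc m) (suc m)

  -- With a = n - j this is j ≤ j². It controls the error of replacing `e a` by `e n`.
  gap²-≥ : ∀ n a b → a ℕ.+ b ≡ n ℕ.+ n → n ℕ.≤ gap² a b ℕ.+ a
  gap²-≥ n zero b refl = subst (n ℕ.≤_) (sym (trans (ℕ.+-identityʳ _) (gap²-even n))) (square-≤ n)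
  gap²-≥ n (suc a) zero eq = ℕ.≤-trans (ℕ.m≤m+n n n) (ℕ.≤-trans (ℕ.≤-reflexive (trans (sym eq) (ℕ.+-identityʳ (suc a))))
    (ℕ.m≤n+m (suc a) (gap² (suc a) 0)))
  gap²-≥ zero (suc a) (suc b) ()
  gap²-≥ (suc n) (suc a) (suc b) eq = subst (suc n ℕ.≤_) (sym (ℕ.+-suc (gap² a b) a))
    (s≤s (gap²-≥ n a b (suc-pair (trans eq (suc-double n)))))

  sgn-+ : ∀ m n → sgn (m ℕ.+ n) ≡ sgn m * sgn n
  sgn-+ zero    n = sym (ℤ.*-identityˡ (sgn n))
  sgn-+ (suc m) n = trans (cong -_ (sgn-+ m n)) (ℤ.neg-distribˡ-* (sgn m) (sgn n))

  sgn-double : ∀ n → sgn (n ℕ.+ n) ≡ 1ℤ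
  sgn-double zero    = refl
  sgn-double (suc n) = trans (cong (λ m → - sgn m) (ℕ.+-suc n n)) (trans (ℤ.neg-involutive (sgn (n ℕ.+ n))) (sgn-double n))

  sgn-square : ∀ n → sgn (n ℕ.* n) ≡ sgn n
  sgn-square zero    = refl
  sgn-square (suc n) = trans (cong sgn (expand n)) (trans (sgn-+ (n ℕ.* n) (suc (n ℕ.+ n)))
    (trans (cong₂ _*_ (sgn-square n) (cong -_ (sgn-double n))) (negate (sgn n))))
    where
    expand : ∀ n → suc n ℕ.* suc n ≡ n ℕ.* n ℕ.+ suc (n ℕ.+ n)
    expand = ℕ.solve-∀
    negate : ∀ x → x * - 1ℤ ≡ - x
    negate = solve-∀

  sgn-* : ∀ n → sgn n * sgn n ≡ 1ℤ
  sgn-* n = trans (sym (sgn-+ n n)) (sgn-double n)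

  -- With a = n - j, both sides are (-1)^j, because j and j² have the same parity.
  sgn-gap² : ∀ n a b → a ℕ.+ b ≡ n ℕ.+ n → sgn n * sgn a ≡ sgn (gap² a b)
  sgn-gap² n zero b refl = trans (ℤ.*-identityʳ (sgn n)) (trans (sym (sgn-square n)) (cong sgn (sym (gap²-even n))))
  sgn-gap² n (suc a) zero eq = trans (cong (λ x → sgn n * x) (trans (cong sgn a≡) (sgn-double n))) (trans (ℤ.*-identityʳ (sgn n))
    (trans (sym (sgn-square n)) (cong sgn (sym (trans (cong (λ m → gap² m 0) a≡) (trans (gap²-comm (n ℕ.+ n) 0)
        (gap²-even n)))))))
    where
    a≡ : suc a ≡ n ℕ.+ n
    a≡ = trans (sym (ℕ.+-identityʳ (suc a))) eq
  sgn-gap² zero (suc a) (suc b) ()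
  sgn-gap² (suc n) (suc a) (suc b) eq = trans (neg-neg (sgn n) (sgn a)) (sgn-gap² n a b (suc-pair (trans eq (suc-double n))))
    where
    neg-neg : ∀ x y → - x * - y ≡ x * y
    neg-neg = solve-∀

  sgn-odd : ∀ n a b → a ℕ.+ b ≡ suc (n ℕ.+ n) → sgn a + sgn b ≡ 0ℤ
  sgn-odd n a b eq = factor (sgn a) (sgn b) (trans (sym (sgn-+ a b)) (trans (cong sgn eq) (cong -_ (sgn-double n)))) (sgn-* a)
    where
    factor : ∀ x y → x * y ≡ - 1ℤ → x * x ≡ 1ℤ → x + y ≡ 0ℤ
    factor x y xy xx = trans (cong₂ _+_ (sym (trans (cong (λ z → x * z) xx) (ℤ.*-identityʳ x)))
        (sym (trans (cong (λ z → z * y) xx) (ℤ.*-identityˡ y))))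
      (trans (expand x y) (trans (cong₂ (λ u v → x * u + x * v) xx xy) (cancel x)))
      where
      expand : ∀ x y → x * (x * x) + x * x * y ≡ x * (x * x) + x * (x * y)
      expand = solve-∀
      cancel : ∀ x → x * 1ℤ + x * - 1ℤ ≡ 0ℤ
      cancel = solve-∀

  constant-neg : ∀ k → constant (- k) ≈ ⊟ constant k
  constant-neg k zero    = refl
  constant-neg k (suc n) = refl

  term : ℕ → ℕ → Series
  term a b = constant (sgn a) ⊠ (q (gap² a b) ⊠ (e a ⊠ e b))

  -- H (2 n) is, up to sign, the sum of (-1)^j q^(j²) / ((q)_(n-j) (q)_(n+j)).
  H : ℕ → Series
  H = Σ₂ term

  cofactor-split : ∀ a b t → cofactor (a ℕ.+ b) ⊠ t ≈
    cofactor a ⊠ (cofactor b ⊠ t) ⊞ (q a ⊠ (cofactor b ⊠ t) ⊞ q b ⊠ (cofactor a ⊠ t))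
  cofactor-split a b t = ≈-trans (⊠-cong {g = t} (⊞-cong {x = one} ≈-refl (⊟-cong (q-+ a b))) ≈-refl)
    (solve 3 (λ a b t → (con 1ℤ :- a :* b) :* t := (con 1ℤ :- a) :* ((con 1ℤ :- b) :* t) :+
      (a :* ((con 1ℤ :- b) :* t) :+ b :* ((con 1ℤ :- a) :* t))) (λ _ → refl) (q a) (q b) t)

  zero-⊠ : ∀ {c} t → c ≈ constant 0ℤ → c ⊠ t ≈ constant 0ℤ
  zero-⊠ t c≈0 = ≈-trans (⊠-cong {g = t} c≈0 ≈-refl) (solve 1 (λ t → con 0ℤ :* t := con 0ℤ) (λ _ → refl) t)

  ⊠-zero : ∀ c {t} → t ≈ constant 0ℤ → c ⊠ t ≈ constant 0ℤ
  ⊠-zero c t≈0 = ≈-trans (⊠-cong {f = c} ≈-refl t≈0) (solve 1 (λ t → t :* con 0ℤ := con 0ℤ) (λ _ → refl) c)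

  cross : ℕ → ℕ → Series
  cross a b = constant (sgn a) ⊠ (q (gap² a (suc b) ℕ.+ a) ⊠ (e a ⊠ e b))

  -- Exchanging `a` and `b` keeps the exponent by `gap²-shift`, and reverses the sign since `a + b`
  -- is odd.
  cross-antisymmetric : ∀ n a b → a ℕ.+ b ≡ suc (n ℕ.+ n) → cross a b ⊞ cross b a ≈ constant 0ℤ
  cross-antisymmetric n a b eq = begin
    cross a b ⊞ cross b a
      ≡⟨ cong (λ d → cross a b ⊞ constant (sgn b) ⊠ (q d ⊠ (e b ⊠ e a))) (gap²-shift n a b eq) ⟨
    constant (sgn a) ⊠ (u ⊠ (e a ⊠ e b)) ⊞ constant (sgn b) ⊠ (u ⊠ (e b ⊠ e a))
      ≈⟨ solve 5 (λ x y u a b → x :* (u :* (a :* b)) :+ y :* (u :* (b :* a)) := (x :+ y) :* (u :* (a :* b)))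
          (λ _ → refl) (constant (sgn a)) (constant (sgn b)) u (e a) (e b) ⟩
    (constant (sgn a) ⊞ constant (sgn b)) ⊠ (u ⊠ (e a ⊠ e b))
      ≈⟨ zero-⊠ (u ⊠ (e a ⊠ e b)) constants ⟩
    constant 0ℤ ∎
    where
    u : Series
    u = q (gap² a (suc b) ℕ.+ a)
    constants : constant (sgn a) ⊞ constant (sgn b) ≈ constant 0ℤ
    constants zero    = sgn-odd n a b eq
    constants (suc n) = refl

  -- 1 - q^(a+b) = (1 - q^a)(1 - q^b) + q^a (1 - q^b) + q^b (1 - q^a): the first
  -- term lowers both indices of e a ⊠ e b, the sums of the other two vanish by
  -- antisymmetry.
  both left right : ℕ → ℕ → Series
  both  a b = cofactor a ⊠ (cofactor b ⊠ term a b)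
  left  a b = q a ⊠ (cofactor b ⊠ term a b)
  right a b = q b ⊠ (cofactor a ⊠ term a b)

  -- The end terms contain `cofactor 0`, which is zero. In the others both indices drop by one,
  -- which keeps `gap²` and changes the sign.
  Σ-both : ∀ m → Σ₂ both (suc (suc m)) ≈ ⊟ H m
  Σ-both m = begin
    Σ₂ both (suc (suc m))                     ≈⟨ Σ₂-first-zero both (suc m) (zero-⊠ (cofactor (suc (suc m)) ⊠ term 0
        (suc (suc m))) cofactor-0) ⟩
    Σ₂ (λ a b → both (suc a) b) (suc m)       ≈⟨ Σ₂-last-zero (λ a b → both (suc a) b) m
        (⊠-zero (cofactor (suc (suc m))) (zero-⊠ (term (suc (suc m)) 0) cofactor-0)) ⟩
    Σ₂ (λ a b → both (suc a) (suc b)) m       ≈⟨ Σ₂-cong m (λ a b _ → reduce a b) ⟩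
    Σ₂ (λ a b → constant (- 1ℤ) ⊠ term a b) m ≈⟨ Σ₂-⊠ {term} (constant (- 1ℤ)) m ⟩
    constant (- 1ℤ) ⊠ H m                     ≈⟨ solve 1 (λ h → con (- 1ℤ) :* h := :- h) (λ _ → refl) (H m) ⟩
    ⊟ H m                                     ∎
    where
    reduce : ∀ a b → both (suc a) (suc b) ≈ constant (- 1ℤ) ⊠ term a b
    reduce a b = begin
      cofactor (suc a) ⊠ (cofactor (suc b) ⊠ (constant (- sgn a) ⊠ (u ⊠ (e (suc a) ⊠ e (suc b)))))
        ≈⟨ solve 6 (λ ca cb c u x y → ca :* (cb :* (c :* (u :* (x :* y)))) := c :* (u :* ((ca :* x) :* (cb :* y))))
            (λ _ → refl) (cofactor (suc a)) (cofactor (suc b)) (constant (- sgn a)) u (e (suc a)) (e (suc b)) ⟩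
      constant (- sgn a) ⊠ (u ⊠ ((cofactor (suc a) ⊠ e (suc a)) ⊠ (cofactor (suc b) ⊠ e (suc b))))
        ≈⟨ ⊠-cong (constant-neg (sgn a)) (⊠-cong {f = u} ≈-refl (⊠-cong (cofactor-e a) (cofactor-e b))) ⟩
      ⊟ constant (sgn a) ⊠ (u ⊠ (e a ⊠ e b))
        ≈⟨ solve 2 (λ c t → (:- c) :* t := con (- 1ℤ) :* (c :* t)) (λ _ → refl) (constant (sgn a)) (u ⊠ (e a ⊠ e b)) ⟩
      constant (- 1ℤ) ⊠ term a b ∎
      where
      u : Series
      u = q (gap² a b)

  Σ-left : ∀ n → Σ₂ left (suc (suc (n ℕ.+ n))) ≈ constant 0ℤ
  Σ-left n = begin
    Σ₂ left (suc m)                    ≈⟨ Σ₂-last-zero left m (⊠-zero (q (suc m)) (zero-⊠ (term (suc m) 0) cofactor-0)) ⟩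
    Σ₂ (λ a b → left a (suc b)) m      ≈⟨ Σ₂-cong m (λ a b _ → reduce a b) ⟩
    Σ₂ cross m                         ≈⟨ Σ₂-antisymmetric cross m (cross-antisymmetric n) ⟩
    constant 0ℤ                        ∎
    where
    m : ℕ
    m = suc (n ℕ.+ n)
    reduce : ∀ a b → left a (suc b) ≈ cross a b
    reduce a b = begin
      q a ⊠ (cofactor (suc b) ⊠ (constant (sgn a) ⊠ (u ⊠ (e a ⊠ e (suc b)))))
        ≈⟨ solve 6 (λ qa cb c u x y → qa :* (cb :* (c :* (u :* (x :* y)))) := c :* ((u :* qa) :* (x :* (cb :* y))))
            (λ _ → refl) (q a) (cofactor (suc b)) (constant (sgn a)) u (e a) (e (suc b)) ⟩
      constant (sgn a) ⊠ ((u ⊠ q a) ⊠ (e a ⊠ (cofactor (suc b) ⊠ e (suc b))))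
        ≈⟨ ⊠-cong {f = constant (sgn a)} ≈-refl (⊠-cong (≈-sym (q-+ (gap² a (suc b)) a)) (⊠-cong {f = e a} ≈-refl
            (cofactor-e b))) ⟩
      cross a b ∎
      where
      u : Series
      u = q (gap² a (suc b))

  -- Reversal turns this into `Σ-left`, as `a` and `b` have equal signs when their sum is even.
  Σ-right : ∀ n → Σ₂ right (suc (suc (n ℕ.+ n))) ≈ constant 0ℤ
  Σ-right n = ≈-trans (Σ₂-flip right (suc (suc (n ℕ.+ n))))
    (≈-trans (Σ₂-cong (suc (suc (n ℕ.+ n))) swap) (Σ-left n))
    where
    even-signs : ∀ a b → a ℕ.+ b ≡ suc (suc (n ℕ.+ n)) → sgn b ≡ sgn a
    even-signs a b eq = ℤ.*-cancelˡ-≡ (sgn a) (sgn b) (sgn a) {{sgn≢0}} (trans (sym (sgn-+ a b)) (trans (cong sgn eq)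
      (trans (ℤ.neg-involutive (sgn (n ℕ.+ n))) (trans (sgn-double n) (sym (sgn-* a))))))
      where
      sgn≢0 : ℤ.NonZero (sgn a)
      sgn≢0 = ℤ.≢-nonZero {sgn a} (λ sgn≡0 → case trans (sym (sgn-* a)) (cong (λ x → x * x) sgn≡0) of λ ())
    swap : ∀ a b → a ℕ.+ b ≡ suc (suc (n ℕ.+ n)) → right b a ≈ left a b
    swap a b eq = begin
      q a ⊠ (cofactor b ⊠ (constant (sgn b) ⊠ (q (gap² b a) ⊠ (e b ⊠ e a))))
        ≡⟨ cong₂ (λ c d → q a ⊠ (cofactor b ⊠ (constant c ⊠ (q d ⊠ (e b ⊠ e a))))) (even-signs a b eq) (gap²-comm b a) ⟩
      q a ⊠ (cofactor b ⊠ (constant (sgn a) ⊠ (q (gap² a b) ⊠ (e b ⊠ e a))))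
        ≈⟨ solve 6 (λ qa cb c u x y → qa :* (cb :* (c :* (u :* (y :* x)))) := qa :* (cb :* (c :* (u :* (x :* y)))))
            (λ _ → refl) (q a) (cofactor b) (constant (sgn a)) (q (gap² a b)) (e a) (e b) ⟩
      left a b ∎

  -- Iteration evaluates H (2 n) as (-1)^n divided by (1 - q²)(1 - q⁴) ⋯ (1 - q^(2n)).
  H-step : ∀ n → cofactor (suc (suc (n ℕ.+ n))) ⊠ H (suc (suc (n ℕ.+ n))) ≈ ⊟ H (n ℕ.+ n)
  H-step n = begin
    cofactor m ⊠ H m                                     ≈⟨ Σ₂-⊠ {term} (cofactor m) m ⟨
    Σ₂ (λ a b → cofactor m ⊠ term a b) m                 ≈⟨ Σ₂-cong m split ⟩
    Σ₂ (λ a b → both a b ⊞ (left a b ⊞ right a b)) m     ≈⟨ Σ₂-⊞ {both} {λ a b → left a b ⊞ right a b} m ⟩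
    Σ₂ both m ⊞ Σ₂ (λ a b → left a b ⊞ right a b) m      ≈⟨ ⊞-cong {x = Σ₂ both m} ≈-refl (Σ₂-⊞ {left} {right} m) ⟩
    Σ₂ both m ⊞ (Σ₂ left m ⊞ Σ₂ right m)                 ≈⟨ ⊞-cong {Σ₂ both m} {⊟ H (n ℕ.+ n)} (Σ-both (n ℕ.+ n))
        (⊞-cong {Σ₂ left m} {constant 0ℤ} {Σ₂ right m} {constant 0ℤ} (Σ-left n) (Σ-right n)) ⟩
    ⊟ H (n ℕ.+ n) ⊞ (constant 0ℤ ⊞ constant 0ℤ)          ≈⟨ solve 1 (λ h → :- h :+ (con 0ℤ :+ con 0ℤ) := :- h)
        (λ _ → refl) (H (n ℕ.+ n)) ⟩
    ⊟ H (n ℕ.+ n)                                        ∎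
    where
    m : ℕ
    m = suc (suc (n ℕ.+ n))
    split : ∀ a b → a ℕ.+ b ≡ m → cofactor m ⊠ term a b ≈ both a b ⊞ (left a b ⊞ right a b)
    split a b a+b≡m = subst (λ m → cofactor m ⊠ term a b ≈ both a b ⊞ (left a b ⊞ right a b)) a+b≡m (cofactor-split a
        b (term a b))

-- Gauss' identity modulo powers of q, and θ as a counting series

module ThetaSeries where
  open Counting
  open PowerSeries
  open Series-Solver using (solve; _:=_; _:+_; _:*_; _:-_; :-_; con)
  open GaussIdentity
  open import Data.Integer as ℤ using (ℤ; +_; -[1+_]; -_; _+_; _-_; _*_; 0ℤ; 1ℤ; ∣_∣)
  open import Data.List using ([]; _∷_)
  open import Data.Nat using (⌊_/2⌋)
  open CommutativeRing seriesRing using () renaming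
    (refl to ≈-refl; sym to ≈-sym; trans to ≈-trans; +-cong to ⊞-cong; -‿cong to ⊟-cong)
  open import Relation.Binary.Reasoning.Setoid (CommutativeRing.setoid seriesRing)

  mod-weaken : ∀ {k l f g} → k ℕ.≤ l → f ≡ g [mod q l ] → f ≡ g [mod q k ]
  mod-weaken {k} {l} {f} {g} k≤l (multiple h f≈) = multiple (q (l ℕ.∸ k) ⊠ h) (≈-trans f≈ (⊞-cong {g} ≈-refl (≈-trans
    (⊠-cong {q l} {q k ⊠ q (l ℕ.∸ k)} {h} (subst (λ m → q m ≈ q k ⊠ q (l ℕ.∸ k)) (ℕ.m+[n∸m]≡n k≤l) (q-+ k (l ℕ.∸ k))) ≈-refl)
    (⊠-assoc (q k) (q (l ℕ.∸ k)) h))))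

  mod-shift : ∀ {k f g} d → f ≡ g [mod q k ] → q d ⊠ f ≡ q d ⊠ g [mod q (d ℕ.+ k) ]
  mod-shift {k} {f} {g} d (multiple h f≈) = multiple h (begin
    q d ⊠ f                          ≈⟨ ⊠-cong {q d} ≈-refl f≈ ⟩
    q d ⊠ (g ⊞ q k ⊠ h)              ≈⟨ solve 4 (λ d g k h → d :* (g :+ k :* h) := d :* g :+ d :* k :* h) (λ _ → refl)
        (q d) g (q k) h ⟩
    q d ⊠ g ⊞ q d ⊠ q k ⊠ h          ≈⟨ ⊞-cong {q d ⊠ g} ≈-refl (⊠-cong {g = h} (≈-sym (q-+ d k)) ≈-refl) ⟩
    q d ⊠ g ⊞ q (d ℕ.+ k) ⊠ h        ∎)

  -- The additional factors 1 / (1 - q^i) have i > a and so are 1 modulo q^(a+1).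
  e-stable : ∀ a j → e (a ℕ.+ j) ≡ e a [mod q (suc a) ]
  e-stable a zero    = ≈⇒mod (subst (λ m → e m ≈ e a) (sym (ℕ.+-identityʳ a)) ≈-refl)
  e-stable a (suc j) = subst (λ m → e m ≡ e a [mod q (suc a) ]) (sym (ℕ.+-suc a j))
    (mod-trans (mod-weaken (s≤s (ℕ.m≤m+n a j)) step) (e-stable a j))
    where
    m : ℕ
    m = a ℕ.+ j
    step : e (suc m) ≡ e m [mod q (suc m) ]
    step = multiple (e m ⊠ geometric m) (≈-trans (⊠-cong {e m} ≈-refl (geometric-unfold m))
      (solve 3 (λ e q g → e :* (con 1ℤ :+ q :* g) := e :+ q :* (e :* g)) (λ _ → refl) (e m) (q (suc m)) (geometric m)))

  -- If `a ≤ n`, then `e a` and `e n` agree below degree `a + 1`, and `q d` raises this bound to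
  -- `d + a + 1`. If `n ≤ a`, they already agree below degree `n + 1`.
  q-e : ∀ {n} d a → n ℕ.≤ d ℕ.+ a → q d ⊠ e a ≡ q d ⊠ e n [mod q (suc n) ]
  q-e {n} d a n≤d+a with ℕ.≤-total a n
  ... | inj₁ a≤n = mod-weaken (subst (suc n ℕ.≤_) (sym (ℕ.+-suc d a)) (s≤s n≤d+a))
    (mod-shift d (mod-sym (subst (λ m → e m ≡ e a [mod q (suc a) ]) (ℕ.m+[n∸m]≡n a≤n) (e-stable a (n ℕ.∸ a)))))
  ... | inj₂ n≤a = mod-weaken (ℕ.m≤n+m (suc n) d)
    (mod-shift d (subst (λ m → e m ≡ e n [mod q (suc n) ]) (ℕ.m+[n∸m]≡n n≤a) (e-stable n (a ℕ.∸ n))))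

  signedTerm : ℕ → ℕ → ℕ → Series
  signedTerm n a b = constant (sgn n) ⊠ (constant (sgn a) ⊠ q (gap² a b))

  signedTheta : ℕ → Series
  signedTheta n = Σ₂ (signedTerm n) (n ℕ.+ n)

  -- In each term `e a` and then `e b` is replaced by `e n`; `gap²-≥` provides the bound for `a`
  -- and, by symmetry, for `b`.
  H-mod : ∀ n → constant (sgn n) ⊠ H (n ℕ.+ n) ≡ (e n ⊠ e n) ⊠ signedTheta n [mod q (suc n) ]
  H-mod n = mod-trans
    (≈⇒mod (≈-sym (Σ₂-⊠ {term} (constant (sgn n)) (n ℕ.+ n))))
    (mod-trans
      (Σ₂-mod (n ℕ.+ n) termwise) (≈⇒mod (Σ₂-⊠ {signedTerm n} (e n ⊠ e n) (n ℕ.+ n))))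
    where
    termwise : ∀ a b → a ℕ.+ b ≡ n ℕ.+ n → constant (sgn n) ⊠ term a b ≡ (e n ⊠ e n) ⊠ signedTerm n a b [mod q (suc n) ]
    termwise a b eq =
      mod-trans
        (≈⇒mod (solve 5 (λ c c′ u x y → c :* (c′ :* (u :* (x :* y))) := c :* c′ :* y :* (u :* x)) (λ _ → refl) c c′ u
            (e a) (e b)))
      (mod-trans
        (mod-⊠ (≈⇒mod ≈-refl) (q-e (gap² a b) a (gap²-≥ n a b eq)))
      (mod-trans
        (≈⇒mod (solve 5 (λ c c′ u x y → c :* c′ :* y :* (u :* x) := c :* c′ :* x :* (u :* y)) (λ _ → refl) c c′ u (e n) (e b)))
      (mod-trans
        (mod-⊠ (≈⇒mod ≈-refl)
          (q-e (gap² a b) b (subst (λ d → n ℕ.≤ d ℕ.+ b) (gap²-comm b a) (gap²-≥ n b a (trans (ℕ.+-comm b a) eq)))))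
        (≈⇒mod (solve 4 (λ c c′ u x → c :* c′ :* x :* (u :* x) := x :* x :* (c :* (c′ :* u))) (λ _ → refl) c c′ u (e n))))))
      where
      c c′ u : Series
      c  = constant (sgn n)
      c′ = constant (sgn a)
      u  = q (gap² a b)

  evenProduct : ℕ → Series
  evenProduct zero    = one
  evenProduct (suc n) = evenProduct n ⊠ cofactor (suc (suc (n ℕ.+ n)))

  cofactor-double : ∀ n → cofactor (suc (suc (n ℕ.+ n))) ≈ cofactor (suc n) ⊠ (one ⊞ q (suc n))
  cofactor-double n = ≈-trans (⊞-cong {one} ≈-refl (⊟-cong
      (subst (λ m → q m ≈ q (suc n) ⊠ q (suc n)) (suc-double n) (q-+ (suc n) (suc n)))))
    (solve 1 (λ q → con 1ℤ :- q :* q := (con 1ℤ :- q) :* (con 1ℤ :+ q)) (λ _ → refl) (q (suc n)))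

  evenProduct-H : ∀ n → evenProduct n ⊠ (constant (sgn n) ⊠ H (n ℕ.+ n)) ≈ one
  evenProduct-H zero    = solve 0 (con 1ℤ :* (con 1ℤ :* (con 1ℤ :* (con 1ℤ :* (con 1ℤ :* con 1ℤ)))) := con 1ℤ) (λ _ → refl)
  evenProduct-H (suc n) = subst (λ m → evenProduct (suc n) ⊠ (constant (sgn (suc n)) ⊠ H m) ≈ one) (sym (suc-double n)) (begin
    evenProduct n ⊠ c ⊠ (constant (- sgn n) ⊠ H m)              ≈⟨ solve 4 (λ d c k h → d :* c :* (k :* h) := d :*
        (k :* (c :* h))) (λ _ → refl) (evenProduct n) c (constant (- sgn n)) (H m) ⟩
    evenProduct n ⊠ (constant (- sgn n) ⊠ (c ⊠ H m))            ≈⟨ ⊠-cong {evenProduct n} ≈-refl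
        (⊠-cong (constant-neg (sgn n)) (H-step n)) ⟩
    evenProduct n ⊠ (⊟ constant (sgn n) ⊠ ⊟ H (n ℕ.+ n))        ≈⟨ solve 3 (λ d k h → d :* ((:- k) :* (:- h)) := d :*
        (k :* h)) (λ _ → refl) (evenProduct n) (constant (sgn n)) (H (n ℕ.+ n)) ⟩
    evenProduct n ⊠ (constant (sgn n) ⊠ H (n ℕ.+ n))            ≈⟨ evenProduct-H n ⟩
    one                                             ∎)
    where
    m : ℕ
    m = suc (suc (n ℕ.+ n))
    c : Series
    c = cofactor m

  e⁻¹ : ℕ → Series
  e⁻¹ zero    = one
  e⁻¹ (suc n) = e⁻¹ n ⊠ cofactor (suc n)

  e-inverse : ∀ n → e⁻¹ n ⊠ e n ≈ one
  e-inverse zero    = solve 0 (con 1ℤ :* con 1ℤ := con 1ℤ) (λ _ → refl)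
  e-inverse (suc n) = ≈-trans (⊠-assoc (e⁻¹ n) (cofactor (suc n)) (e (suc n)))
    (≈-trans (⊠-cong {e⁻¹ n} ≈-refl (cofactor-e n)) (e-inverse n))

  -- The hypotheses determine `P n` as the product of (1 + q^k) / (1 - q^k) over 1 ≤ k ≤ n.
  -- Overpartitions with parts at most `n` are shown to satisfy them below.
  module _ (P : ℕ → Series) (P-zero : P 0 ≈ one)
           (P-suc : ∀ n → cofactor (suc n) ⊠ P (suc n) ≈ (one ⊞ q (suc n)) ⊠ P n) where

    -- Factor by factor, (1 + q^k) / (1 - q^k) = (1 - q^(2k)) / (1 - q^k)².
    P-product : ∀ n → P n ≈ evenProduct n ⊠ (e n ⊠ e n)
    P-product zero    = ≈-trans P-zero (solve 0 (con 1ℤ := con 1ℤ :* (con 1ℤ :* con 1ℤ)) (λ _ → refl))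
    P-product (suc n) = begin
      P (suc n)                              ≈⟨ ⊠-identityˡ (P (suc n)) ⟨
      one ⊠ P (suc n)                        ≈⟨ ⊠-cong {g = P (suc n)} (≈-sym (geometric-inverse n)) ≈-refl ⟩
      c ⊠ g ⊠ P (suc n)                      ≈⟨ solve 3 (λ c g p → c :* g :* p := g :* (c :* p)) (λ _ → refl) c g (P (suc n)) ⟩
      g ⊠ (c ⊠ P (suc n))                    ≈⟨ ⊠-cong {g} ≈-refl (P-suc n) ⟩
      g ⊠ (r ⊠ P n)                          ≈⟨ ⊠-cong {g} ≈-refl (⊠-cong {r} ≈-refl (P-product n)) ⟩
      g ⊠ (r ⊠ (evenProduct n ⊠ (e n ⊠ e n)))          ≈⟨ solve 4 (λ g r d e → g :* (r :* (d :* (e :* e))) := con 1ℤ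
          :* (g :* (r :* (d :* (e :* e))))) (λ _ → refl) g r (evenProduct n) (e n) ⟩
      one ⊠ (g ⊠ (r ⊠ (evenProduct n ⊠ (e n ⊠ e n))))  ≈⟨ ⊠-cong {g = g ⊠ (r ⊠ (evenProduct n ⊠ (e n ⊠ e n)))}
          (≈-sym (geometric-inverse n)) ≈-refl ⟩
      c ⊠ g ⊠ (g ⊠ (r ⊠ (evenProduct n ⊠ (e n ⊠ e n)))) ≈⟨ solve 5 (λ c g r d e → c :* g :*
          (g :* (r :* (d :* (e :* e)))) := d :* (c :* r) :* ((e :* g) :* (e :* g))) (λ _ → refl) c g r (evenProduct n) (e n) ⟩
      evenProduct n ⊠ (c ⊠ r) ⊠ ((e n ⊠ g) ⊠ (e n ⊠ g)) ≈⟨ ⊠-cong {g = (e n ⊠ g) ⊠ (e n ⊠ g)} (⊠-cong {evenProduct n}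
          ≈-refl (≈-sym (cofactor-double n))) ≈-refl ⟩
      evenProduct (suc n) ⊠ (e (suc n) ⊠ e (suc n))    ∎
      where
      c g r : Series
      c = cofactor (suc n)
      g = geometric n
      r = one ⊞ q (suc n)

    -- `P-product` splits off `evenProduct n` and leaves `e n ⊠ e n` to be combined with
    -- `signedTheta n`. By `H-mod` that combination is H (2 n) up to sign, the inverse of
    -- `evenProduct n`.
    gauss-mod : ∀ n → P n ⊠ signedTheta n ≡ one [mod q (suc n) ]
    gauss-mod n = mod-trans (≈⇒mod insert)
      (mod-trans
        (mod-⊠ (≈⇒mod ≈-refl)
          (mod-sym (H-mod n)))
        (≈⇒mod collapse))
      where
      i E k : Series
      i = e⁻¹ n
      E = e n ⊠ e n
      k = constant (sgn n)
      ii≈ : (i ⊠ e n) ⊠ (i ⊠ e n) ≈ one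
      ii≈ = ≈-trans (⊠-cong (e-inverse n) (e-inverse n)) (⊠-identityˡ one)
      insert : P n ⊠ signedTheta n ≈ (i ⊠ i ⊠ P n) ⊠ (E ⊠ signedTheta n)
      insert = begin
        P n ⊠ signedTheta n                                     ≈⟨ ⊠-identityˡ (P n ⊠ signedTheta n) ⟨
        one ⊠ (P n ⊠ signedTheta n)                             ≈⟨ ⊠-cong {g = P n ⊠ signedTheta n} (≈-sym ii≈) ≈-refl ⟩
        (i ⊠ e n) ⊠ (i ⊠ e n) ⊠ (P n ⊠ signedTheta n)           ≈⟨ solve 4 (λ i e p t → i :* e :* (i :* e) :* (p :* t)
            := i :* i :* p :* (e :* e :* t)) (λ _ → refl) i (e n) (P n) (signedTheta n) ⟩
        (i ⊠ i ⊠ P n) ⊠ (E ⊠ signedTheta n)                     ∎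
      collapse : (i ⊠ i ⊠ P n) ⊠ (k ⊠ H (n ℕ.+ n)) ≈ one
      collapse = begin
        (i ⊠ i ⊠ P n) ⊠ (k ⊠ H (n ℕ.+ n))                       ≈⟨ ⊠-cong {g = k ⊠ H (n ℕ.+ n)} (⊠-cong {i ⊠ i} ≈-refl
            (P-product n)) ≈-refl ⟩
        (i ⊠ i ⊠ (evenProduct n ⊠ E)) ⊠ (k ⊠ H (n ℕ.+ n))                 ≈⟨ solve 4 (λ i d e h → i :* i :*
            (d :* (e :* e)) :* h := (i :* e) :* (i :* e) :* (d :* h)) (λ _ → refl) i (evenProduct n) (e n) (k ⊠ H (n ℕ.+ n)) ⟩
        (i ⊠ e n) ⊠ (i ⊠ e n) ⊠ (evenProduct n ⊠ (k ⊠ H (n ℕ.+ n)))       ≈⟨ ⊠-cong ii≈ (evenProduct-H n) ⟩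
        one ⊠ one                                               ≈⟨ ⊠-identityˡ one ⟩
        one                                                     ∎

  -- The generating function of the squares of the integers j with ∣ j ∣ ≤ n.
  partialTheta : ℕ → Series
  partialTheta n = Σ₂ (λ a b → q (gap² a b)) (n ℕ.+ n)

  δ-refl : ∀ k → δ k k ≡ 1ℤ
  δ-refl zero    = refl
  δ-refl (suc k) = δ-refl k

  δ-≢ : ∀ k i → k ≢ i → δ k i ≡ 0ℤ
  δ-≢ zero    zero    k≢i = contradiction refl k≢i
  δ-≢ zero    (suc i) k≢i = refl
  δ-≢ (suc k) zero    k≢i = refl
  δ-≢ (suc k) (suc i) k≢i = δ-≢ k i (λ eq → k≢i (cong suc eq))

  Σ₂-scale : ∀ {F G i k} m → (∀ a b → a ℕ.+ b ≡ m → F a b i ≡ k * G a b i) → Σ₂ F m i ≡ k * Σ₂ G m i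
  Σ₂-scale zero    eq = eq 0 0 refl
  Σ₂-scale {F} {G} {i} {k} (suc m) eq = trans (cong₂ _+_ (eq 0 (suc m) refl)
    (Σ₂-scale {λ a b → F (suc a) b} {λ a b → G (suc a) b} {i} {k} m (λ a b eq′ → eq (suc a) b (cong suc eq′))))
    (sym (ℤ.*-distribˡ-+ k (G 0 (suc m) i) (Σ₂ (λ a b → G (suc a) b) m i)))

  -- A term q^(j²) contributes only to the coefficient i = j², where its sign (-1)^j is (-1)^i.
  signedTheta-partial : ∀ n i → signedTheta n i ≡ sgn i * partialTheta n i
  signedTheta-partial n i = Σ₂-scale {signedTerm n} {λ a b → q (gap² a b)} {i} {sgn i} (n ℕ.+ n) sign-gap²
    where
    sign-δ : ∀ d → sgn d * δ d i ≡ sgn i * δ d i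
    sign-δ d with d ℕ.≟ i
    ... | yes refl = refl
    ... | no d≢i   = trans (cong (λ x → sgn d * x) (δ-≢ d i d≢i)) (trans (trans (ℤ.*-zeroʳ (sgn d))
        (sym (ℤ.*-zeroʳ (sgn i)))) (cong (λ x → sgn i * x) (sym (δ-≢ d i d≢i))))
    sign-gap² : ∀ a b → a ℕ.+ b ≡ n ℕ.+ n → signedTerm n a b i ≡ sgn i * q (gap² a b) i
    sign-gap² a b eq = trans (constant-⊠ (sgn n) (constant (sgn a) ⊠ q (gap² a b)) i)
      (trans (cong (λ x → sgn n * x) (constant-⊠ (sgn a) (q (gap² a b)) i))
      (trans (sym (ℤ.*-assoc (sgn n) (sgn a) (q (gap² a b) i)))
      (trans (cong₂ _*_ (sgn-gap² n a b eq) (q-δ (gap² a b) i))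
      (trans (sign-δ (gap² a b)) (cong (λ x → sgn i * x) (sym (q-δ (gap² a b) i)))))))

  -- The new terms, for j = n + 1 and j = - (n + 1), sit at the two ends of the sum.
  partialTheta-suc : ∀ n i → partialTheta (suc n) i ≡ (+ 2) * δ (suc n ℕ.* suc n) i + partialTheta n i
  partialTheta-suc n i = trans (cong (λ m → Σ₂ F m i) (suc-double n)) (trans
    (cong (λ x → F 0 (suc (suc (n ℕ.+ n))) i + x) (Σ₂-last (λ a b → F (suc a) b) (n ℕ.+ n) i))
    (trans (cong₂ (λ x y → x + (partialTheta n i + y)) end end) (collect (δ (suc n ℕ.* suc n) i) (partialTheta n i))))
    where
    F : ℕ → ℕ → Series
    F a b = q (gap² a b)
    end : q (suc ⌊ n ℕ.+ n /2⌋ ℕ.* suc ⌊ n ℕ.+ n /2⌋) i ≡ δ (suc n ℕ.* suc n) i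
    end = trans (q-δ (suc ⌊ n ℕ.+ n /2⌋ ℕ.* suc ⌊ n ℕ.+ n /2⌋) i) (cong (λ h → δ (suc h ℕ.* suc h) i) (half-double n))
    collect : ∀ x y → x + (y + x) ≡ + 2 * x + y
    collect = solve-∀

  ∣_∣² : ℤ → ℕ
  ∣ j ∣² = ∣ j ∣ ℕ.* ∣ j ∣

  Counts : {signedP̄ : Set} → (ℕ → signedP̄ → Set) → Series → Set
  Counts P f = ∀ n → ∃[ k ] P n HasSize k × f n ≡ + k

  shell : ∀ n i → ∃[ k ] (λ j → ∣ j ∣ ≡ suc n × ∣ j ∣² ≡ i) HasSize k × + 2 * δ (suc n ℕ.* suc n) i ≡ + k
  shell n i with suc n ℕ.* suc n ℕ.≟ i
  ... | yes refl = 2 , enumeration (+ suc n ∷ -[1+ n ] ∷ []) (((λ ()) ∷ []) ∷ [] ∷ [])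
    (λ { (here refl) → refl , refl ; (there (here refl)) → refl , refl })
    (λ { {+ _} (refl , _) → here refl ; { -[1+ _ ]} (refl , _) → there (here refl) }) ,
    cong (λ x → + 2 * x) (δ-refl (suc n ℕ.* suc n))
  ... | no ≢i = 0 , HasSize-∅ (λ { j (refl′ , eq) → ≢i (trans (cong (λ m → m ℕ.* m) (sym refl′)) eq) }) ,
    cong (λ x → + 2 * x) (δ-≢ (suc n ℕ.* suc n) i ≢i)

  partialTheta-counts : ∀ n i → ∃[ k ] (λ j → ∣ j ∣ ℕ.≤ n × ∣ j ∣² ≡ i) HasSize k × partialTheta n i ≡ + k
  partialTheta-counts zero zero = 1 , enumeration (+ 0 ∷ []) ([] ∷ [])
    (λ { (here refl) → z≤n , refl }) (λ { {+ zero} _ → here refl ; {+ suc _} (() , _) ; { -[1+ _ ]} (() , _) }) , refl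
  partialTheta-counts zero (suc i) = 0 , HasSize-∅ (λ { (+ zero) (_ , ()) ; (+ suc _) (() , _) ; -[1+ _ ] (() , _) }) , refl
  partialTheta-counts (suc n) i with k , hk , eqk ← partialTheta-counts n i | l , hl , eql ← shell n i =
    l ℕ.+ k , HasSize-⇔ to from (HasSize-⊎ disjoint hl hk) ,
    trans (partialTheta-suc n i) (trans (cong₂ _+_ eql eqk) (sym (ℤ.pos-+ l k)))
    where
    disjoint : ∀ j → ∣ j ∣ ≡ suc n × ∣ j ∣² ≡ i → ¬ (∣ j ∣ ℕ.≤ n × ∣ j ∣² ≡ i)
    disjoint j (eq , _) (le , _) = ℕ.<⇒≱ (s≤s le) (ℕ.≤-reflexive (sym eq))
    to : ∀ j → (∣ j ∣ ≡ suc n × ∣ j ∣² ≡ i) ⊎ (∣ j ∣ ℕ.≤ n × ∣ j ∣² ≡ i) → ∣ j ∣ ℕ.≤ suc n × ∣ j ∣² ≡ i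
    to j (inj₁ (eq , sq)) = ℕ.≤-reflexive eq , sq
    to j (inj₂ (le , sq)) = ℕ.m≤n⇒m≤1+n le , sq
    from : ∀ j → ∣ j ∣ ℕ.≤ suc n × ∣ j ∣² ≡ i → (∣ j ∣ ≡ suc n × ∣ j ∣² ≡ i) ⊎ (∣ j ∣ ℕ.≤ n × ∣ j ∣² ≡ i)
    from j (le , sq) with ℕ.m≤n⇒m<n∨m≡n le
    ... | inj₁ (s≤s lt) = inj₂ (lt , sq)
    ... | inj₂ eq = inj₁ (eq , sq)

  -- The diagonal suffices: j² = i forces ∣ j ∣ ≤ i, so coefficient `i` is final in the `i`-th
  -- partial sum.
  θ : Series
  θ i = partialTheta i i

  partialTheta-counts-all : ∀ {n i} → i ℕ.≤ n → ∃[ k ] (λ j → ∣ j ∣² ≡ i) HasSize k × partialTheta n i ≡ + k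
  partialTheta-counts-all {n} {i} i≤n with k , hk , eq ← partialTheta-counts n i =
    k , HasSize-⇔ (λ _ → proj₂) (λ { j refl → ℕ.≤-trans (square-≤ (∣ j ∣)) i≤n , refl }) hk , eq

  θ-counts : Counts (λ i j → ∣ j ∣² ≡ i) θ
  θ-counts i = partialTheta-counts-all ℕ.≤-refl

  partialTheta-θ : ∀ {n i} → i ℕ.≤ n → partialTheta n i ≡ θ i
  partialTheta-θ {n} {i} i≤n with k , hk , eqk ← partialTheta-counts-all i≤n | l , hl , eql ← θ-counts i =
    trans eqk (trans (cong +_ (HasSize-unique hk hl)) (sym eql))

-- The generating function of overpartitions with bounded parts

module OverpartitionSeries where
  open Counting
  open PowerSeries
  open Series-Solver using (solve; _:=_; _:+_; _:*_; _:-_; :-_; con)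
  open GaussIdentity
  open import Data.Bool using (Bool; true; false; T)
  open import Data.Bool.Properties using (T?)
  open import Data.Integer as ℤ using (ℤ; +_; _+_; _*_; 1ℤ)
  open import Data.List using (List; []; _∷_; map)
  open import Data.Nat.ListAction using (sum)
  open import Data.Unit using (tt)
  open import Function.Bundles using (module Equivalence)
  open import Relation.Nullary.Decidable using (_×-dec_; _→-dec_; _⊎-dec_)
  open CommutativeRing seriesRing using () renaming
    (refl to ≈-refl; sym to ≈-sym; trans to ≈-trans; +-cong to ⊞-cong; -‿cong to ⊟-cong)
  open import Relation.Binary.Reasoning.Setoid (CommutativeRing.setoid seriesRing)

  -- Below a leading part of size m no further part of size m is overlined;
  -- this is the case free = false.
  Admissible : Bool → ℕ → Part → Set
  Admissible free m a = size a ℕ.≤ m × (T (overlined a) → T free ⊎ size a ≢ m)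

  admissible? : ∀ free m a → Dec (Admissible free m a)
  admissible? free m a = (size a ℕ.≤? m) ×-dec (T? (overlined a) →-dec (T? free ⊎-dec ¬? (size a ℕ.≟ m)))

  Class : Bool → ℕ → ℕ → List Part → Set
  Class free m n π = IsOverpartition n π × All (Admissible free m) π

  overpartitions-size : ∀ n → IsOverpartition n HasSize p̄ n
  overpartitions-size n = enumeration (overpartitions n) (overpartitions-unique n)
    (Equivalence.to ∈-overpartitions) (Equivalence.from ∈-overpartitions)

  class-size : ∀ free m n → ∃[ k ] Class free m n HasSize k
  class-size free m n = HasSize-filter (overpartitions-size n) (All.all? (admissible? free m))

  classSeries : Bool → ℕ → Series
  classSeries free m n = + proj₁ (class-size free m n)

  Headed : Bool → ℕ → ℕ → List Part → Set
  Headed free m n π = ∃[ o ] ∃[ ρ ] ∃[ j ] π ≡ part (suc m) o ∷ ρ × (T o → T free) × suc m ℕ.+ j ≡ n × Class false (suc m) j ρ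

  class-cons : ∀ {free m j} o ρ → (T o → T free) → Class false (suc m) j ρ → Class free (suc m) (suc m ℕ.+ j) (part (suc m) o ∷ ρ)
  class-cons {free} {m} o ρ o⇒free (π-over , adm) = record
    { positive = s≤s z≤n ∷ IsOverpartition.positive π-over
    ; ordered  = All.map precedes adm ∷ IsOverpartition.ordered π-over
    ; total    = cong (suc m ℕ.+_) (IsOverpartition.total π-over) } ,
    (ℕ.≤-refl , λ o → inj₁ (o⇒free o)) ∷ All.map (λ a → proj₁ a , λ o → inj₂ (not-m a o)) adm
    where
    not-m : ∀ {b} → Admissible false (suc m) b → T (overlined b) → size b ≢ suc m
    not-m (_ , f) o with inj₂ ≢m ← f o = ≢m
    precedes : ∀ {b} → Admissible false (suc m) b → part (suc m) o Precedes b
    precedes a = proj₁ a , λ o eq → not-m a o (sym eq)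

  -- Parts are weakly decreasing, so a first part below `m + 1` bounds all the others.
  class-uncons : ∀ {free m n} π → Class free (suc m) n π → Class true m n π ⊎ Headed free m n π
  class-uncons [] (π-over , _) = inj₁ (π-over , [])
  class-uncons {free} {m} {n} (part z o ∷ ρ) (π-over , (z≤ , adm-o) ∷ adm) with z ℕ.≟ suc m | IsOverpartition.positive
      π-over | IsOverpartition.ordered π-over
  ... | no z≢ | _ | o-ρ ∷ _ = inj₁ (π-over , (z≤m , λ _ → inj₁ tt) ∷ All.map (λ b → ℕ.≤-trans (proj₁ b) z≤m , λ _ → inj₁ tt) o-ρ)
    where
    z≤m : z ℕ.≤ m
    z≤m = ℕ.≤-pred (ℕ.≤∧≢⇒< z≤ z≢)
  ... | yes refl | _ ∷ pos | o-ρ ∷ ord = inj₂ (o , ρ , sum (map size ρ) , refl , free-o , IsOverpartition.total π-over ,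
    record { positive = pos ; ordered = ord ; total = refl } , All.map (λ b → proj₁ b , λ ob → inj₂ (λ eq → proj₂ b ob
        (sym eq))) o-ρ)
    where
    free-o : T o → T free
    free-o to with adm-o to
    ... | inj₁ tf = tf
    ... | inj₂ ≢m = contradiction refl ≢m

  class-weaken : ∀ {free m n} π → Class true m n π → Class free (suc m) n π
  class-weaken π (π-over , adm) = π-over ,
    All.map (λ a → ℕ.m≤n⇒m≤1+n (proj₁ a) , λ _ → inj₂ (λ eq → ℕ.<-irrefl eq (s≤s (proj₁ a)))) adm

  class-headed-disjoint : ∀ {free m n} π → Class true m n π → ¬ Headed free m n π
  class-headed-disjoint _ (_ , (≤m , _) ∷ _) (_ , _ , _ , refl , _) = ℕ.<-irrefl refl ≤m

  weight : Bool → ℕ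
  weight false = 1
  weight true  = 2

  weight-size : ∀ free → (λ o → T o → T free) HasSize weight free
  weight-size false = enumeration (false ∷ []) ([] ∷ []) (λ { (here refl) () }) (λ { {false} _ → here refl ; {true} f
      → contradiction tt f })
  weight-size true  = enumeration (false ∷ true ∷ []) (((λ ()) ∷ []) ∷ [] ∷ []) (λ _ _ → tt)
      (λ { {false} _ → here refl ; {true} _ → there (here refl) })

  headed-size : ∀ free m j {k} → Class false (suc m) j HasSize k → Headed free m (suc m ℕ.+ j) HasSize (weight free ℕ.* k)
  headed-size free m j hk = HasSize-map (λ (o , ρ) → part (suc m) o ∷ ρ)
    (λ (o , ρ) (o⇒free , class) → o , ρ , j , refl , o⇒free , refl , class)
    (λ { (o , ρ) (o′ , ρ′) _ _ refl → refl })
    (λ { _ (o , ρ , j′ , refl , o⇒free , eq , class) → (o , ρ) , (o⇒free , subst (λ j → Class false (suc m) j ρ)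
        (ℕ.+-cancelˡ-≡ (suc m) j′ j eq) class) , refl })
    (HasSize-× (weight-size free) hk)

  classSeries-split : ∀ free m {n l} → Headed free m n HasSize l → classSeries free (suc m) n ≡ classSeries true m n + + l
  classSeries-split free m {n} {l} hl = trans (cong +_ (HasSize-unique (proj₂ (class-size free (suc m) n))
    (HasSize-⇔ to class-uncons (HasSize-⊎ class-headed-disjoint (proj₂ (class-size true m n)) hl)))) (ℤ.pos-+ _ l)
    where
    to : ∀ π → Class true m n π ⊎ Headed free m n π → Class free (suc m) n π
    to π (inj₁ class) = class-weaken π class
    to _ (inj₂ (o , ρ , _ , refl , o⇒free , refl , class)) = class-cons o ρ o⇒free class

  -- Remove a leading part of size `m + 1`, if there is one. It may be overlined only if `free`
  -- holds, and after it this size may no longer be overlined.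
  classSeries-suc : ∀ free m → classSeries free (suc m) ≈
    classSeries true m ⊞ constant (+ weight free) ⊠ (q (suc m) ⊠ classSeries false (suc m))
  classSeries-suc free m n with n ℕ.<? suc m
  ... | yes n<m = trans (classSeries-split free m (HasSize-∅ none))
    (cong (λ x → classSeries true m n + x) (sym (trans (constant-⊠ (+ weight free) (q (suc m) ⊠ classSeries false (suc m)) n)
      (trans (cong (λ x → + weight free * x) (q-⊠-< (classSeries false (suc m)) n<m)) (ℤ.*-zeroʳ (+ weight free))))))
    where
    none : ∀ π → ¬ Headed free m n π
    none _ (_ , _ , j , _ , _ , refl , _) = ℕ.m+n≮m (suc m) j n<m
  ... | no n≮m with j , refl ← ℕ.m≤n⇒∃[o]m+o≡n (ℕ.≮⇒≥ n≮m) =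
    trans (classSeries-split free m (headed-size free m j (proj₂ (class-size false (suc m) j))))
      (cong (λ x → classSeries true m (suc m ℕ.+ j) + x) (trans (ℤ.pos-* (weight free) _)
        (sym (trans (constant-⊠ (+ weight free) (q (suc m) ⊠ classSeries false (suc m)) (suc m ℕ.+ j))
          (cong (λ x → + weight free * x) (q-⊠-+ (suc m) (classSeries false (suc m)) j))))))

  P : ℕ → Series
  P = classSeries true

  P-zero : P 0 ≈ one
  P-zero zero = cong +_ (HasSize-unique (proj₂ (class-size true 0 0))
    (enumeration ([] ∷ []) ([] ∷ []) (λ { (here refl) → record { positive = [] ; ordered = [] ; total = refl } , [] })
      (λ { {[]} _ → here refl ; {part zero _ ∷ _} (over , _) → contradiction (IsOverpartition.positive over) (λ { (() ∷ _) })
         ; {part (suc _) _ ∷ _} (_ , (() , _) ∷ _) })))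
  P-zero (suc n) = cong +_ (HasSize-unique (proj₂ (class-size true 0 (suc n))) (HasSize-∅ none))
    where
    none : ∀ π → ¬ Class true 0 (suc n) π
    none [] (over , _) with () ← IsOverpartition.total over
    none (part zero _ ∷ _) (over , _) with () ∷ _ ← IsOverpartition.positive over
    none (part (suc _) _ ∷ _) (_ , (() , _) ∷ _)

  -- The two cases of `classSeries-suc` are P (n + 1) = P n + 2 u R and R = P n + u R with u =
  -- q^(n+1). Hence (1 - u) R = P n, and `R` can be eliminated.
  P-suc : ∀ n → cofactor (suc n) ⊠ P (suc n) ≈ (one ⊞ q (suc n)) ⊠ P n
  P-suc n = begin
    cofactor (suc n) ⊠ P (suc n)
      ≈⟨ ⊠-cong {cofactor (suc n)} ≈-refl (classSeries-suc true n) ⟩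
    cofactor (suc n) ⊠ (P n ⊞ constant (+ 2) ⊠ (u ⊠ R))
      ≈⟨ solve 3 (λ u p r → (con 1ℤ :- u) :* (p :+ con (+ 2) :* (u :* r)) := (con 1ℤ :- u) :* p :+ con (+ 2) :* u :*
          (r :- con 1ℤ :* (u :* r))) (λ _ → refl) u (P n) R ⟩
    cofactor (suc n) ⊠ P n ⊞ constant (+ 2) ⊠ u ⊠ (R ⊞ ⊟ (one ⊠ (u ⊠ R)))
      ≈⟨ ⊞-cong {cofactor (suc n) ⊠ P n} ≈-refl (⊠-cong {constant (+ 2) ⊠ u} ≈-refl (⊞-cong {R} {P n ⊞ one ⊠ (u ⊠ R)}
          (classSeries-suc false n) ≈-refl)) ⟩
    cofactor (suc n) ⊠ P n ⊞ constant (+ 2) ⊠ u ⊠ (P n ⊞ one ⊠ (u ⊠ R) ⊞ ⊟ (one ⊠ (u ⊠ R)))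
      ≈⟨ solve 3 (λ u p r → (con 1ℤ :- u) :* p :+ con (+ 2) :* u :* (p :+ con 1ℤ :* (u :* r) :- con 1ℤ :* (u :* r)) :=
          (con 1ℤ :+ u) :* p) (λ _ → refl) u (P n) R ⟩
    (one ⊞ u) ⊠ P n ∎
    where
    u R : Series
    u = q (suc n)
    R = classSeries false (suc n)

  part-≤-total : ∀ π → All (λ a → size a ℕ.≤ sum (map size π)) π
  part-≤-total []      = []
  part-≤-total (a ∷ π) = ℕ.m≤m+n (size a) _ ∷ All.map (λ b≤ → ℕ.≤-trans b≤ (ℕ.m≤n+m (sum (map size π)) (size a))) (part-≤-total π)

  P-p̄ : ∀ {m n} → n ℕ.≤ m → P m n ≡ + p̄ n
  P-p̄ {m} {n} n≤m = cong +_ (HasSize-unique (proj₂ (class-size true m n)) (HasSize-⇔ admit (λ _ → proj₁)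
      (overpartitions-size n)))
    where
    admit : ∀ π → IsOverpartition n π → Class true m n π
    admit π over = over , All.map (λ a≤ → ℕ.≤-trans a≤ (ℕ.≤-trans (ℕ.≤-reflexive (IsOverpartition.total over)) n≤m) ,
        λ _ → inj₁ tt) (part-≤-total π)

-- Geometric sums modulo 5

module Recurrences where
  open import Data.Nat using (_+_; _*_; _%_; _/_)

  module GeometricSums (p : ℕ) (u : ℕ → ℕ) (recurrence : ∀ j → u (suc j) ≡ p * u j + u 0) where
    step : ∀ i {x} → u i ≡ x → u (suc i) ≡ p * x + u 0
    step i refl = recurrence i

    four-steps : ∀ j → u (4 + j) ≡ p * p * p * p * u j + (1 + p + p * p + p * p * p) * u 0
    four-steps j = trans (step (3 + j) (step (2 + j) (step (1 + j) (recurrence j)))) (expand p (u j) (u 0))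
      where
      expand : ∀ p x y → p * (p * (p * (p * x + y) + y) + y) + y ≡ p * p * p * p * x + (1 + p + p * p + p * p * p) * y
      expand = ℕ.solve-∀

    three-steps : u 3 ≡ (1 + p + p * p + p * p * p) * u 0
    three-steps = trans (step 2 (step 1 (recurrence 0))) (expand p (u 0))
      where
      expand : ∀ p y → p * (p * (p * y + y) + y) + y ≡ (1 + p + p * p + p * p * p) * y
      expand = ℕ.solve-∀

    -- Four steps of the recurrence multiply by p⁴ and add `u 0` times the given multiple of 5.
    5∣period-4 : 5 ℕ.∣ 1 + p + p * p + p * p * p → ∀ α → 5 ℕ.∣ u (α * 4 + 3)
    5∣period-4 5∣ zero    = subst (5 ℕ.∣_) (sym three-steps) (ℕ.∣m⇒∣m*n (u 0) 5∣)
    5∣period-4 5∣ (suc α) = subst (5 ℕ.∣_) (sym (four-steps (α * 4 + 3)))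
      (ℕ.∣m∣n⇒∣m+n (ℕ.∣n⇒∣m*n (p * p * p * p) (5∣period-4 5∣ α)) (ℕ.∣m⇒∣m*n (u 0) 5∣))

    5∣period-5 : 5 ℕ.∣ 1 + p + p * p + p * p * p + p * p * p * p → ∀ α → 5 ℕ.∣ u (α * 5 + 4)
    5∣period-5 5∣ zero    = subst (5 ℕ.∣_) (sym (trans (four-steps 0) (collect p (u 0)))) (ℕ.∣m⇒∣m*n (u 0) 5∣)
      where
      collect : ∀ p x → p * p * p * p * x + (1 + p + p * p + p * p * p) * x ≡ (1 + p + p * p + p * p * p + p * p * p * p) * x
      collect = ℕ.solve-∀
    5∣period-5 5∣ (suc α) = subst (5 ℕ.∣_) (sym (trans (four-steps (suc (α * 5 + 4)))
        (trans (cong (λ x → p * p * p * p * x + (1 + p + p * p + p * p * p) * u 0) (recurrence (α * 5 + 4)))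
            (collect p (u (α * 5 + 4)) (u 0)))))
      (ℕ.∣m∣n⇒∣m+n (ℕ.∣n⇒∣m*n (p * p * p * p * p) (5∣period-5 5∣ α)) (ℕ.∣m⇒∣m*n (u 0) 5∣))
      where
      collect : ∀ p x y → p * p * p * p * (p * x + y) + (1 + p + p * p + p * p * p) * y ≡
                p * p * p * p * p * x + (1 + p + p * p + p * p * p + p * p * p * p) * y
      collect = ℕ.solve-∀

  -- `quotient` is a fifth of the difference between the sums for r + 5 t and for r, multiplied out.
  5∣sum-4 : ∀ p {r} → p % 5 ≡ r → 5 ℕ.∣ 1 + r + r * r + r * r * r → 5 ℕ.∣ 1 + p + p * p + p * p * p
  5∣sum-4 p {r} refl 5∣ = subst (5 ℕ.∣_) (trans (expand r t) (cong (λ p → 1 + p + p * p + p * p * p) (sym (ℕ.m≡m%n+[m/n]*n p 5))))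
    (ℕ.∣m∣n⇒∣m+n 5∣ (ℕ.m∣m*n (quotient r t)))
    where
    t : ℕ
    t = p / 5
    quotient : ℕ → ℕ → ℕ
    quotient r t = t + 2 * r * t + 5 * (t * t) + 3 * (r * r) * t + 15 * r * (t * t) + 25 * (t * t * t)
    expand : ∀ r t → 1 + r + r * r + r * r * r +
      5 * (t + 2 * r * t + 5 * (t * t) + 3 * (r * r) * t + 15 * r * (t * t) + 25 * (t * t * t)) ≡
      1 + (r + t * 5) + ((r + t * 5) * (r + t * 5)) + ((r + t * 5) * (r + t * 5) * (r + t * 5))
    expand = ℕ.solve-∀

  5∣sum-5 : ∀ p → p % 5 ≡ 1 → 5 ℕ.∣ 1 + p + p * p + p * p * p + p * p * p * p
  5∣sum-5 p p%5≡1 = subst (5 ℕ.∣_) (trans (expand t) (cong (λ p → 1 + p + p * p + p * p * p + p * p * p * p)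
      (sym (trans (ℕ.m≡m%n+[m/n]*n p 5) (cong (_+ t * 5) p%5≡1)))))
    (ℕ.m∣m*n (quotient t))
    where
    t : ℕ
    t = p / 5
    quotient : ℕ → ℕ
    quotient t = 1 + 10 * t + 50 * (t * t) + 125 * (t * t * t) + 125 * (t * t * t * t)
    expand : ∀ t → 5 * (1 + 10 * t + 50 * (t * t) + 125 * (t * t * t) + 125 * (t * t * t * t)) ≡
      1 + (1 + t * 5) + ((1 + t * 5) * (1 + t * 5)) + ((1 + t * 5) * (1 + t * 5) * (1 + t * 5)) + ((1 + t * 5) *
          (1 + t * 5) * (1 + t * 5) * (1 + t * 5))
    expand = ℕ.solve-∀

-- Overpartitions of 5 n and sums of three squares modulo 5

module Congruences where
  open Counting
  open Quaternions using (quat; norm)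
  open Descent using (normℕ; +normℕ; _∣ᴴ_; norm-•; •-cancel)
  open Representations using (module Sandwich; re-•)
  open Conics using (norm-p-count)
  open PowerSeries
  open Series-Solver using (solve; _:=_; _:+_; _:*_; con)
  open GaussIdentity using (X; X-⊠-zero; X-⊠-suc; q; q-⊠-<; q-⊠-+; one; sgn; sgn-*; _≡_[mod_]; multiple; mod-⊠;
      mod-trans; mod-sym; ≈⇒mod; mod-coefficient)
  open ThetaSeries
  open Recurrences
  open OverpartitionSeries
  open import Data.Integer as ℤ using (ℤ; +_; -_; _+_; _-_; _*_; 0ℤ; 1ℤ; ∣_∣)
  open import Data.Integer.DivMod using (_/ℕ_; _%ℕ_; a≡a%ℕn+[a/ℕn]*n; n%ℕd<d)
  open import Data.Integer.Divisibility.Signed using (divides; ∣⇒∣ᵤ; ∣ᵤ⇒∣; ∣m∣n⇒∣m+n; ∣n⇒∣m*n) renaming (_∣_ to infix 4 _∣ᶻ_)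
  open import Relation.Nullary.Decidable using (from-yes)
  open CommutativeRing seriesRing using () renaming
    (refl to ≈-refl; sym to ≈-sym; trans to ≈-trans; +-cong to ⊞-cong; -‿cong to ⊟-cong)
  open import Relation.Binary.Reasoning.Setoid (CommutativeRing.setoid seriesRing)

  -- The ring automorphism that substitutes -q for q.
  twist : Series → Series
  twist f n = sgn n * f n

  twist-⊠ : ∀ f g → twist f ⊠ twist g ≈ twist (f ⊠ g)
  twist-⊠ f g zero    = rearrange (f 0) (g 0)
    where
    rearrange : ∀ a b → 1ℤ * a * (1ℤ * b) ≡ 1ℤ * (a * b)
    rearrange = solve-∀
  twist-⊠ f g (suc n) = trans (cong (λ x → twist f 0 * twist g (suc n) + x) (trans
      (⊠-cong {g = twist g} {twist g} (λ i → negate (sgn i) (f (suc i))) (λ _ → refl) n)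
      (trans (scale-⊠ (- 1ℤ) (twist (tail f)) (twist g) n) (cong (λ x → - 1ℤ * x) (twist-⊠ (tail f) g n)))))
    (rearrange (sgn n) (f 0) (g (suc n)) ((tail f ⊠ g) n))
    where
    negate : ∀ sgn x → - sgn * x ≡ - 1ℤ * (sgn * x)
    negate = solve-∀
    rearrange : ∀ sgn a b x → 1ℤ * a * (- sgn * b) + - 1ℤ * (sgn * x) ≡ - sgn * (a * b + x)
    rearrange = solve-∀

  twist-twist : ∀ f → twist (twist f) ≈ f
  twist-twist f n = trans (sym (ℤ.*-assoc (sgn n) (sgn n) (f n))) (trans (cong (_* f n) (sgn-* n)) (ℤ.*-identityˡ (f n)))

  p̄-series : Series
  p̄-series n = + p̄ n

  -- Up to degree `n` both factors coincide with the truncations to which `gauss-mod` applies.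
  p̄-inverse : p̄-series ⊠ twist θ ≈ one
  p̄-inverse n = trans
    (⊠-cong-≤ n (λ i i≤n → sym (P-p̄ i≤n))
      (λ i i≤n → sym (trans (signedTheta-partial n i) (cong (λ x → sgn i * x) (partialTheta-θ i≤n)))))
    (mod-coefficient (gauss-mod P P-zero P-suc n) (ℕ.n<1+n n))

  signedP̄ : Series
  signedP̄ = twist p̄-series

  signedP̄-inverse : signedP̄ ⊠ θ ≈ one
  signedP̄-inverse = begin
    signedP̄ ⊠ θ                          ≈⟨ ⊠-cong {signedP̄} ≈-refl (≈-sym (twist-twist θ)) ⟩
    signedP̄ ⊠ twist (twist θ)            ≈⟨ twist-⊠ p̄-series (twist θ) ⟩
    twist (p̄-series ⊠ twist θ)     ≈⟨ (λ n → cong (λ x → sgn n * x) (p̄-inverse n)) ⟩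
    twist one                      ≈⟨ twist-one ⟩
    one                            ∎
    where
    twist-one : twist one ≈ one
    twist-one zero    = refl
    twist-one (suc n) = ℤ.*-zeroʳ (sgn (suc n))

  5ˢ : Series
  5ˢ = constant (+ 5)

  mod5-coefficient : ∀ {f g} → f ≡ g [mod 5ˢ ] → ∀ n → + 5 ∣ᶻ f n - g n
  mod5-coefficient {f} {g} (multiple h f≈) n = divides (h n) (trans (cong (_- g n) (f≈ n))
    (trans (cong (λ x → g n + x - g n) (constant-⊠ (+ 5) h n)) (rearrange (g n) (h n))))
    where
    rearrange : ∀ g h → g + + 5 * h - g ≡ h * + 5
    rearrange = solve-∀

  coefficient-mod5 : ∀ {f g} → (∀ n → + 5 ∣ᶻ f n - g n) → f ≡ g [mod 5ˢ ]
  coefficient-mod5 {f} {g} d = multiple (λ n → _∣ᶻ_.quotient (d n)) (λ n → trans (rearrange (f n) (g n))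
    (cong (λ x → g n + x) (trans (_∣ᶻ_.equality (d n)) (trans (ℤ.*-comm _ (+ 5)) (sym (constant-⊠ (+ 5) _ n))))))
    where
    rearrange : ∀ f g → f ≡ g + (f - g)
    rearrange = solve-∀

  -- The series f(q⁵).
  dilate : Series → Series
  dilate f 0 = f 0
  dilate f 1 = 0ℤ
  dilate f 2 = 0ℤ
  dilate f 3 = 0ℤ
  dilate f 4 = 0ℤ
  dilate f (suc (suc (suc (suc (suc n))))) = dilate (tail f) n

  fermat-5 : ∀ a → + 5 ∣ᶻ a * a * a * a * a - a
  fermat-5 a = subst (+ 5 ∣ᶻ_) (trans (expand (+ (a %ℕ 5)) (a /ℕ 5)) (cong (λ a → a * a * a * a * a - a)
      (sym (a≡a%ℕn+[a/ℕn]*n a 5))))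
    (∣m∣n⇒∣m+n (residue (a %ℕ 5) (n%ℕd<d a 5)) (divides (quotient (+ (a %ℕ 5)) (a /ℕ 5)) refl))
    where
    quotient : ℤ → ℤ → ℤ
    quotient r t = + 5 * r * r * r * r * t + + 50 * r * r * r * t * t + + 250 * r * r * t * t * t + + 625 * r * t * t
        * t * t + + 625 * t * t * t * t * t - t
    residue : ∀ r → r ℕ.< 5 → + 5 ∣ᶻ + r * + r * + r * + r * + r - + r
    residue 0 _ = divides 0ℤ refl
    residue 1 _ = divides 0ℤ refl
    residue 2 _ = divides (+ 6) refl
    residue 3 _ = divides (+ 48) refl
    residue 4 _ = divides (+ 204) refl
    residue (suc (suc (suc (suc (suc _))))) (s≤s (s≤s (s≤s (s≤s (s≤s ())))))
    expand : ∀ r t → r * r * r * r * r - r +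
      (+ 5 * r * r * r * r * t + + 50 * r * r * r * t * t + + 250 * r * r * t * t * t + + 625 * r * t * t * t * t + +
          625 * t * t * t * t * t - t) * + 5 ≡
      (r + t * + 5) * (r + t * + 5) * (r + t * + 5) * (r + t * + 5) * (r + t * + 5) - (r + t * + 5)
    expand = solve-∀

  fifth : Series → Series
  fifth f = f ⊠ f ⊠ f ⊠ f ⊠ f

  head-tail : ∀ f → f ≈ constant (f 0) ⊞ X ⊠ tail f
  head-tail f zero    = sym (trans (cong (λ x → f 0 + x) (X-⊠-zero (tail f))) (ℤ.+-identityʳ (f 0)))
  head-tail f (suc n) = sym (trans (ℤ.+-identityˡ ((X ⊠ tail f) (suc n))) (X-⊠-suc (tail f) n))

  -- The binomial theorem for `f 0 + q tail f`: the mixed terms have coefficients 5 and 10.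
  fifth-expand : ∀ f → fifth f ≡ fifth (constant (f 0)) ⊞ q 5 ⊠ fifth (tail f) [mod 5ˢ ]
  fifth-expand f = multiple (a ⊠ x ⊠ (a ⊠ a ⊠ a ⊞ constant (+ 2) ⊠ a ⊠ a ⊠ x ⊞ constant (+ 2) ⊠ a ⊠ x ⊠ x ⊞ x ⊠ x ⊠ x))
    (≈-trans (⊠-cong (⊠-cong (⊠-cong (⊠-cong f≈ f≈) f≈) f≈) f≈)
      (solve 3 (λ a X t → let x = X :* t ; f = a :+ x in f :* f :* f :* f :* f :=
        -- The nested product is `q 5` unfolded.
        a :* a :* a :* a :* a :+ (X :* (X :* (X :* (X :* (X :* con 1ℤ))))) :* (t :* t :* t :* t :* t) :+
        con (+ 5) :* (a :* x :* (a :* a :* a :+ con (+ 2) :* a :* a :* x :+ con (+ 2) :* a :* x :* x :+ x :* x :* x)))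
            (λ _ → refl) a X (tail f)))
    where
    a x : Series
    a = constant (f 0)
    x = X ⊠ tail f
    f≈ : f ≈ a ⊞ x
    f≈ = head-tail f

  fifth-constant : ∀ k → fifth (constant k) ≈ constant (k * k * k * k * k)
  fifth-constant k zero    = refl
  fifth-constant k (suc n) = trans (⊠-comm (g ⊠ g ⊠ g ⊠ g) g (suc n)) (trans (constant-⊠ k (g ⊠ g ⊠ g ⊠ g) (suc n))
      (trans (cong (λ x → k * x) (vanish (g ⊠ g ⊠ g) (vanish (g ⊠ g) (vanish g (λ _ → refl))) n)) (ℤ.*-zeroʳ k)))
    where
    g : Series
    g = constant k
    vanish : ∀ h → (∀ n → h (suc n) ≡ 0ℤ) → ∀ n → (h ⊠ g) (suc n) ≡ 0ℤ
    vanish h h≡0 n = trans (⊠-comm h g (suc n)) (trans (constant-⊠ k h (suc n)) (trans (cong (λ x → k * x) (h≡0 n))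
        (ℤ.*-zeroʳ k)))

  -- By `fifth-expand` the constant term is Fermat's congruence, the next four coefficients vanish
  -- modulo 5, and the rest is the claim for `tail f`, five degrees lower.
  frobenius-coefficient : ∀ n f → + 5 ∣ᶻ fifth f n - dilate f n
  frobenius-coefficient n f = subst (+ 5 ∣ᶻ_) (telescope (fifth f n) (expanded n) (dilate f n))
    (∣m∣n⇒∣m+n (mod5-coefficient (fifth-expand f) n) (remaining n))
    where
    expanded : Series
    expanded = fifth (constant (f 0)) ⊞ q 5 ⊠ fifth (tail f)
    telescope : ∀ a b c → a - b + (b - c) ≡ a - c
    telescope = solve-∀
    low : ∀ {n} → suc n ℕ.< 5 → + 5 ∣ᶻ expanded (suc n) - 0ℤ
    low {n} n<5 = divides 0ℤ (cong (_- 0ℤ) (cong₂ _+_ (fifth-constant (f 0) (suc n)) (q-⊠-< {5} (fifth (tail f)) {suc n} n<5)))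
    remaining : ∀ n → + 5 ∣ᶻ expanded n - dilate f n
    remaining 0 = subst (+ 5 ∣ᶻ_) (cong (_- f 0) (sym (trans (cong₂ _+_ (fifth-constant (f 0) 0)
        (q-⊠-< {5} (fifth (tail f)) {0} (s≤s z≤n)))
      (ℤ.+-identityʳ (f 0 * f 0 * f 0 * f 0 * f 0))))) (fermat-5 (f 0))
    remaining 1 = low (s≤s (s≤s z≤n))
    remaining 2 = low (s≤s (s≤s (s≤s z≤n)))
    remaining 3 = low (s≤s (s≤s (s≤s (s≤s z≤n))))
    remaining 4 = low (s≤s (s≤s (s≤s (s≤s (s≤s z≤n)))))
    remaining (suc (suc (suc (suc (suc n))))) = subst (λ x → + 5 ∣ᶻ x - dilate (tail f) n)
      (sym (trans (cong₂ _+_ (fifth-constant (f 0) (5 ℕ.+ n)) (q-⊠-+ 5 (fifth (tail f)) n)) (ℤ.+-identityˡ (fifth (tail f) n))))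
      (frobenius-coefficient n (tail f))

  frobenius : ∀ f → fifth f ≡ dilate f [mod 5ˢ ]
  frobenius f = coefficient-mod5 (λ n → frobenius-coefficient n f)

  section : Series → Series
  section f n = f (n ℕ.* 5)

  dilate-section : ∀ g f → section (dilate g ⊠ f) ≈ g ⊠ section f
  dilate-section g f zero    = refl
  dilate-section g f (suc n) = cong (λ x → g 0 * f (suc n ℕ.* 5) + x)
    (trans (zeros (f (4 ℕ.+ n ℕ.* 5)) (f (3 ℕ.+ n ℕ.* 5)) (f (2 ℕ.+ n ℕ.* 5)) (f (1 ℕ.+ n ℕ.* 5))
        (section (dilate (tail g) ⊠ f) n)) (dilate-section (tail g) f n))
    where
    zeros : ∀ a b c d x → 0ℤ * a + (0ℤ * b + (0ℤ * c + (0ℤ * d + x))) ≡ x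
    zeros = solve-∀

  -- The induction follows the recursion of `_⊠_` and passes to `tail f`, so `P` must be a general
  -- family; `disjoint` makes the index of `x` unique.
  Counts-+ : {A B : Set} {P : ℕ → A → Set} {Q : ℕ → B → Set} {f g : Series} →
    (∀ {i j x} → P i x → P j x → i ≡ j) → Counts P f → Counts Q g →
    Counts (λ n ((x , y) : A × B) → ∃[ i ] ∃[ j ] i ℕ.+ j ≡ n × P i x × Q j y) (f ⊠ g)
  Counts-+ disjoint hf hg zero with k , hk , eqk ← hf 0 | l , hl , eql ← hg 0 =
    k ℕ.* l , HasSize-⇔ (λ _ (px , qy) → 0 , 0 , refl , px , qy) (λ { _ (zero , zero , _ , px , qy) → px , qy })
        (HasSize-× hk hl) ,
    trans (cong₂ _*_ eqk eql) (sym (ℤ.pos-* k l))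
  Counts-+ {P = P} {Q} disjoint hf hg (suc n)
    with k , hk , eqk ← hf 0 | l , hl , eql ← hg (suc n)
       | m , hm , eqm ← Counts-+ (λ px py → ℕ.suc-injective (disjoint px py)) (λ i → hf (suc i)) hg n =
    k ℕ.* l ℕ.+ m , HasSize-⇔ to from (HasSize-⊎ (λ { _ (p₀ , _) (_ , _ , _ , p , _) → contradiction (disjoint p₀ p)
        (λ ()) }) (HasSize-× hk hl) hm) ,
    trans (cong₂ _+_ (trans (cong₂ _*_ eqk eql) (sym (ℤ.pos-* k l))) eqm) (sym (ℤ.pos-+ (k ℕ.* l) m))
    where
    to : ∀ ((x , y) : _ × _) → (P 0 x × Q (suc n) y) ⊎ (∃[ i ] ∃[ j ] i ℕ.+ j ≡ n × P (suc i) x × Q j y) →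
         ∃[ i ] ∃[ j ] i ℕ.+ j ≡ suc n × P i x × Q j y
    to _ (inj₁ (px , qy)) = 0 , suc n , refl , px , qy
    to _ (inj₂ (i , j , eq , px , qy)) = suc i , j , cong suc eq , px , qy
    from : ∀ ((x , y) : _ × _) → (∃[ i ] ∃[ j ] i ℕ.+ j ≡ suc n × P i x × Q j y) →
         (P 0 x × Q (suc n) y) ⊎ (∃[ i ] ∃[ j ] i ℕ.+ j ≡ n × P (suc i) x × Q j y)
    from _ (zero , j , refl , px , qy) = inj₁ (px , qy)
    from _ (suc i , j , eq , px , qy) = inj₂ (i , j , ℕ.suc-injective eq , px , qy)

  Counts-⊠ : {A B : Set} (ν : A → ℕ) (μ : B → ℕ) {f g : Series} → Counts (λ n x → ν x ≡ n) f → Counts (λ n y → μ y ≡ n) g →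
    Counts (λ n ((x , y) : A × B) → ν x ℕ.+ μ y ≡ n) (f ⊠ g)
  Counts-⊠ ν μ hf hg n with k , hk , eq ← Counts-+ (λ { refl refl → refl }) hf hg n =
    k , HasSize-⇔ (λ { _ (_ , _ , eq , refl , refl) → eq }) (λ (x , y) eq → ν x , μ y , eq , refl , refl) hk , eq

  Counts-map : {A B : Set} {P : ℕ → A → Set} {Q : ℕ → B → Set} {f : Series} (φ : A → B) → (∀ n x → P n x → Q n (φ x)) →
    (∀ x y → φ x ≡ φ y → x ≡ y) → (∀ n y → Q n y → ∃[ x ] P n x × φ x ≡ y) → Counts P f → Counts Q f
  Counts-map φ to injective onto hf n with k , hk , eq ← hf n =
    k , HasSize-map φ (to n) (λ x y _ _ → injective x y) (onto n) hk , eq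

  θ² θ³ θ⁴ : Series
  θ² = θ ⊠ θ
  θ³ = θ² ⊠ θ
  θ⁴ = θ³ ⊠ θ

  θ²-counts : Counts (λ n ((a , b) : ℤ × ℤ) → ∣ a ∣² ℕ.+ ∣ b ∣² ≡ n) θ²
  θ²-counts = Counts-⊠ ∣_∣² ∣_∣² θ-counts θ-counts

  θ³-counts′ : Counts (λ n (((a , b) , c) : (ℤ × ℤ) × ℤ) → ∣ a ∣² ℕ.+ ∣ b ∣² ℕ.+ ∣ c ∣² ≡ n) θ³
  θ³-counts′ = Counts-⊠ (λ (a , b) → ∣ a ∣² ℕ.+ ∣ b ∣²) ∣_∣² θ²-counts θ-counts

  norm≡ : ∀ x {n} → normℕ x ≡ n → norm x ≡ + n
  norm≡ x eq = trans (sym (+normℕ x)) (cong +_ eq)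

  normℕ≡ : ∀ x {n} → norm x ≡ + n → normℕ x ≡ n
  normℕ≡ x eq = ℤ.+-injective (trans (+normℕ x) eq)

  θ⁴-counts : Counts (λ n x → norm x ≡ + n) θ⁴
  θ⁴-counts = Counts-map (λ (((a , b) , c) , d) → quat a b c d) (λ n (((a , b) , c) , d) eq → norm≡ (quat a b c d) eq)
    (λ { _ _ refl → refl }) (λ { n (quat a b c d) eq → (((a , b) , c) , d) , normℕ≡ (quat a b c d) eq , refl })
    (Counts-⊠ (λ ((a , b) , c) → ∣ a ∣² ℕ.+ ∣ b ∣² ℕ.+ ∣ c ∣²) ∣_∣² θ³-counts′ θ-counts)

  θ³-counts : Counts (λ n x → Quaternions.re x ≡ 0ℤ × norm x ≡ + n) θ³
  θ³-counts = Counts-map (λ ((b , c) , d) → quat 0ℤ b c d) (λ n ((b , c) , d) eq → refl , norm≡ (quat 0ℤ b c d) eq)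
    (λ { _ _ refl → refl }) (λ { n (quat _ b c d) (refl , eq) → ((b , c) , d) , normℕ≡ (quat 0ℤ b c d) eq , refl }) θ³-counts′

  Counts-size : {A : Set} {P : ℕ → A → Set} {f : Series} → Counts P f → ∀ n {k} → f n ≡ + k → P n HasSize k
  Counts-size hf n eq with k , hk , eqk ← hf n = HasSize-≡ hk (ℤ.+-injective (trans (sym eqk) eq))

  unit-count : (λ u → norm u ≡ 1ℤ) HasSize 8
  -- The coefficient of q in θ⁴ is computed to be 8.
  unit-count = Counts-size θ⁴-counts 1 refl

  5-prime : Prime 5
  5-prime = from-yes (prime? 5)

  prime-norm-count : ∀ {p} → Prime p → 3 ℕ.≤ p → (λ σ → norm σ ≡ + p) HasSize (suc p ℕ.* 8)
  prime-norm-count {p} p-prime 3≤p = HasSize-≡ (proj₁ (proj₂ (θ⁴-counts p))) (norm-p-count p-prime 3≤p unit-count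
      (proj₁ (proj₂ (θ⁴-counts p))))

  -- There are 48 quaternions of norm 5, so 48 a = 48 k + 8 l with b = k + l, whence b - a = 5 (a -
  -- k).
  θ⁴-section : ∀ n → + 5 ∣ᶻ θ⁴ (n ℕ.* 5) - θ⁴ n
  θ⁴-section n = compare (θ⁴-counts n) (θ⁴-counts (n ℕ.* 5))
    where
    3≤5 : 3 ℕ.≤ 5
    3≤5 = s≤s (s≤s (s≤s z≤n))
    compare : ∀ {x y} → (∃[ a ] (λ x → norm x ≡ + n) HasSize a × x ≡ + a) → (∃[ b ] (λ x → norm x ≡ + (n ℕ.* 5))
        HasSize b × y ≡ + b) → + 5 ∣ᶻ y - x
    compare (a , ha , refl) (b , hb , refl) = conclude (Sandwich.norm-multiple-count 5-prime 3≤5 unit-count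
        (prime-norm-count 5-prime 3≤5) ha
      (HasSize-⇔ (λ x eq → trans eq +n*5) (λ x eq → trans eq (sym +n*5)) hb))
      where
      +n*5 : + (n ℕ.* 5) ≡ + 5 * + n
      +n*5 = trans (ℤ.pos-* n 5) (ℤ.*-comm (+ n) (+ 5))
      conclude : (∃[ k ] ∃[ l ] k ℕ.+ l ≡ b × 48 ℕ.* a ≡ k ℕ.* 48 ℕ.+ l ℕ.* 8) → + 5 ∣ᶻ + b - + a
      conclude (k , l , refl , eq) = divides (+ a - + k) (trans (cong (_- + a) (ℤ.pos-+ k l)) (ℤ.*-cancelˡ-≡ (+ 8) _ _
        (trans (isolate (+ a) (+ k) (+ l)) (trans (cong (λ x → + 8 * (+ k - + a) + (x - + k * + 48)) (sym eqℤ))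
            (collect (+ a) (+ k))))))
        where
        eqℤ : + 48 * + a ≡ + k * + 48 + + l * + 8
        eqℤ = trans (sym (ℤ.pos-* 48 a)) (trans (cong +_ eq) (trans (ℤ.pos-+ (k ℕ.* 48) (l ℕ.* 8))
            (cong₂ _+_ (ℤ.pos-* k 48) (ℤ.pos-* l 8))))
        isolate : ∀ a k l → + 8 * (k + l - a) ≡ + 8 * (k - a) + (k * + 48 + l * + 8 - k * + 48)
        isolate = solve-∀
        collect : ∀ a k → + 8 * (k - a) + (+ 48 * a - k * + 48) ≡ + 8 * ((a - k) * + 5)
        collect = solve-∀

  -- Taking sections gives θ times the left side as θ⁴ modulo 5; multiplication by `signedP̄` then
  -- removes one factor θ on both sides.
  section-signedP̄ : section signedP̄ ≡ θ³ [mod 5ˢ ]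
  section-signedP̄ = mod-trans (≈⇒mod insert) (mod-trans (mod-⊠ (≈⇒mod {f = signedP̄} ≈-refl) sectioned) (≈⇒mod cancel))
    where
    dilated : dilate θ ⊠ signedP̄ ≡ θ⁴ [mod 5ˢ ]
    dilated = mod-trans (mod-⊠ (mod-sym (frobenius θ)) (≈⇒mod {f = signedP̄} ≈-refl)) (≈⇒mod (begin
      θ⁴ ⊠ θ ⊠ signedP̄       ≈⟨ ⊠-assoc θ⁴ θ signedP̄ ⟩
      θ⁴ ⊠ (θ ⊠ signedP̄)     ≈⟨ ⊠-cong {θ⁴} ≈-refl (≈-trans (⊠-comm θ signedP̄) signedP̄-inverse) ⟩
      θ⁴ ⊠ one         ≈⟨ ⊠-identityʳ θ⁴ ⟩
      θ⁴               ∎))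
    sectioned : θ ⊠ section signedP̄ ≡ θ⁴ [mod 5ˢ ]
    sectioned = coefficient-mod5 (λ n → subst (+ 5 ∣ᶻ_)
      (trans (telescope ((dilate θ ⊠ signedP̄) (n ℕ.* 5)) (θ⁴ (n ℕ.* 5)) (θ⁴ n)) (cong (_- θ⁴ n) (dilate-section θ signedP̄ n)))
      (∣m∣n⇒∣m+n (mod5-coefficient dilated (n ℕ.* 5)) (θ⁴-section n)))
      where
      telescope : ∀ a b c → a - b + (b - c) ≡ a - c
      telescope = solve-∀
    insert : section signedP̄ ≈ signedP̄ ⊠ (θ ⊠ section signedP̄)
    insert = begin
      section signedP̄                ≈⟨ ⊠-identityˡ (section signedP̄) ⟨
      one ⊠ section signedP̄          ≈⟨ ⊠-cong {g = section signedP̄} (≈-sym signedP̄-inverse) ≈-refl ⟩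
      signedP̄ ⊠ θ ⊠ section signedP̄        ≈⟨ ⊠-assoc signedP̄ θ (section signedP̄) ⟩
      signedP̄ ⊠ (θ ⊠ section signedP̄)      ∎
    cancel : signedP̄ ⊠ θ⁴ ≈ θ³
    cancel = begin
      signedP̄ ⊠ (θ³ ⊠ θ)             ≈⟨ solve 3 (λ a t u → a :* (t :* u) := t :* (a :* u)) (λ _ → refl) signedP̄ θ³ θ ⟩
      θ³ ⊠ (signedP̄ ⊠ θ)             ≈⟨ ⊠-cong {θ³} ≈-refl signedP̄-inverse ⟩
      θ³ ⊠ one                 ≈⟨ ⊠-identityʳ θ³ ⟩
      θ³                       ∎

  r₃ : ℕ → ℕ
  r₃ n = proj₁ (θ³-counts n)

  r₃-size : ∀ n → (λ x → Quaternions.re x ≡ 0ℤ × norm x ≡ + n) HasSize r₃ n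
  r₃-size n = proj₁ (proj₂ (θ³-counts n))

  p̄-from-r₃ : ∀ n → 5 ℕ.∣ r₃ n → p̄ (n ℕ.* 5) ℕ.% 5 ≡ 0
  p̄-from-r₃ n 5∣r₃ = ℕ.n∣m⇒m%n≡0 (p̄ (n ℕ.* 5)) 5 (∣⇒∣ᵤ {+ 5} {+ p̄ (n ℕ.* 5)} (subst (+ 5 ∣ᶻ_) (twist-twist p̄-series (n ℕ.* 5))
    (∣n⇒∣m*n (sgn (n ℕ.* 5)) (subst (+ 5 ∣ᶻ_) (add-back (section signedP̄ n) (θ³ n))
      (∣m∣n⇒∣m+n (mod5-coefficient section-signedP̄ n) (subst (+ 5 ∣ᶻ_) (sym (proj₂ (proj₂ (θ³-counts n))))
          (∣ᵤ⇒∣ {+ 5} {+ r₃ n} 5∣r₃)))))))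
    where
    add-back : ∀ a b → a - b + b ≡ a
    add-back = solve-∀

  -- The Hecke relation for r₃ along odd powers of p

  module _ {p : ℕ} (p-prime : Prime p) (3≤p : 3 ℕ.≤ p) where
    open Sandwich p-prime 3≤p unit-count using (Pure; pure-count)
    private
      Pᶻ : ℤ
      Pᶻ = + p
      instance
        p≢0 : ℕ.NonZero p
        p≢0 = ℕ.>-nonZero (ℕ.≤-trans (s≤s z≤n) 3≤p)

    +p²* : ∀ n → + (p ℕ.* p ℕ.* n) ≡ Pᶻ * Pᶻ * + n
    +p²* n = trans (ℤ.pos-* (p ℕ.* p) n) (cong (_* + n) (ℤ.pos-* p p))

    -- `pure-count` reads 8 (p + 1) a = 8 (p + 1) k + 8 l with b = k + l. The number `k` is kept
    -- general because it is r₃(n / p²) or 0, according to whether p² divides n.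
    hecke : ∀ {n k} → p ℕ.∣ n → (λ x → (Pure x × norm x ≡ Pᶻ * Pᶻ * + n) × Pᶻ * Pᶻ ∣ᴴ x) HasSize k →
            r₃ (p ℕ.* p ℕ.* n) ℕ.+ p ℕ.* k ≡ suc p ℕ.* r₃ n
    hecke {n} {k} p∣n hk = conclude (pure-count (∣ᵤ⇒∣ {Pᶻ} {+ n} p∣n) (prime-norm-count p-prime 3≤p) (r₃-size n)
      (HasSize-⇔ (λ x (pure , eq) → pure , trans eq (+p²* n)) (λ x (pure , eq) → pure , trans eq (sym (+p²* n)))
          (r₃-size (p ℕ.* p ℕ.* n))) hk)
      where
      conclude : ∀ {a b} → (∃[ l ] k ℕ.+ l ≡ b × suc p ℕ.* 8 ℕ.* a ≡ k ℕ.* (suc p ℕ.* 8) ℕ.+ l ℕ.* 8) → b ℕ.+ p ℕ.* k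
          ≡ suc p ℕ.* a
      conclude {a} (l , refl , eq) = ℕ.*-cancelʳ-≡ _ _ 8 (trans (left k l p) (trans (sym eq) (right a p)))
        where
        left : ∀ k l p → (k ℕ.+ l ℕ.+ p ℕ.* k) ℕ.* 8 ≡ k ℕ.* (suc p ℕ.* 8) ℕ.+ l ℕ.* 8
        left = ℕ.solve-∀
        right : ∀ a p → suc p ℕ.* 8 ℕ.* a ≡ suc p ℕ.* a ℕ.* 8
        right = ℕ.solve-∀

    p²≢0 : ℤ.NonZero (Pᶻ * Pᶻ)
    p²≢0 = ℤ.i*j≢0 Pᶻ Pᶻ

    multiples : ∀ n → (λ x → (Pure x × norm x ≡ Pᶻ * Pᶻ * + (p ℕ.* p ℕ.* n)) × Pᶻ * Pᶻ ∣ᴴ x) HasSize r₃ n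
    multiples n = HasSize-map ((Pᶻ * Pᶻ) Quaternions.•_)
      (λ y (pure , eq) → (trans (re-• (Pᶻ * Pᶻ) y) (trans (cong (λ x → Pᶻ * Pᶻ * x) pure) (ℤ.*-zeroʳ (Pᶻ * Pᶻ))) ,
        trans (norm-• (Pᶻ * Pᶻ) y) (trans (cong (λ x → Pᶻ * Pᶻ * (Pᶻ * Pᶻ) * x) eq) (regroup (+ n)))) , y , refl)
      (λ x y _ _ → •-cancel (Pᶻ * Pᶻ) {{p²≢0}})
      (λ { _ ((pure , eq) , y , refl) → y , (ℤ.*-cancelˡ-≡ (Pᶻ * Pᶻ) (Quaternions.re y) 0ℤ {{p²≢0}}
          (trans (sym (re-• (Pᶻ * Pᶻ) y)) (trans pure (sym (ℤ.*-zeroʳ (Pᶻ * Pᶻ))))) ,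
        ℤ.*-cancelˡ-≡ (Pᶻ * Pᶻ * (Pᶻ * Pᶻ)) (norm y) (+ n) {{ℤ.i*j≢0 (Pᶻ * Pᶻ) (Pᶻ * Pᶻ) {{p²≢0}} {{p²≢0}}}}
            (trans (sym (norm-• (Pᶻ * Pᶻ) y)) (trans eq (sym (regroup (+ n)))))) , refl })
      (r₃-size n)
      where
      regroup : ∀ x → Pᶻ * Pᶻ * (Pᶻ * Pᶻ) * + n ≡ Pᶻ * Pᶻ * + (p ℕ.* p ℕ.* n)
      regroup _ = trans (ℤ.*-assoc (Pᶻ * Pᶻ) (Pᶻ * Pᶻ) (+ n)) (cong (λ x → Pᶻ * Pᶻ * x) (sym (+p²* n)))

    -- The norm of a multiple of p² is divisible by p⁴, but p³ N is not.
    no-multiples : ∀ N → ¬ p ℕ.∣ N → (λ x → (Pure x × norm x ≡ Pᶻ * Pᶻ * + (p ℕ.* N)) × Pᶻ * Pᶻ ∣ᴴ x) HasSize 0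
    no-multiples N p∤N = HasSize-∅ (λ { _ ((_ , eq) , y , refl) → p∤N (∣⇒∣ᵤ {Pᶻ} {+ N} (divides (norm y)
      (ℤ.*-cancelˡ-≡ (Pᶻ * Pᶻ * Pᶻ) (+ N) (norm y * Pᶻ) {{ℤ.i*j≢0 (Pᶻ * Pᶻ) Pᶻ {{p²≢0}}}}
        (trans (trans (ℤ.*-assoc (Pᶻ * Pᶻ) Pᶻ (+ N)) (cong (λ x → Pᶻ * Pᶻ * x) (sym (ℤ.pos-* p N))))
          (trans (sym (trans (sym (norm-• (Pᶻ * Pᶻ) y)) eq)) (regroup Pᶻ (norm y))))))) })
      where
      regroup : ∀ p m → p * p * (p * p) * m ≡ p * p * p * (m * p)
      regroup = solve-∀

    module _ (N : ℕ) (p∤N : ¬ p ℕ.∣ N) where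
      odd-power : ℕ → ℕ
      odd-power zero    = p ℕ.* N
      odd-power (suc j) = p ℕ.* p ℕ.* odd-power j

      p∣odd-power : ∀ j → p ℕ.∣ odd-power j
      p∣odd-power zero    = ℕ.m∣m*n N
      p∣odd-power (suc j) = ℕ.∣m⇒∣m*n (odd-power j) (ℕ.m∣m*n p)

      u : ℕ → ℕ
      u j = r₃ (odd-power j)

      -- The Hecke relation says that `u (j + 1) - p u j` does not depend on `j`. Its value is
      -- `u 0`, since for the lowest power there are no multiples of p² to subtract.
      u-recurrence : ∀ j → u (suc j) ≡ p ℕ.* u j ℕ.+ u 0
      u-recurrence zero    = trans (sym (trans (cong (λ x → u 1 ℕ.+ x) (ℕ.*-zeroʳ p)) (ℕ.+-identityʳ (u 1))))
          (trans (hecke (p∣odd-power 0) (no-multiples N p∤N)) (ℕ.+-comm (u 0) (p ℕ.* u 0)))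
      u-recurrence (suc j) = ℕ.+-cancelʳ-≡ (p ℕ.* u j) (u (suc (suc j))) (p ℕ.* u (suc j) ℕ.+ u 0)
          (trans (hecke (p∣odd-power (suc j)) (multiples (odd-power j)))
        (trans (cong (λ x → x ℕ.+ p ℕ.* u (suc j)) (u-recurrence j)) (rearrange (p ℕ.* u j) (u 0) (p ℕ.* u (suc j)))))
        where
        rearrange : ∀ a b c → a ℕ.+ b ℕ.+ c ≡ c ℕ.+ b ℕ.+ a
        rearrange = ℕ.solve-∀

      odd-power-^ : ∀ j → odd-power j ≡ p ℕ.^ (j ℕ.+ j ℕ.+ 1) ℕ.* N
      odd-power-^ zero    = cong (ℕ._* N) (sym (ℕ.*-identityʳ p))
      odd-power-^ (suc j) = trans (cong (p ℕ.* p ℕ.*_) (odd-power-^ j)) (trans (rearrange p (p ℕ.^ (j ℕ.+ j ℕ.+ 1)) N)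
        (cong (λ k → p ℕ.^ (suc k ℕ.+ 1) ℕ.* N) (sym (ℕ.+-suc j j))))
        where
        rearrange : ∀ p x n → p ℕ.* p ℕ.* (x ℕ.* n) ≡ p ℕ.* (p ℕ.* x) ℕ.* n
        rearrange = ℕ.solve-∀

      p̄-odd-power : ∀ j k → j ℕ.+ j ℕ.+ 1 ≡ k → 5 ℕ.∣ u j → p̄ (5 ℕ.* p ℕ.^ k ℕ.* N) ℕ.% 5 ≡ 0
      p̄-odd-power j k refl 5∣u = subst (λ m → p̄ m ℕ.% 5 ≡ 0)
        (trans (cong (ℕ._* 5) (odd-power-^ j)) (rearrange (p ℕ.^ (j ℕ.+ j ℕ.+ 1)) N)) (p̄-from-r₃ (odd-power j) 5∣u)
        where
        rearrange : ∀ x n → x ℕ.* n ℕ.* 5 ≡ 5 ℕ.* x ℕ.* n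
        rearrange = ℕ.solve-∀

-- Residue classes of p and exponents

open Recurrences
open Congruences
open import Data.Nat using (_+_; _*_; _^_; _%_; _≤_)

theorem4 : ∀ (p N α : ℕ) → Prime p → 3 ≤ p → 1 ≤ N → Coprime N p →
    (p % 5 ≡ 1 → p̄ (5 * p ^ (10 * α + 9) * N) % 5 ≡ 0)
    × ((p % 5 ≡ 2) ⊎ (p % 5 ≡ 3) ⊎ (p % 5 ≡ 4) →
    p̄ (5 * p ^ (8 * α + 7) * N) % 5 ≡ 0)
theorem4 p N α p-prime 3≤p _ coprime =
  -- `odd-power j` contains p^(2j+1), so j = 5 α + 4 and j = 4 α + 3 yield the two exponents.
  (λ p%5 → p̄-odd-power p-prime 3≤p N p∤N (α * 5 + 4) (10 * α + 9) (exponent₁ α)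
    (5∣period-5 (5∣sum-5 p p%5) α)) ,
  (λ p%5 → p̄-odd-power p-prime 3≤p N p∤N (α * 4 + 3) (8 * α + 7) (exponent₂ α)
    (5∣period-4 (sum-4 p%5) α))
  where
  p∤N : ¬ p ℕ.∣ N
  p∤N p∣N = ℕ.<⇒≢ (ℕ.≤-trans (s≤s (s≤s z≤n)) 3≤p) (sym (coprime (p∣N , ℕ.∣-refl)))
  open GeometricSums p (u p-prime 3≤p N p∤N) (u-recurrence p-prime 3≤p N p∤N)
  exponent₁ : ∀ α → α * 5 + 4 + (α * 5 + 4) + 1 ≡ 10 * α + 9
  exponent₁ = ℕ.solve-∀
  exponent₂ : ∀ α → α * 4 + 3 + (α * 4 + 3) + 1 ≡ 8 * α + 7
  exponent₂ = ℕ.solve-∀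
  sum-4 : (p % 5 ≡ 2) ⊎ (p % 5 ≡ 3) ⊎ (p % 5 ≡ 4) → 5 ℕ.∣ 1 + p + p * p + p * p * p
  -- 1 + r + r² + r³ is 15, 40 and 85 for r = 2, 3 and 4.
  sum-4 (inj₁ eq)        = 5∣sum-4 p eq (ℕ.divides 3 refl)
  sum-4 (inj₂ (inj₁ eq)) = 5∣sum-4 p eq (ℕ.divides 8 refl)
  sum-4 (inj₂ (inj₂ eq)) = 5∣sum-4 p eq (ℕ.divides 17 refl)
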